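{- The equational logic $\mathcal{L}_{\mathrm{eq}}$ is sound. Moreover, for all $\eta, \eta' \in [\![\Gamma]\!]$ with $\eta \sim_\Gamma \eta'$: if $\Gamma \vdash v \equiv_A v'$ is derivable in $\mathcal{L}_{\mathrm{eq}}$ then $[\![\Gamma\vdash v:A]\!]\eta \sim_A [\![\Gamma\vdash v':A]\!]\eta'$, and if $\Gamma \vdash c \equiv_{\underline{C}} c'$ is derivable then $[\![\Gamma\vdash c:\underline{C}]\!]\eta \sim_{\underline{C}} [\![\Gamma\vdash c':\underline{C}]\!]\eta'$.
   Context: Calculus. Values $v ::= x \mid () \mid \mathtt{true} \mid \mathtt{false} \mid \mathtt{fun}\,x\mapsto c \mid \mathtt{handler}\,\{\mathtt{return}\,x \mapsto c_r;\ h\}$; computations $c ::= \mathtt{if}\ v\ \mathtt{then}\ c_1\ \mathtt{else}\ c_2 \mid v_1\,v_2 \mid \mathtt{return}\ v \mid \mathit{op}(v; y.c) \mid \mathtt{do}\ x \leftarrow c_1\ \mathtt{in}\ c_2 \mid \mathtt{with}\ v\ \mathtt{handle}\ c$; operation clauses $h$ are finite sets of clauses $\mathit{op}(x;k)\mapsto c_{\mathit{op}}$, at most one per symbol. Value types $A,B ::= \mathtt{unit}\mid \mathtt{bool} \mid A \to \underline{C} \mid \underline{C}\Rightarrow \underline{D}$; computation types $\underline{C} ::= A\,!\,\Sigma/\mathcal{E}$, with $\Sigma$ a finite set of declarations $\mathit{op}: A_{\mathit{op}} \to B_{\mathit{op}}$ and $\mathcal{E}$ a finite set of equations $(x_i:A_i)_i;(z_j:B_j\to*)_j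 \vdash T_1 \sim T_2$ between templates $T ::= z\,v \mid \mathtt{if}\ v\ \mathtt{then}\ T_1\ \mathtt{else}\ T_2 \mid \mathit{op}(v; y.T)$. Instantiation $T[f_j/z_j]_j$: $(z_j\,v)\mapsto f_j\,v$, commuting with $\mathtt{if}$ and $\mathit{op}(v;y.-)$. Typing (mutually defined; $A\,!\,\Sigma/\mathcal E$ well-formed iff both templates of each equation are well-typed w.r.t. $\Sigma$). Values: variables from context; $()$ : unit; $\mathtt{true},\mathtt{false}$ : bool; $\mathtt{fun}\,x\mapsto c:A\to\underline C$ if $\Gamma,x:A\vdash c:\underline C$; $\mathtt{handler}\{\mathtt{return}\,x\mapsto c_r;h\}: A\,!\,\Sigma/\mathcal E\Rightarrow\underline D$ if $\Gamma,x:A\vdash c_r:\underline D$ and $\Gamma\vdash h\models\mathcal E:\Sigma\rightrightarrows\underline D$. Computations: $\mathtt{if}$ : $\underline C$ if guard bool and branches $\underline C$; $v_1\,v_2:\underline C$ if $v_1:A\to\underline C$, $v_2:A$; $\mathtt{return}\,v:A\,!\,\Sigma/\mathcal E$ if $v:A$; $\mathit{op}(v;y.c):A\,!\,\Sigma/\mathcal E$ if $(\mathit{op}:A_{op}\to B_{op})\in\Sigma$, $v:A_{op}$, $\Gamma,y:B_{op}\vdash c:A\,!\,\Sigma/\mathcal E$; $\mathtt{do}\,x\leftarrow c_1\,\mathtt{in}\,c_2:B\,!\,\Sigma/\mathcal E$ if $c_1:A\,!\,\Sigma/\mathcal E$, $\Gamma,x:A\vdash c_2:B\,!\,\Sigma/\mathcal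 E$; $\mathtt{with}\,v\,\mathtt{handle}\,c:\underline D$ if $v:\underline C\Rightarrow\underline D$, $c:\underline C$. Clauses: $\Gamma\vdash h:\Sigma\rightrightarrows\underline D$ iff exactly one clause per operation of $\Sigma$ and no others, with $\Gamma,x:A_{op},k:B_{op}\to\underline D\vdash c_{op}:\underline D$. Templates: $z\,v$ if $(z:A\to*)\in Z$, $v:A$; conditionals; $\mathit{op}(v;y.T)$ if $(\mathit{op}:A\to B)\in\Sigma$, $v:A$, $T$ well-typed with $y:B$ added. A logic is a choice of the judgment $\Gamma\vdash h\models\mathcal E:\Sigma\rightrightarrows\underline D$ (holding only when $\Gamma\vdash h:\Sigma\rightrightarrows\underline D$ and $\mathcal E$ well-formed w.r.t. $\Sigma$). The logic $\mathcal L_{\mathrm{eq}}$: simultaneously with typing, it defines judgments $\Gamma\vdash v_1\equiv_A v_2$ and $\Gamma\vdash c_1\equiv_{\underline C}c_2$ (for well-typed terms) closed under reflexivity, symmetry, transitivity, substitution, congruence for each term constructor, and the $\beta\eta$-equivalences of the calculus (including e.g. $\mathtt{do}\,x\leftarrow\mathtt{return}\,v\,\mathtt{in}\,c\equiv c[v/x]$, $\mathtt{do}\,x\leftarrow\mathit{op}(v;y.c_1)\,\mathtt{in}\,c_2\equiv\mathit{op}(v;y.\mathtt{do}\,x\leftarrow c_1\,\mathtt{in}\,c_2)$, function $\beta$, and the conditional reductions), plus: (inheritance) if $((x_i:A_i)_i;(z_j:B_j\to*)_j\vdash T_1\sim T_2)\in\mathcal E$, $\Gamma\vdash v_i:A_i$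 and $\Gamma\vdash f_j:B_j\to A\,!\,\Sigma/\mathcal E$, then $\Gamma\vdash (T_1[f_j/z_j]_j)[v_i/x_i]_i\equiv_{A!\Sigma/\mathcal E}(T_2[f_j/z_j]_j)[v_i/x_i]_i$. Its handler judgment is: $\Gamma\vdash h\models\emptyset:\Sigma\rightrightarrows\underline D$ whenever $\Gamma\vdash h:\Sigma\rightrightarrows\underline D$; and $\Gamma\vdash h\models\mathcal E\cup\{(x_i:A_i)_i;(z_j:B_j\to*)_j\vdash T_1\sim T_2\}:\Sigma\rightrightarrows\underline D$ if $\Gamma\vdash h\models\mathcal E:\Sigma\rightrightarrows\underline D$ and $\Gamma,(x_i:A_i)_i,(f_j:B_j\to\underline D)_j\vdash T_1^h[f_j/z_j]_j\equiv_{\underline D}T_2^h[f_j/z_j]_j$, where for $h=\{\mathit{op}(x;k)\mapsto c_{op}\}_{op}$: $(z_i\,v)^h[f_j/z_j]_j=f_i\,v$, $(\mathtt{if}\,v\,\mathtt{then}\,T_1\,\mathtt{else}\,T_2)^h[\dots]=\mathtt{if}\,v\,\mathtt{then}\,T_1^h[\dots]\,\mathtt{else}\,T_2^h[\dots]$, $(\mathit{op}(v;y.T))^h[f_j/z_j]_j=c_{op}[v/x,(\mathtt{fun}\,y\mapsto T^h[f_j/z_j]_j)/k]$. Denotational semantics. $[\![\mathtt{unit}]\!]=\{\star\}$, $[\![\mathtt{bool}]\!]=\{\mathrm{ff},\mathrm{tt}\}$, $[\![A\to\underline C]\!]=[\![A]\!]\to[\![\underline C]\!]$, $[\![\underline C\Rightarrow\underline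 D]\!]=[\![\underline C]\!]\to[\![\underline D]\!]$, $[\![A\,!\,\Sigma/\mathcal E]\!]=[\![\Sigma]\!][\![A]\!]$, the inductive set generated by $\mathrm{in}_{\mathrm{ret}}(a)$ and $\mathrm{in}_{op}(a;\kappa)$ ($\mathit{op}\in\Sigma$, $a\in[\![A_{op}]\!]$, $\kappa:[\![B_{op}]\!]\to[\![\Sigma]\!][\![A]\!]$). Interpretations $H_{op}:[\![A_{op}]\!]\times([\![B_{op}]\!]\to Y)\to Y$; free interpretation $F^X_\Sigma$ uses $\mathrm{in}_{op}$; lift $f^\dagger_H(\mathrm{in}_{\mathrm{ret}}(x))=f(x)$, $f^\dagger_H(\mathrm{in}_{op}(a;\kappa))=H_{op}(a,f^\dagger_H\circ\kappa)$. Terms ($\eta\in[\![\Gamma]\!]$, a product): variables are projections; constants as expected; $[\![\mathtt{fun}\,x\mapsto c]\!]\eta=\lambda a.[\![c]\!](\eta,a)$; $([\![h]\!]\eta)_{op}(a,\kappa)=[\![c_{op}]\!](\eta,a,\kappa)$; $[\![\mathtt{handler}\{\mathtt{return}\,x\mapsto c_r;h\}]\!]\eta=(\lambda a.[\![c_r]\!](\eta,a))^\dagger_{[\![h]\!]\eta}$; $\mathtt{if}$ by cases; application; $[\![\mathtt{return}\,v]\!]\eta=\mathrm{in}_{\mathrm{ret}}([\![v]\!]\eta)$; $[\![\mathit{op}(v;y.c)]\!]\eta=\mathrm{in}_{op}([\![v]\!]\eta;\lambda b.[\![c]\!](\eta,b))$; $[\![\mathtt{do}\,x\leftarrow c_1\,\mathtt{in}\,c_2]\!]\eta=(\lambda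 a.[\![c_2]\!](\eta,a))^\dagger_{F^{[\![A]\!]}_\Sigma}([\![c_1]\!]\eta)$; $[\![\mathtt{with}\,v\,\mathtt{handle}\,c]\!]\eta=[\![v]\!]\eta([\![c]\!]\eta)$. Templates: $[\![z_j\,v]\!]_H(\eta;\zeta)=\zeta_j([\![v]\!]\eta)$, conditionals by cases, $[\![\mathit{op}(v;y.T)]\!]_H(\eta;\zeta)=H_{op}([\![v]\!]\eta,\lambda b.[\![T]\!]_H((\eta,b);\zeta))$. Relations. Identity on $[\![\mathtt{unit}]\!]$, $[\![\mathtt{bool}]\!]$; $f\sim_{A\to\underline C}f'$ iff $a\sim_A a'$ implies $f(a)\sim_{\underline C}f'(a')$; $h\sim_{\underline C\Rightarrow\underline D}h'$ iff $t\sim_{\underline C}t'$ implies $h(t)\sim_{\underline D}h'(t')$; for $\underline C=A\,!\,\Sigma/\mathcal E$, $\sim_{\underline C}$ is the smallest symmetric, transitive relation such that $a\sim_A a'\Rightarrow\mathrm{in}_{\mathrm{ret}}(a)\sim\mathrm{in}_{\mathrm{ret}}(a')$; $a\sim_{A_{op}}a'$, $f\sim_{B_{op}\to\underline C}f'\Rightarrow\mathrm{in}_{op}(a;f)\sim\mathrm{in}_{op}(a';f')$; for each equation $(x_i:A_i)_i;(z_j:B_j\to*)_j\vdash T_1\sim T_2$ in $\mathcal E$, $a_i\sim a_i'$, $f_j\sim_{B_j\to\underline C}f_j'\Rightarrow[\![T_1]\!]_{F^{[\![A]\!]}_\Sigma}((a_i);(f_j))\sim[\![T_2]\!]_{F^{[\![A]\!]}_\Sigma}((a_i');(f_j'))$.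 $\sim_\Gamma$ is componentwise. Soundness: a logic is sound if whenever $\Gamma\vdash h\models\mathcal E:\Sigma\rightrightarrows\underline D$, for every equation $(x_i:A_i)_i;(z_j:B_j\to*)_j\vdash T_1\sim T_2$ in $\mathcal E$, all $\eta\sim_\Gamma\eta'$, $a_i\sim_{A_i}a_i'$, $f_j\sim_{B_j\to\underline D}f_j'$: $[\![T_1]\!]_{[\![h]\!]\eta}((a_i);(f_j))\sim_{\underline D}[\![T_2]\!]_{[\![h]\!]\eta'}((a_i');(f_j'))$. -}

module Defs where

open import Data.Nat.Base using (ℕ; zero; suc; _+_; _≡ᵇ_)
open import Data.Fin.Base using (Fin; toℕ) renaming (zero to fzero; suc to fsuc)
open import Data.Bool.Base using (Bool; true; false; T; not; _∧_; if_then_else_)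
open import Data.List.Base using (List; []; _∷_; map; length; lookup; _++_)
open import Data.List.Relation.Binary.Pointwise using (Pointwise)
open import Data.List.Relation.Unary.All using (All)
open import Data.List.Membership.Propositional using (_∈_)
open import Data.Maybe.Base using (Maybe; just; nothing; maybe′)
open import Data.Product using (Σ; Σ-syntax; _×_; _,_; proj₁; proj₂)
open import Data.Unit.Base using (⊤; tt)
open import Relation.Binary.PropositionalEquality using (_≡_)

-- Raw syntax (de Bruijn indices; variable 0 is the innermost binder)

OpName : Set
OpName = ℕ

elem : ℕ → List ℕ → Bool
elem x [] = false
elem x (y ∷ ys) = if x ≡ᵇ y then true else elem x ys

distinct : List ℕ → Bool
distinct [] = true
distinct (x ∷ xs) = not (elem x xs) ∧ distinct xs

mutual
  data Val : Set where
    var      : ℕ → Val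
    unitV    : Val
    trueV    : Val
    falseV   : Val
    fun      : Comp → Val                -- fun x ↦ c      (binds x)
    handler  : Comp → Clauses → Val      -- handler {return x ↦ c_r ; h}  (c_r binds x)

  data Comp : Set where
    ifC    : Val → Comp → Comp → Comp
    app    : Val → Val → Comp
    ret    : Val → Comp
    opC    : OpName → Val → Comp → Comp  -- op(v; y.c)       (c binds y)
    doC    : Comp → Comp → Comp          -- do x ← c₁ in c₂  (c₂ binds x)
    withC  : Val → Comp → Comp

  -- operation clauses  op(x;k) ↦ c_op ; the body binds x (index 1) and k (index 0)
  Clauses : Set
  Clauses = List (OpName × Comp)

-- templates; value variables of a template refer to the equation context
-- (index i ↦ x_i) extended by the binders y of op(v; y.T);
-- zapp j v is the application z_j v of the j-th template variable.
data Tmpl : Set where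
  zapp : ℕ → Val → Tmpl
  tif  : Val → Tmpl → Tmpl → Tmpl
  top  : OpName → Val → Tmpl → Tmpl

mutual
  data VTy : Set where
    unit : VTy
    bool : VTy
    _⇾_  : VTy → CTy → VTy
    _⇛_  : CTy → CTy → VTy

  -- A ! Σ / E ; Σ is a finite list of declarations op : A_op → B_op with
  -- pairwise distinct names, E a finite list of equations
  data CTy : Set where
    comp : VTy → (Sg : List (OpName × VTy × VTy)) → T (distinct (map proj₁ Sg)) → List Eqn → CTy

  -- (x_i : A_i)_i ; (z_j : B_j → *)_j ⊢ T₁ ∼ T₂
  data Eqn : Set where
    eqn : (xs zs : List VTy) → Tmpl → Tmpl → Eqn

Sig : Set
Sig = List (OpName × VTy × VTy)

Ctx : Set
Ctx = List VTy

OpIx : Sig → Set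
OpIx Sg = Fin (length Sg)

nameOf : (Sg : Sig) → OpIx Sg → OpName
nameOf Sg i = proj₁ (lookup Sg i)

argOf : (Sg : Sig) → OpIx Sg → VTy
argOf Sg i = proj₁ (proj₂ (lookup Sg i))

resOf : (Sg : Sig) → OpIx Sg → VTy
resOf Sg i = proj₂ (proj₂ (lookup Sg i))

eqXs eqZs : Eqn → List VTy
eqXs (eqn xs zs T₁ T₂) = xs
eqZs (eqn xs zs T₁ T₂) = zs

eqL eqR : Eqn → Tmpl
eqL (eqn xs zs T₁ T₂) = T₁
eqR (eqn xs zs T₁ T₂) = T₂

lookupCl : Clauses → OpName → Maybe Comp
lookupCl [] o = nothing
lookupCl ((o' , c) ∷ h) o = if o ≡ᵇ o' then just c else lookupCl h o

Ren : Set
Ren = ℕ → ℕ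

extR : Ren → Ren
extR ρ zero = zero
extR ρ (suc n) = suc (ρ n)

mutual
  renV : Ren → Val → Val
  renV ρ (var n) = var (ρ n)
  renV ρ unitV = unitV
  renV ρ trueV = trueV
  renV ρ falseV = falseV
  renV ρ (fun c) = fun (renC (extR ρ) c)
  renV ρ (handler c h) = handler (renC (extR ρ) c) (renH ρ h)

  renC : Ren → Comp → Comp
  renC ρ (ifC v c₁ c₂) = ifC (renV ρ v) (renC ρ c₁) (renC ρ c₂)
  renC ρ (app v₁ v₂) = app (renV ρ v₁) (renV ρ v₂)
  renC ρ (ret v) = ret (renV ρ v)
  renC ρ (opC o v c) = opC o (renV ρ v) (renC (extR ρ) c)
  renC ρ (doC c₁ c₂) = doC (renC ρ c₁) (renC (extR ρ) c₂)
  renC ρ (withC v c) = withC (renV ρ v) (renC ρ c)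

  renH : Ren → Clauses → Clauses
  renH ρ [] = []
  renH ρ ((o , c) ∷ h) = (o , renC (extR (extR ρ)) c) ∷ renH ρ h

Subst : Set
Subst = ℕ → Val

extS : Subst → Subst
extS σ zero = var zero
extS σ (suc n) = renV suc (σ n)

mutual
  subV : Subst → Val → Val
  subV σ (var n) = σ n
  subV σ unitV = unitV
  subV σ trueV = trueV
  subV σ falseV = falseV
  subV σ (fun c) = fun (subC (extS σ) c)
  subV σ (handler c h) = handler (subC (extS σ) c) (subH σ h)

  subC : Subst → Comp → Comp
  subC σ (ifC v c₁ c₂) = ifC (subV σ v) (subC σ c₁) (subC σ c₂)
  subC σ (app v₁ v₂) = app (subV σ v₁) (subV σ v₂)
  subC σ (ret v) = ret (subV σ v)
  subC σ (opC o v c) = opC o (subV σ v) (subC (extS σ) c)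
  subC σ (doC c₁ c₂) = doC (subC σ c₁) (subC (extS σ) c₂)
  subC σ (withC v c) = withC (subV σ v) (subC σ c)

  subH : Subst → Clauses → Clauses
  subH σ [] = []
  subH σ ((o , c) ∷ h) = (o , subC (extS (extS σ)) c) ∷ subH σ h

_•_ : Val → Subst → Subst
(w • σ) zero = w
(w • σ) (suc n) = σ n
infixr 5 _•_

_[_]C : Comp → Val → Comp
c [ w ]C = subC (w • var) c

_[_]V : Val → Val → Val
v [ w ]V = subV (w • var) v

listS : List Val → Subst
listS [] n = var n
listS (v ∷ vs) zero = v
listS (v ∷ vs) (suc n) = listS vs n

inst : Subst → (ℕ → Val) → Tmpl → Comp
inst σ φ (zapp j v) = app (φ j) (subV σ v)
inst σ φ (tif v T₁ T₂) = ifC (subV σ v) (inst σ φ T₁) (inst σ φ T₂)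
inst σ φ (top o v T) = opC o (subV σ v) (inst (extS σ) (λ j → renV suc (φ j)) T)

-- handler translation  T^h[f_j/z_j]_j :
-- σ : template value variables, φ j : f_j, γ : variables of the handler
-- context Γ (as seen from the current context)
hT : Clauses → Subst → (ℕ → Val) → Subst → Tmpl → Comp
hT h σ φ γ (zapp j v) = app (φ j) (subV σ v)
hT h σ φ γ (tif v T₁ T₂) = ifC (subV σ v) (hT h σ φ γ T₁) (hT h σ φ γ T₂)
hT h σ φ γ (top o v T) =
  maybe′ (λ cop → subC (fun (hT h (extS σ) (λ j → renV suc (φ j)) (λ n → renV suc (γ n)) T)
                         • subV σ v • γ) cop)
         (ret unitV)
         (lookupCl h o)

-- T^h[f_j/z_j]_j in the context  Γ, (x_i : A_i)_i, (f_j : B_j → D)_j , which in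
-- de Bruijn form is  (map (_⇾ D) zs) ++ xs ++ Γ  (f_j = variable j,
-- x_i = variable (|zs| + i)).
hInst : Clauses → (xs zs : List VTy) → Tmpl → Comp
hInst h xs zs T = hT h (λ i → var (length zs + i)) var (λ n → var (length zs + length xs + n)) T

data _∋_∶_ : Ctx → ℕ → VTy → Set where
  here  : ∀ {Γ A} → (A ∷ Γ) ∋ zero ∶ A
  there : ∀ {Γ A B n} → Γ ∋ n ∶ A → (B ∷ Γ) ∋ suc n ∶ A

infix 3 _⊢v_∶_ _⊢c_∶_ _⊢h_∶_⇉_ _⊢_⊨_∶_⇉_ _⊢v_≈_∶_ _⊢c_≈_∶_

mutual
  data _⊢v_∶_ : Ctx → Val → VTy → Set where
    varT     : ∀ {Γ n A} → Γ ∋ n ∶ A → Γ ⊢v var n ∶ A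
    unitT    : ∀ {Γ} → Γ ⊢v unitV ∶ unit
    trueT    : ∀ {Γ} → Γ ⊢v trueV ∶ bool
    falseT   : ∀ {Γ} → Γ ⊢v falseV ∶ bool
    funT     : ∀ {Γ A C c} → (A ∷ Γ) ⊢c c ∶ C → Γ ⊢v fun c ∶ A ⇾ C
    handlerT : ∀ {Γ A Sg u E D cr h} →
               (A ∷ Γ) ⊢c cr ∶ D → Γ ⊢ h ⊨ E ∶ Sg ⇉ D →
               Γ ⊢v handler cr h ∶ comp A Sg u E ⇛ D

  data _⊢c_∶_ : Ctx → Comp → CTy → Set where
    ifT   : ∀ {Γ v c₁ c₂ C} → Γ ⊢v v ∶ bool → Γ ⊢c c₁ ∶ C → Γ ⊢c c₂ ∶ C → Γ ⊢c ifC v c₁ c₂ ∶ C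
    appT  : ∀ {Γ v₁ v₂ A C} → Γ ⊢v v₁ ∶ A ⇾ C → Γ ⊢v v₂ ∶ A → Γ ⊢c app v₁ v₂ ∶ C
    retT  : ∀ {Γ v A Sg u E} → Γ ⊢v v ∶ A → Γ ⊢c ret v ∶ comp A Sg u E
    opT   : ∀ {Γ o v c A Sg u E} (i : OpIx Sg) → nameOf Sg i ≡ o →
            Γ ⊢v v ∶ argOf Sg i → (resOf Sg i ∷ Γ) ⊢c c ∶ comp A Sg u E →
            Γ ⊢c opC o v c ∶ comp A Sg u E
    doT   : ∀ {Γ c₁ c₂ A B Sg u E} → Γ ⊢c c₁ ∶ comp A Sg u E → (A ∷ Γ) ⊢c c₂ ∶ comp B Sg u E →
            Γ ⊢c doC c₁ c₂ ∶ comp B Sg u E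
    withT : ∀ {Γ v c C D} → Γ ⊢v v ∶ C ⇛ D → Γ ⊢c c ∶ C → Γ ⊢c withC v c ∶ D

  data ClauseFor (Γ : Ctx) (h : Clauses) (o : OpName) (A B : VTy) (D : CTy) : Set where
    clause : (c : Comp) → lookupCl h o ≡ just c → ((B ⇾ D) ∷ A ∷ Γ) ⊢c c ∶ D →
             ClauseFor Γ h o A B D

  data _⊢h_∶_⇉_ : Ctx → Clauses → Sig → CTy → Set where
    clausesT : ∀ {Γ h Sg D} → T (distinct (map proj₁ h)) →
               ((i : OpIx Sg) → ClauseFor Γ h (nameOf Sg i) (argOf Sg i) (resOf Sg i) D) →
               All (λ cl → Σ[ i ∈ OpIx Sg ] nameOf Sg i ≡ proj₁ cl) h →
               Γ ⊢h h ∶ Sg ⇉ D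

  data TmplTy (Sg : Sig) (zs : List VTy) : Ctx → Tmpl → Set where
    tzT   : ∀ {Γ n v} (j : Fin (length zs)) → toℕ j ≡ n → Γ ⊢v v ∶ lookup zs j →
            TmplTy Sg zs Γ (zapp n v)
    tifT  : ∀ {Γ v T₁ T₂} → Γ ⊢v v ∶ bool → TmplTy Sg zs Γ T₁ → TmplTy Sg zs Γ T₂ →
            TmplTy Sg zs Γ (tif v T₁ T₂)
    topT  : ∀ {Γ o v T} (i : OpIx Sg) → nameOf Sg i ≡ o → Γ ⊢v v ∶ argOf Sg i →
            TmplTy Sg zs (resOf Sg i ∷ Γ) T → TmplTy Sg zs Γ (top o v T)

  data _⊢_⊨_∶_⇉_ : Ctx → Clauses → List Eqn → Sig → CTy → Set where
    ⊨[] : ∀ {Γ h Sg D} → Γ ⊢h h ∶ Sg ⇉ D → Γ ⊢ h ⊨ [] ∶ Sg ⇉ D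
    ⊨∷  : ∀ {Γ h E Sg D xs zs T₁ T₂} → Γ ⊢ h ⊨ E ∶ Sg ⇉ D →
          TmplTy Sg zs xs T₁ → TmplTy Sg zs xs T₂ →
          (map (_⇾ D) zs ++ xs ++ Γ) ⊢c hInst h xs zs T₁ ≈ hInst h xs zs T₂ ∶ D →
          Γ ⊢ h ⊨ (eqn xs zs T₁ T₂ ∷ E) ∶ Sg ⇉ D

  data ClauseEqFor (Γ : Ctx) (h h' : Clauses) (o : OpName) (A B : VTy) (D : CTy) : Set where
    clauseEq : ∀ {c c'} → lookupCl h o ≡ just c → lookupCl h' o ≡ just c' →
               ((B ⇾ D) ∷ A ∷ Γ) ⊢c c ≈ c' ∶ D → ClauseEqFor Γ h h' o A B D

  data _⊢v_≈_∶_ : Ctx → Val → Val → VTy → Set where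
    reflV   : ∀ {Γ v A} → Γ ⊢v v ∶ A → Γ ⊢v v ≈ v ∶ A
    symV    : ∀ {Γ v v' A} → Γ ⊢v v ≈ v' ∶ A → Γ ⊢v v' ≈ v ∶ A
    transV  : ∀ {Γ v v' v'' A} → Γ ⊢v v ≈ v' ∶ A → Γ ⊢v v' ≈ v'' ∶ A → Γ ⊢v v ≈ v'' ∶ A
    substV  : ∀ {Γ w A v v' B} → Γ ⊢v w ∶ A → (A ∷ Γ) ⊢v v ≈ v' ∶ B →
              Γ ⊢v v [ w ]V ≈ v' [ w ]V ∶ B
    funV≡   : ∀ {Γ A C c c'} → (A ∷ Γ) ⊢c c ≈ c' ∶ C → Γ ⊢v fun c ≈ fun c' ∶ A ⇾ C
    handlerV≡ : ∀ {Γ A Sg u E D cr cr' h h'} →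
              Γ ⊢ h ⊨ E ∶ Sg ⇉ D → Γ ⊢ h' ⊨ E ∶ Sg ⇉ D →
              (A ∷ Γ) ⊢c cr ≈ cr' ∶ D →
              ((i : OpIx Sg) → ClauseEqFor Γ h h' (nameOf Sg i) (argOf Sg i) (resOf Sg i) D) →
              Γ ⊢v handler cr h ≈ handler cr' h' ∶ comp A Sg u E ⇛ D
    funη    : ∀ {Γ v A C} → Γ ⊢v v ∶ A ⇾ C → Γ ⊢v fun (app (renV suc v) (var zero)) ≈ v ∶ A ⇾ C
    unitη   : ∀ {Γ v} → Γ ⊢v v ∶ unit → Γ ⊢v v ≈ unitV ∶ unit

  data _⊢c_≈_∶_ : Ctx → Comp → Comp → CTy → Set where
    reflC   : ∀ {Γ c C} → Γ ⊢c c ∶ C → Γ ⊢c c ≈ c ∶ C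
    symC    : ∀ {Γ c c' C} → Γ ⊢c c ≈ c' ∶ C → Γ ⊢c c' ≈ c ∶ C
    transC  : ∀ {Γ c c' c'' C} → Γ ⊢c c ≈ c' ∶ C → Γ ⊢c c' ≈ c'' ∶ C → Γ ⊢c c ≈ c'' ∶ C
    substC  : ∀ {Γ w A c c' C} → Γ ⊢v w ∶ A → (A ∷ Γ) ⊢c c ≈ c' ∶ C →
              Γ ⊢c c [ w ]C ≈ c' [ w ]C ∶ C
    ifC≡    : ∀ {Γ v v' c₁ c₁' c₂ c₂' C} → Γ ⊢v v ≈ v' ∶ bool → Γ ⊢c c₁ ≈ c₁' ∶ C →
              Γ ⊢c c₂ ≈ c₂' ∶ C → Γ ⊢c ifC v c₁ c₂ ≈ ifC v' c₁' c₂' ∶ C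
    app≡    : ∀ {Γ v₁ v₁' v₂ v₂' A C} → Γ ⊢v v₁ ≈ v₁' ∶ A ⇾ C → Γ ⊢v v₂ ≈ v₂' ∶ A →
              Γ ⊢c app v₁ v₂ ≈ app v₁' v₂' ∶ C
    ret≡    : ∀ {Γ v v' A Sg u E} → Γ ⊢v v ≈ v' ∶ A → Γ ⊢c ret v ≈ ret v' ∶ comp A Sg u E
    opC≡    : ∀ {Γ o v v' c c' A Sg u E} (i : OpIx Sg) → nameOf Sg i ≡ o →
              Γ ⊢v v ≈ v' ∶ argOf Sg i → (resOf Sg i ∷ Γ) ⊢c c ≈ c' ∶ comp A Sg u E →
              Γ ⊢c opC o v c ≈ opC o v' c' ∶ comp A Sg u E
    doC≡    : ∀ {Γ c₁ c₁' c₂ c₂' A B Sg u E} → Γ ⊢c c₁ ≈ c₁' ∶ comp A Sg u E →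
              (A ∷ Γ) ⊢c c₂ ≈ c₂' ∶ comp B Sg u E → Γ ⊢c doC c₁ c₂ ≈ doC c₁' c₂' ∶ comp B Sg u E
    withC≡  : ∀ {Γ v v' c c' C D} → Γ ⊢v v ≈ v' ∶ C ⇛ D → Γ ⊢c c ≈ c' ∶ C →
              Γ ⊢c withC v c ≈ withC v' c' ∶ D
    ifTrue  : ∀ {Γ c₁ c₂ C} → Γ ⊢c c₁ ∶ C → Γ ⊢c c₂ ∶ C → Γ ⊢c ifC trueV c₁ c₂ ≈ c₁ ∶ C
    ifFalse : ∀ {Γ c₁ c₂ C} → Γ ⊢c c₁ ∶ C → Γ ⊢c c₂ ∶ C → Γ ⊢c ifC falseV c₁ c₂ ≈ c₂ ∶ C
    funβ    : ∀ {Γ c v A C} → (A ∷ Γ) ⊢c c ∶ C → Γ ⊢v v ∶ A → Γ ⊢c app (fun c) v ≈ c [ v ]C ∶ C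
    doRet   : ∀ {Γ v c A B Sg u E} → Γ ⊢v v ∶ A → (A ∷ Γ) ⊢c c ∶ comp B Sg u E →
              Γ ⊢c doC (ret v) c ≈ c [ v ]C ∶ comp B Sg u E
    doOp    : ∀ {Γ o v c₁ c₂ A B Sg u E} (i : OpIx Sg) → nameOf Sg i ≡ o →
              Γ ⊢v v ∶ argOf Sg i → (resOf Sg i ∷ Γ) ⊢c c₁ ∶ comp A Sg u E →
              (A ∷ Γ) ⊢c c₂ ∶ comp B Sg u E →
              Γ ⊢c doC (opC o v c₁) c₂ ≈ opC o v (doC c₁ (renC (extR suc) c₂)) ∶ comp B Sg u E
    withRet : ∀ {Γ cr h v A Sg u E D} → Γ ⊢v handler cr h ∶ comp A Sg u E ⇛ D → Γ ⊢v v ∶ A →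
              Γ ⊢c withC (handler cr h) (ret v) ≈ cr [ v ]C ∶ D
    withOp  : ∀ {Γ cr h o v c cop C D} → Γ ⊢v handler cr h ∶ C ⇛ D → Γ ⊢c opC o v c ∶ C →
              lookupCl h o ≡ just cop →
              Γ ⊢c withC (handler cr h) (opC o v c)
                 ≈ subC (fun (withC (renV suc (handler cr h)) c) • v • var) cop ∶ D
    boolη   : ∀ {Γ c v C} → (bool ∷ Γ) ⊢c c ∶ C → Γ ⊢v v ∶ bool →
              Γ ⊢c c [ v ]C ≈ ifC v (c [ trueV ]C) (c [ falseV ]C) ∶ C
    doη     : ∀ {Γ c A Sg u E} → Γ ⊢c c ∶ comp A Sg u E →
              Γ ⊢c doC c (ret (var zero)) ≈ c ∶ comp A Sg u E
    doAssoc : ∀ {Γ c₁ c₂ c₃ A B B' Sg u E} → Γ ⊢c c₁ ∶ comp A Sg u E →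
              (A ∷ Γ) ⊢c c₂ ∶ comp B Sg u E → (B ∷ Γ) ⊢c c₃ ∶ comp B' Sg u E →
              Γ ⊢c doC (doC c₁ c₂) c₃ ≈ doC c₁ (doC c₂ (renC (extR suc) c₃)) ∶ comp B' Sg u E
    inherit : ∀ {Γ A Sg u E xs zs T₁ T₂ vs fs} → eqn xs zs T₁ T₂ ∈ E →
              TmplTy Sg zs xs T₁ → TmplTy Sg zs xs T₂ →
              Pointwise (λ v B → Γ ⊢v v ∶ B) vs xs →
              Pointwise (λ f B → Γ ⊢v f ∶ B ⇾ comp A Sg u E) fs zs →
              Γ ⊢c inst (listS vs) (listS fs) T₁ ≈ inst (listS vs) (listS fs) T₂ ∶ comp A Sg u E

data Free (I : Set) (P R : I → Set) (X : Set) : Set where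
  in-ret : X → Free I P R X
  in-op  : (i : I) → P i → (R i → Free I P R X) → Free I P R X

liftF : ∀ {I : Set} {P R : I → Set} {X Y : Set} →
        (X → Y) → ((i : I) → P i → (R i → Y) → Y) → Free I P R X → Y
liftF f H (in-ret x) = f x
liftF f H (in-op i a κ) = H i a (λ b → liftF f H (κ b))

mutual
  ⟦_⟧v : VTy → Set
  ⟦ unit ⟧v = ⊤
  ⟦ bool ⟧v = Bool
  ⟦ A ⇾ C ⟧v = ⟦ A ⟧v → ⟦ C ⟧c
  ⟦ C ⇛ D ⟧v = ⟦ C ⟧c → ⟦ D ⟧c

  ⟦_⟧c : CTy → Set
  ⟦ comp A Sg u E ⟧c = Free (OpIx Sg) (⟦ Sg ⟧ar) (⟦ Sg ⟧res) ⟦ A ⟧v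

  ⟦_⟧ar : (Sg : Sig) → OpIx Sg → Set
  ⟦ (o , A , B) ∷ Sg ⟧ar fzero = ⟦ A ⟧v
  ⟦ _ ∷ Sg ⟧ar (fsuc i) = ⟦ Sg ⟧ar i

  ⟦_⟧res : (Sg : Sig) → OpIx Sg → Set
  ⟦ (o , A , B) ∷ Sg ⟧res fzero = ⟦ B ⟧v
  ⟦ _ ∷ Sg ⟧res (fsuc i) = ⟦ Sg ⟧res i

toAr : (Sg : Sig) (i : OpIx Sg) → ⟦ argOf Sg i ⟧v → ⟦ Sg ⟧ar i
toAr ((o , A , B) ∷ Sg) fzero a = a
toAr (_ ∷ Sg) (fsuc i) a = toAr Sg i a

fromAr : (Sg : Sig) (i : OpIx Sg) → ⟦ Sg ⟧ar i → ⟦ argOf Sg i ⟧v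
fromAr ((o , A , B) ∷ Sg) fzero a = a
fromAr (_ ∷ Sg) (fsuc i) a = fromAr Sg i a

toRes : (Sg : Sig) (i : OpIx Sg) → ⟦ resOf Sg i ⟧v → ⟦ Sg ⟧res i
toRes ((o , A , B) ∷ Sg) fzero b = b
toRes (_ ∷ Sg) (fsuc i) b = toRes Sg i b

fromRes : (Sg : Sig) (i : OpIx Sg) → ⟦ Sg ⟧res i → ⟦ resOf Sg i ⟧v
fromRes ((o , A , B) ∷ Sg) fzero b = b
fromRes (_ ∷ Sg) (fsuc i) b = fromRes Sg i b

⟦_⟧x : Ctx → Set
⟦ [] ⟧x = ⊤
⟦ A ∷ Γ ⟧x = ⟦ A ⟧v × ⟦ Γ ⟧x

lookupEnv : ∀ {Γ n A} → Γ ∋ n ∶ A → ⟦ Γ ⟧x → ⟦ A ⟧v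
lookupEnv here (a , η) = a
lookupEnv (there p) (a , η) = lookupEnv p η

Interp : Sig → Set → Set
Interp Sg Y = (i : OpIx Sg) → ⟦ Sg ⟧ar i → (⟦ Sg ⟧res i → Y) → Y

freeI : (Sg : Sig) (X : Set) → Interp Sg (Free (OpIx Sg) (⟦ Sg ⟧ar) (⟦ Sg ⟧res) X)
freeI Sg X i a κ = in-op i a κ

mutual
  ⟦_⟧V : ∀ {Γ v A} → Γ ⊢v v ∶ A → ⟦ Γ ⟧x → ⟦ A ⟧v
  ⟦ varT p ⟧V η = lookupEnv p η
  ⟦ unitT ⟧V η = tt
  ⟦ trueT ⟧V η = true
  ⟦ falseT ⟧V η = false
  ⟦ funT d ⟧V η = λ a → ⟦ d ⟧C (a , η)
  ⟦ handlerT dr p ⟧V η = liftF (λ a → ⟦ dr ⟧C (a , η)) (⟦ p ⟧⊨ η)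

  ⟦_⟧C : ∀ {Γ c C} → Γ ⊢c c ∶ C → ⟦ Γ ⟧x → ⟦ C ⟧c
  ⟦ ifT dv d₁ d₂ ⟧C η = if ⟦ dv ⟧V η then ⟦ d₁ ⟧C η else ⟦ d₂ ⟧C η
  ⟦ appT d₁ d₂ ⟧C η = ⟦ d₁ ⟧V η (⟦ d₂ ⟧V η)
  ⟦ retT d ⟧C η = in-ret (⟦ d ⟧V η)
  ⟦ opT {Sg = Sg} i e dv dc ⟧C η =
    in-op i (toAr Sg i (⟦ dv ⟧V η)) (λ b → ⟦ dc ⟧C (fromRes Sg i b , η))
  ⟦ doT {B = B} {Sg = Sg} d₁ d₂ ⟧C η =
    liftF (λ a → ⟦ d₂ ⟧C (a , η)) (freeI Sg ⟦ B ⟧v) (⟦ d₁ ⟧C η)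
  ⟦ withT dv dc ⟧C η = ⟦ dv ⟧V η (⟦ dc ⟧C η)

  ⟦_⟧H : ∀ {Γ h Sg D} → Γ ⊢h h ∶ Sg ⇉ D → ⟦ Γ ⟧x → Interp Sg ⟦ D ⟧c
  ⟦ clausesT {Sg = Sg} u cls all ⟧H η i a κ =
    ⟦ cls i ⟧CL η (fromAr Sg i a) (λ b → κ (toRes Sg i b))

  ⟦_⟧CL : ∀ {Γ h o A B D} → ClauseFor Γ h o A B D → ⟦ Γ ⟧x → ⟦ A ⟧v → (⟦ B ⟧v → ⟦ D ⟧c) → ⟦ D ⟧c
  ⟦ clause c e d ⟧CL η a κ = ⟦ d ⟧C (κ , a , η)

  ⟦_⟧⊨ : ∀ {Γ h E Sg D} → Γ ⊢ h ⊨ E ∶ Sg ⇉ D → ⟦ Γ ⟧x → Interp Sg ⟦ D ⟧c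
  ⟦ ⊨[] d ⟧⊨ η = ⟦ d ⟧H η
  ⟦ ⊨∷ p d₁ d₂ e ⟧⊨ η = ⟦ p ⟧⊨ η

⟦_⟧T : ∀ {Sg zs Γ T} {Y : Set} → TmplTy Sg zs Γ T → Interp Sg Y → ⟦ Γ ⟧x →
       ((j : Fin (length zs)) → ⟦ lookup zs j ⟧v → Y) → Y
⟦ tzT j e dv ⟧T H η ζ = ζ j (⟦ dv ⟧V η)
⟦ tifT dv d₁ d₂ ⟧T H η ζ = if ⟦ dv ⟧V η then ⟦ d₁ ⟧T H η ζ else ⟦ d₂ ⟧T H η ζ
⟦_⟧T {Sg} (topT i e dv d) H η ζ =
  H i (toAr Sg i (⟦ dv ⟧V η)) (λ b → ⟦ d ⟧T H (fromRes Sg i b , η) ζ)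

Rel : Set → Set₁
Rel X = X → X → Set

data FRel {I : Set} {P R : I → Set} {X : Set}
          (RX : Rel X) (RP : (i : I) → Rel (P i)) (RR : (i : I) → Rel (R i))
          (EI : Set) (XS : EI → Set) (RXS : (e : EI) → Rel (XS e))
          (J : EI → Set) (BZ : (e : EI) → J e → Set) (RBZ : (e : EI) (j : J e) → Rel (BZ e j))
          (DE : EI → Set)
          (T₁ T₂ : (e : EI) → DE e → XS e → ((j : J e) → BZ e j → Free I P R X) → Free I P R X)
          : Free I P R X → Free I P R X → Set where
  symR   : ∀ {t t'} → FRel RX RP RR EI XS RXS J BZ RBZ DE T₁ T₂ t t' →
           FRel RX RP RR EI XS RXS J BZ RBZ DE T₁ T₂ t' t
  transR : ∀ {t t' t''} → FRel RX RP RR EI XS RXS J BZ RBZ DE T₁ T₂ t t' →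
           FRel RX RP RR EI XS RXS J BZ RBZ DE T₁ T₂ t' t'' →
           FRel RX RP RR EI XS RXS J BZ RBZ DE T₁ T₂ t t''
  retR   : ∀ {a a'} → RX a a' → FRel RX RP RR EI XS RXS J BZ RBZ DE T₁ T₂ (in-ret a) (in-ret a')
  opR    : ∀ (i : I) {a a' κ κ'} → RP i a a' →
           (∀ b b' → RR i b b' → FRel RX RP RR EI XS RXS J BZ RBZ DE T₁ T₂ (κ b) (κ' b')) →
           FRel RX RP RR EI XS RXS J BZ RBZ DE T₁ T₂ (in-op i a κ) (in-op i a' κ')
  eqnR   : ∀ (e : EI) (d : DE e) {as as' fs fs'} → RXS e as as' →
           (∀ j b b' → RBZ e j b b' → FRel RX RP RR EI XS RXS J BZ RBZ DE T₁ T₂ (fs j b) (fs' j b')) →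
           FRel RX RP RR EI XS RXS J BZ RBZ DE T₁ T₂ (T₁ e d as fs) (T₂ e d as' fs')

mutual
  VRel : (A : VTy) → Rel ⟦ A ⟧v
  VRel unit a a' = a ≡ a'
  VRel bool a a' = a ≡ a'
  VRel (A ⇾ C) f f' = ∀ a a' → VRel A a a' → CRel C (f a) (f' a')
  VRel (C ⇛ D) h h' = ∀ t t' → CRel C t t' → CRel D (h t) (h' t')

  CRel : (C : CTy) → Rel ⟦ C ⟧c
  CRel (comp A Sg u E) =
    FRel (VRel A) (ArRel Sg) (ResRel Sg)
         (Fin (length E)) (λ e → ⟦ eqXs (lookup E e) ⟧x) (EXRel E)
         (λ e → Fin (length (eqZs (lookup E e)))) (λ e j → ⟦ lookup (eqZs (lookup E e)) j ⟧v) (EZRel E)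
         (λ e → TmplTy Sg (eqZs (lookup E e)) (eqXs (lookup E e)) (eqL (lookup E e))
              × TmplTy Sg (eqZs (lookup E e)) (eqXs (lookup E e)) (eqR (lookup E e)))
         (λ e d as fs → ⟦ proj₁ d ⟧T (freeI Sg ⟦ A ⟧v) as fs)
         (λ e d as fs → ⟦ proj₂ d ⟧T (freeI Sg ⟦ A ⟧v) as fs)

  ArRel : (Sg : Sig) (i : OpIx Sg) → Rel (⟦ Sg ⟧ar i)
  ArRel ((o , A , B) ∷ Sg) fzero = VRel A
  ArRel (_ ∷ Sg) (fsuc i) = ArRel Sg i

  ResRel : (Sg : Sig) (i : OpIx Sg) → Rel (⟦ Sg ⟧res i)
  ResRel ((o , A , B) ∷ Sg) fzero = VRel B
  ResRel (_ ∷ Sg) (fsuc i) = ResRel Sg i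

  CtxRel : (Γ : Ctx) → Rel ⟦ Γ ⟧x
  CtxRel [] η η' = ⊤
  CtxRel (A ∷ Γ) (a , η) (a' , η') = VRel A a a' × CtxRel Γ η η'

  ZjRel : (zs : List VTy) (j : Fin (length zs)) → Rel ⟦ lookup zs j ⟧v
  ZjRel (B ∷ zs) fzero = VRel B
  ZjRel (B ∷ zs) (fsuc j) = ZjRel zs j

  EXRel : (E : List Eqn) (e : Fin (length E)) → Rel ⟦ eqXs (lookup E e) ⟧x
  EXRel (eqn xs zs T₁ T₂ ∷ E) fzero = CtxRel xs
  EXRel (_ ∷ E) (fsuc e) = EXRel E e

  EZRel : (E : List Eqn) (e : Fin (length E)) (j : Fin (length (eqZs (lookup E e)))) →
          Rel ⟦ lookup (eqZs (lookup E e)) j ⟧v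
  EZRel (eqn xs zs T₁ T₂ ∷ E) fzero j = ZjRel zs j
  EZRel (_ ∷ E) (fsuc e) j = EZRel E e j

{-# OPTIONS --safe #-}

-- Types are not recorded in terms, so a derivation may guess hidden intermediate types
-- and soundness includes coherence: all derivations of a judgment must have related
-- meanings.  Coherence follows from a logical relation VS A A' between the meanings of
-- one term at two types, empty when the types have different shapes, which on the
-- diagonal is the given relation.
--
-- CRel closes under an equation for every derivation of its two templates.  Such a
-- derivation may contain handlers whose own soundness refers to CRel at unrelated types,
-- so a direct induction on derivations is circular.  Therefore CRel is first replaced by
-- CR, which admits a template derivation only if it is coherent with all derivations of
-- the same template of at most its size.  Any two admitted derivations are then coherent,
-- every derivation is admitted by induction on its size, and CR coincides with CRel.
--
-- Typing is not visibly closed under substitution, because the handler rule contains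
-- derivations of equations.  The induction thus passes through a semantic typing ⊩ whose
-- handler rule asks for the equations to hold in the model.
module Submission where

open import Defs
open import Data.Bool.Base using (true; false; T; if_then_else_)
open import Data.Empty using (⊥; ⊥-elim)
open import Data.Fin.Base using (Fin; toℕ) renaming (zero to fzero; suc to fsuc)
open import Data.Fin.Properties using (toℕ-injective)
open import Data.List.Base using (List; []; _∷_; map; length; lookup; _++_)
open import Data.List.Membership.Propositional using (_∈_)
open import Data.List.Membership.Propositional.Properties using (∈-lookup)
open import Data.List.Relation.Binary.Pointwise using (Pointwise; []; _∷_)
open import Data.List.Relation.Unary.Any using (here; there; index)
open import Data.List.Relation.Unary.Any.Properties using (lookup-index)
open import Data.Maybe.Base using (just; maybe′)
open import Data.Maybe.Properties using (just-injective)
open import Data.Nat.Base using (ℕ; zero; suc; _+_; _⊔_; _≤_; s≤s; _≡ᵇ_)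
open import Data.Nat.Properties using (≤-refl; ≤-trans; ≤-total; m≤m⊔n; m≤n⊔m; n≤1+n; ≡⇒≡ᵇ)
open import Data.Product using (Σ; Σ-syntax; _×_; _,_; proj₁; proj₂)
open import Data.Sum.Base using (inj₁; inj₂)
open import Data.Unit.Base using (⊤; tt)
open import Relation.Binary.PropositionalEquality using (_≡_; refl; sym; trans; cong; cong₂; subst)

-- Sizes of derivations

sup : ∀ n → (Fin n → ℕ) → ℕ
sup zero f = zero
sup (suc n) f = f fzero ⊔ sup n (λ i → f (fsuc i))

sup-upper : ∀ n (f : Fin n → ℕ) i → f i ≤ sup n f
sup-upper (suc n) f fzero = m≤m⊔n (f fzero) _
sup-upper (suc n) f (fsuc i) =
  ≤-trans (sup-upper n (λ i → f (fsuc i)) i) (m≤n⊔m (f fzero) _)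

mutual
  -- Structural induction would not do: stability compares a derivation with others of the same
  -- template that are not among its subderivations. Each size is one more than a maximum, so a
  -- single bound covers all premises of a rule, and the bound zero is vacuous for derivations.
  sizeV : ∀ {Γ v A} → Γ ⊢v v ∶ A → ℕ
  sizeV (varT _) = 1
  sizeV unitT = 1
  sizeV trueT = 1
  sizeV falseT = 1
  sizeV (funT d) = suc (sizeC d)
  sizeV (handlerT d p) = suc (sizeC d ⊔ size⊨ p)

  sizeC : ∀ {Γ c C} → Γ ⊢c c ∶ C → ℕ
  sizeC (ifT v d₁ d₂) = suc (sizeV v ⊔ (sizeC d₁ ⊔ sizeC d₂))
  sizeC (appT v w) = suc (sizeV v ⊔ sizeV w)
  sizeC (retT v) = suc (sizeV v)
  sizeC (opT i e v d) = suc (sizeV v ⊔ sizeC d)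
  sizeC (doT d₁ d₂) = suc (sizeC d₁ ⊔ sizeC d₂)
  sizeC (withT v d) = suc (sizeV v ⊔ sizeC d)

  sizeCl : ∀ {Γ h o A B D} → ClauseFor Γ h o A B D → ℕ
  sizeCl (clause c e d) = suc (sizeC d)

  sizeH : ∀ {Γ h Sg D} → Γ ⊢h h ∶ Sg ⇉ D → ℕ
  sizeH (clausesT {Sg = Sg} u cls _) = suc (sup (length Sg) (λ i → sizeCl (cls i)))

  sizeT : ∀ {Sg zs Γ T} → TmplTy Sg zs Γ T → ℕ
  sizeT (tzT j e v) = suc (sizeV v)
  sizeT (tifT v t₁ t₂) = suc (sizeV v ⊔ (sizeT t₁ ⊔ sizeT t₂))
  sizeT (topT i e v t) = suc (sizeV v ⊔ sizeT t)

  size⊨ : ∀ {Γ h E Sg D} → Γ ⊢ h ⊨ E ∶ Sg ⇉ D → ℕ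
  size⊨ (⊨[] d) = suc (sizeH d)
  size⊨ (⊨∷ p t₁ t₂ e) = suc ((size⊨ p ⊔ size≈C e) ⊔ (sizeT t₁ ⊔ sizeT t₂))

  size≈Cl : ∀ {Γ h h' o A B D} → ClauseEqFor Γ h h' o A B D → ℕ
  size≈Cl (clauseEq _ _ e) = suc (size≈C e)

  size≈V : ∀ {Γ v v' A} → Γ ⊢v v ≈ v' ∶ A → ℕ
  size≈V (reflV d) = suc (sizeV d)
  size≈V (symV e) = suc (size≈V e)
  size≈V (transV e e') = suc (size≈V e ⊔ size≈V e')
  size≈V (substV d e) = suc (sizeV d ⊔ size≈V e)
  size≈V (funV≡ e) = suc (size≈C e)
  size≈V (handlerV≡ {Sg = Sg} p p' e es) =
    suc ((size⊨ p ⊔ size⊨ p') ⊔ (size≈C e ⊔ sup (length Sg) (λ i → size≈Cl (es i))))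
  size≈V (funη d) = suc (sizeV d)
  size≈V (unitη d) = suc (sizeV d)

  size≈C : ∀ {Γ c c' C} → Γ ⊢c c ≈ c' ∶ C → ℕ
  size≈C (reflC d) = suc (sizeC d)
  size≈C (symC e) = suc (size≈C e)
  size≈C (transC e e') = suc (size≈C e ⊔ size≈C e')
  size≈C (substC d e) = suc (sizeV d ⊔ size≈C e)
  size≈C (ifC≡ e e₁ e₂) = suc (size≈V e ⊔ (size≈C e₁ ⊔ size≈C e₂))
  size≈C (app≡ e e') = suc (size≈V e ⊔ size≈V e')
  size≈C (ret≡ e) = suc (size≈V e)
  size≈C (opC≡ i _ e e') = suc (size≈V e ⊔ size≈C e')
  size≈C (doC≡ e e') = suc (size≈C e ⊔ size≈C e')
  size≈C (withC≡ e e') = suc (size≈V e ⊔ size≈C e')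
  size≈C (ifTrue d₁ d₂) = suc (sizeC d₁ ⊔ sizeC d₂)
  size≈C (ifFalse d₁ d₂) = suc (sizeC d₁ ⊔ sizeC d₂)
  size≈C (funβ d v) = suc (sizeC d ⊔ sizeV v)
  size≈C (doRet v d) = suc (sizeV v ⊔ sizeC d)
  size≈C (doOp i _ v d₁ d₂) = suc (sizeV v ⊔ (sizeC d₁ ⊔ sizeC d₂))
  size≈C (withRet d v) = suc (sizeV d ⊔ sizeV v)
  size≈C (withOp d c _) = suc (sizeV d ⊔ sizeC c)
  size≈C (boolη d v) = suc (sizeC d ⊔ sizeV v)
  size≈C (doη d) = suc (sizeC d)
  size≈C (doAssoc d₁ d₂ d₃) = suc (sizeC d₁ ⊔ (sizeC d₂ ⊔ sizeC d₃))
  size≈C (inherit _ t₁ t₂ vs fs) =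
    suc ((sizeT t₁ ⊔ sizeT t₂) ⊔ (sizeArgs vs ⊔ sizeFuns fs))

  sizeArgs : ∀ {Γ vs xs} → Pointwise (λ v B → Γ ⊢v v ∶ B) vs xs → ℕ
  sizeArgs [] = zero
  sizeArgs (d ∷ ds) = sizeV d ⊔ sizeArgs ds

  sizeFuns : ∀ {Γ C fs zs} → Pointwise (λ f B → Γ ⊢v f ∶ B ⇾ C) fs zs → ℕ
  sizeFuns [] = zero
  sizeFuns (d ∷ ds) = sizeV d ⊔ sizeFuns ds

-- Templates as trees

data TreeRel {I J : Set} {P R : I → Set} {Z : J → Set}
             (RP : (i : I) → Rel (P i)) (RR : (i : I) → Rel (R i)) (RZ : (j : J) → Rel (Z j)) :
             Free I P R (Σ J Z) → Free I P R (Σ J Z) → Set where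
  leafR : ∀ {j b b'} → RZ j b b' → TreeRel RP RR RZ (in-ret (j , b)) (in-ret (j , b'))
  nodeR : ∀ {i a a' κ κ'} → RP i a a' →
          (∀ b b' → RR i b b' → TreeRel RP RR RZ (κ b) (κ' b')) →
          TreeRel RP RR RZ (in-op i a κ) (in-op i a' κ')

-- The interpretation in the free algebra over pairs of a template variable and its argument:
-- conditionals are already decided, and what remains is all that another interpretation can see.
tree : ∀ {Sg zs Γ T} → TmplTy Sg zs Γ T → ⟦ Γ ⟧x →
       Free (OpIx Sg) ⟦ Sg ⟧ar ⟦ Sg ⟧res (Σ[ j ∈ Fin (length zs) ] ⟦ lookup zs j ⟧v)
tree {Sg} d η = ⟦ d ⟧T (freeI Sg _) η (λ j b → in-ret (j , b))

-- Every interpretation factors through the tree, but below an operation only pointwise, so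
-- rewriting a meaning into the lift of a tree would need extensionality. The recursion is therefore
-- on the two templates, which also makes the trees compute far enough to match on their relation;
-- conditionals are decided on each side independently.
tree-interp : ∀ {Sg zs Γ Γ' T T'} {Y Y' : Set} {RP RR RZ} (R : Y → Y' → Set)
  {H : Interp Sg Y} {H' : Interp Sg Y'} {fs fs'} →
  (∀ i a a' → RP i a a' → ∀ κ κ' → (∀ b b' → RR i b b' → R (κ b) (κ' b')) →
     R (H i a κ) (H' i a' κ')) →
  (∀ j b b' → RZ j b b' → R (fs j b) (fs' j b')) →
  (d : TmplTy Sg zs Γ T) (d' : TmplTy Sg zs Γ' T') → ∀ {η η'} →
  TreeRel RP RR RZ (tree d η) (tree d' η') → R (⟦ d ⟧T H η fs) (⟦ d' ⟧T H' η' fs')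
tree-interp R op leaf (tifT v d₁ d₂) d' {η} r with ⟦ v ⟧V η
... | true = tree-interp R op leaf d₁ d' r
... | false = tree-interp R op leaf d₂ d' r
tree-interp R op leaf d@(tzT _ _ _) (tifT v d₁ d₂) {η' = η'} r with ⟦ v ⟧V η'
... | true = tree-interp R op leaf d d₁ r
... | false = tree-interp R op leaf d d₂ r
tree-interp R op leaf d@(topT _ _ _ _) (tifT v d₁ d₂) {η' = η'} r with ⟦ v ⟧V η'
... | true = tree-interp R op leaf d d₁ r
... | false = tree-interp R op leaf d d₂ r
tree-interp R op leaf (tzT j _ v) (tzT .j _ v') (leafR r) = leaf j _ _ r
tree-interp R op leaf (tzT _ _ _) (topT _ _ _ _) ()
tree-interp R op leaf (topT _ _ _ _) (tzT _ _ _) ()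
tree-interp R op leaf (topT i _ v d) (topT .i _ v' d') (nodeR r rs) =
  op i _ _ r _ _ (λ b b' s → tree-interp R op leaf d d' (rs b b' s))

-- Coherence is demanded of trees, whose comparison involves only the types in the signature and in
-- the equation. Demanding it of meanings would mention `CR` at the very type being defined.
Stable : ∀ {Sg zs xs T} → ((i : OpIx Sg) → Rel (⟦ Sg ⟧ar i)) → ((i : OpIx Sg) → Rel (⟦ Sg ⟧res i)) →
         Rel ⟦ xs ⟧x → ((j : Fin (length zs)) → Rel ⟦ lookup zs j ⟧v) → TmplTy Sg zs xs T → Set
Stable {Sg} {zs} {xs} {T} RP RR RX RZ d =
  (d' : TmplTy Sg zs xs T) → sizeT d' ≤ sizeT d → ∀ as as' → RX as as' →
  TreeRel RP RR RZ (tree d as) (tree d' as')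

-- The relation generated by stable derivations

mutual
  VR : (A : VTy) → Rel ⟦ A ⟧v
  VR unit a a' = a ≡ a'
  VR bool a a' = a ≡ a'
  VR (A ⇾ C) f f' = ∀ a a' → VR A a a' → CR C (f a) (f' a')
  VR (C ⇛ D) h h' = ∀ t t' → CR C t t' → CR D (h t) (h' t')

  CR : (C : CTy) → Rel ⟦ C ⟧c
  CR (comp A Sg u E) =
    FRel (VR A) (ArR Sg) (ResR Sg)
         (Fin (length E)) (λ e → ⟦ eqXs (lookup E e) ⟧x) (EXR E)
         (λ e → Fin (length (eqZs (lookup E e)))) (λ e j → ⟦ lookup (eqZs (lookup E e)) j ⟧v) (EZR E)
         (λ e → Σ[ d ∈ TmplTy Sg (eqZs (lookup E e)) (eqXs (lookup E e)) (eqL (lookup E e))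
                      × TmplTy Sg (eqZs (lookup E e)) (eqXs (lookup E e)) (eqR (lookup E e)) ]
                Stable (ArR Sg) (ResR Sg) (EXR E e) (EZR E e) (proj₁ d)
              × Stable (ArR Sg) (ResR Sg) (EXR E e) (EZR E e) (proj₂ d))
         (λ e d as fs → ⟦ proj₁ (proj₁ d) ⟧T (freeI Sg ⟦ A ⟧v) as fs)
         (λ e d as fs → ⟦ proj₂ (proj₁ d) ⟧T (freeI Sg ⟦ A ⟧v) as fs)

  -- Recursion on lists, here and in the relations below, keeps the definition structural: that
  -- `argOf Sg i` is a component of `Sg` would be hidden behind `lookup`. The `-from` and `-to`
  -- lemmas convert between the two forms.
  ArR : (Sg : Sig) (i : OpIx Sg) → Rel (⟦ Sg ⟧ar i)
  ArR ((o , A , B) ∷ Sg) fzero = VR A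
  ArR (_ ∷ Sg) (fsuc i) = ArR Sg i

  ResR : (Sg : Sig) (i : OpIx Sg) → Rel (⟦ Sg ⟧res i)
  ResR ((o , A , B) ∷ Sg) fzero = VR B
  ResR (_ ∷ Sg) (fsuc i) = ResR Sg i

  CtxR : (Γ : Ctx) → Rel ⟦ Γ ⟧x
  CtxR [] η η' = ⊤
  CtxR (A ∷ Γ) (a , η) (a' , η') = VR A a a' × CtxR Γ η η'

  ZjR : (zs : List VTy) (j : Fin (length zs)) → Rel ⟦ lookup zs j ⟧v
  ZjR (B ∷ zs) fzero = VR B
  ZjR (B ∷ zs) (fsuc j) = ZjR zs j

  EXR : (E : List Eqn) (e : Fin (length E)) → Rel ⟦ eqXs (lookup E e) ⟧x
  EXR (eqn xs zs T₁ T₂ ∷ E) fzero = CtxR xs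
  EXR (_ ∷ E) (fsuc e) = EXR E e

  EZR : (E : List Eqn) (e : Fin (length E)) (j : Fin (length (eqZs (lookup E e)))) →
        Rel ⟦ lookup (eqZs (lookup E e)) j ⟧v
  EZR (eqn xs zs T₁ T₂ ∷ E) fzero j = ZjR zs j
  EZR (_ ∷ E) (fsuc e) j = EZR E e j

StableEqn : Sig → (E : List Eqn) → Fin (length E) → Set
StableEqn Sg E e =
  Σ[ d ∈ TmplTy Sg (eqZs (lookup E e)) (eqXs (lookup E e)) (eqL (lookup E e))
       × TmplTy Sg (eqZs (lookup E e)) (eqXs (lookup E e)) (eqR (lookup E e)) ]
    Stable (ArR Sg) (ResR Sg) (EXR E e) (EZR E e) (proj₁ d)
  × Stable (ArR Sg) (ResR Sg) (EXR E e) (EZR E e) (proj₂ d)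

CR-sym : ∀ C {t t'} → CR C t t' → CR C t' t
CR-sym (comp _ _ _ _) = symR

CR-trans : ∀ C {t t' t''} → CR C t t' → CR C t' t'' → CR C t t''
CR-trans (comp _ _ _ _) = transR

CR-reflˡ : ∀ C {t t'} → CR C t t' → CR C t t
CR-reflˡ C r = CR-trans C r (CR-sym C r)

CR-reflʳ : ∀ C {t t'} → CR C t t' → CR C t' t'
CR-reflʳ C r = CR-trans C (CR-sym C r) r

VR-sym : ∀ A {a a'} → VR A a a' → VR A a' a
VR-sym unit r = sym r
VR-sym bool r = sym r
VR-sym (A ⇾ C) r a a' s = CR-sym C (r a' a (VR-sym A s))
VR-sym (C ⇛ D) r t t' s = CR-sym D (r t' t (CR-sym C s))

VR-trans : ∀ A {a a' a''} → VR A a a' → VR A a' a'' → VR A a a''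
VR-trans unit r r' = trans r r'
VR-trans bool r r' = trans r r'
VR-trans (A ⇾ C) r r' a a' s = CR-trans C (r a a' s) (r' a' a' (VR-trans A (VR-sym A s) s))
VR-trans (C ⇛ D) r r' t t' s = CR-trans D (r t t' s) (r' t' t' (CR-reflʳ C s))

VR-reflˡ : ∀ A {a a'} → VR A a a' → VR A a a
VR-reflˡ A r = VR-trans A r (VR-sym A r)

VR-reflʳ : ∀ A {a a'} → VR A a a' → VR A a' a'
VR-reflʳ A r = VR-trans A (VR-sym A r) r

CtxR-sym : ∀ Γ {η η'} → CtxR Γ η η' → CtxR Γ η' η
CtxR-sym [] _ = tt
CtxR-sym (A ∷ Γ) (r , rs) = VR-sym A r , CtxR-sym Γ rs

CtxR-trans : ∀ Γ {η η' η''} → CtxR Γ η η' → CtxR Γ η' η'' → CtxR Γ η η''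
CtxR-trans [] _ _ = tt
CtxR-trans (A ∷ Γ) (r , rs) (s , ss) = VR-trans A r s , CtxR-trans Γ rs ss

CtxR-reflˡ : ∀ Γ {η η'} → CtxR Γ η η' → CtxR Γ η η
CtxR-reflˡ Γ r = CtxR-trans Γ r (CtxR-sym Γ r)

CtxR-reflʳ : ∀ Γ {η η'} → CtxR Γ η η' → CtxR Γ η' η'
CtxR-reflʳ Γ r = CtxR-trans Γ (CtxR-sym Γ r) r

CtxR-lookup : ∀ {Γ n A η η'} (q : Γ ∋ n ∶ A) → CtxR Γ η η' →
              VR A (lookupEnv q η) (lookupEnv q η')
CtxR-lookup here (r , _) = r
CtxR-lookup (there q) (_ , rs) = CtxR-lookup q rs

-- Conversions at positions of signatures and equations

fromAr-toAr : ∀ Sg i a → fromAr Sg i (toAr Sg i a) ≡ a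
fromAr-toAr (_ ∷ Sg) fzero a = refl
fromAr-toAr (_ ∷ Sg) (fsuc i) a = fromAr-toAr Sg i a

fromRes-toRes : ∀ Sg i b → fromRes Sg i (toRes Sg i b) ≡ b
fromRes-toRes (_ ∷ Sg) fzero b = refl
fromRes-toRes (_ ∷ Sg) (fsuc i) b = fromRes-toRes Sg i b

ArR-from : ∀ Sg i {a a'} → ArR Sg i a a' → VR (argOf Sg i) (fromAr Sg i a) (fromAr Sg i a')
ArR-from (_ ∷ Sg) fzero r = r
ArR-from (_ ∷ Sg) (fsuc i) r = ArR-from Sg i r

ArR-to : ∀ Sg i {a a'} → VR (argOf Sg i) a a' → ArR Sg i (toAr Sg i a) (toAr Sg i a')
ArR-to (_ ∷ Sg) fzero r = r
ArR-to (_ ∷ Sg) (fsuc i) r = ArR-to Sg i r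

ResR-from : ∀ Sg i {b b'} → ResR Sg i b b' → VR (resOf Sg i) (fromRes Sg i b) (fromRes Sg i b')
ResR-from (_ ∷ Sg) fzero r = r
ResR-from (_ ∷ Sg) (fsuc i) r = ResR-from Sg i r

ResR-to : ∀ Sg i {b b'} → VR (resOf Sg i) b b' → ResR Sg i (toRes Sg i b) (toRes Sg i b')
ResR-to (_ ∷ Sg) fzero r = r
ResR-to (_ ∷ Sg) (fsuc i) r = ResR-to Sg i r

ArR-sym : ∀ Sg i {a a'} → ArR Sg i a a' → ArR Sg i a' a
ArR-sym ((_ , A , _) ∷ Sg) fzero r = VR-sym A r
ArR-sym (_ ∷ Sg) (fsuc i) r = ArR-sym Sg i r

ArR-trans : ∀ Sg i {a a' a''} → ArR Sg i a a' → ArR Sg i a' a'' → ArR Sg i a a''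
ArR-trans ((_ , A , _) ∷ Sg) fzero r s = VR-trans A r s
ArR-trans (_ ∷ Sg) (fsuc i) r s = ArR-trans Sg i r s

ResR-sym : ∀ Sg i {b b'} → ResR Sg i b b' → ResR Sg i b' b
ResR-sym ((_ , _ , B) ∷ Sg) fzero r = VR-sym B r
ResR-sym (_ ∷ Sg) (fsuc i) r = ResR-sym Sg i r

ResR-trans : ∀ Sg i {b b' b''} → ResR Sg i b b' → ResR Sg i b' b'' → ResR Sg i b b''
ResR-trans ((_ , _ , B) ∷ Sg) fzero r s = VR-trans B r s
ResR-trans (_ ∷ Sg) (fsuc i) r s = ResR-trans Sg i r s

ArR-reflˡ : ∀ Sg i {a a'} → ArR Sg i a a' → ArR Sg i a a
ArR-reflˡ Sg i r = ArR-trans Sg i r (ArR-sym Sg i r)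

ArR-reflʳ : ∀ Sg i {a a'} → ArR Sg i a a' → ArR Sg i a' a'
ArR-reflʳ Sg i r = ArR-trans Sg i (ArR-sym Sg i r) r

ResR-reflˡ : ∀ Sg i {b b'} → ResR Sg i b b' → ResR Sg i b b
ResR-reflˡ Sg i r = ResR-trans Sg i r (ResR-sym Sg i r)

ResR-reflʳ : ∀ Sg i {b b'} → ResR Sg i b b' → ResR Sg i b' b'
ResR-reflʳ Sg i r = ResR-trans Sg i (ResR-sym Sg i r) r

ZjR-from : ∀ zs j {b b'} → ZjR zs j b b' → VR (lookup zs j) b b'
ZjR-from (_ ∷ zs) fzero r = r
ZjR-from (_ ∷ zs) (fsuc j) r = ZjR-from zs j r

ZjR-to : ∀ zs j {b b'} → VR (lookup zs j) b b' → ZjR zs j b b'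
ZjR-to (_ ∷ zs) fzero r = r
ZjR-to (_ ∷ zs) (fsuc j) r = ZjR-to zs j r

EXR-from : ∀ E e {as as'} → EXR E e as as' → CtxR (eqXs (lookup E e)) as as'
EXR-from (eqn _ _ _ _ ∷ E) fzero r = r
EXR-from (eqn _ _ _ _ ∷ E) (fsuc e) r = EXR-from E e r

EXR-to : ∀ E e {as as'} → CtxR (eqXs (lookup E e)) as as' → EXR E e as as'
EXR-to (eqn _ _ _ _ ∷ E) fzero r = r
EXR-to (eqn _ _ _ _ ∷ E) (fsuc e) r = EXR-to E e r

EZR-from : ∀ E e j {b b'} → EZR E e j b b' → VR (lookup (eqZs (lookup E e)) j) b b'
EZR-from (eqn _ zs _ _ ∷ E) fzero j r = ZjR-from zs j r
EZR-from (eqn _ _ _ _ ∷ E) (fsuc e) j r = EZR-from E e j r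

EZR-to : ∀ E e j {b b'} → VR (lookup (eqZs (lookup E e)) j) b b' → EZR E e j b b'
EZR-to (eqn _ zs _ _ ∷ E) fzero j r = ZjR-to zs j r
EZR-to (eqn _ _ _ _ ∷ E) (fsuc e) j r = EZR-to E e j r

-- Interpretations and homomorphisms out of free algebras

AlgR : ∀ Sg D → Rel (Interp Sg ⟦ D ⟧c)
AlgR Sg D H H' =
  ∀ i a a' → ArR Sg i a a' → ∀ κ κ' → (∀ b b' → ResR Sg i b b' → CR D (κ b) (κ' b')) →
  CR D (H i a κ) (H' i a' κ')

-- Only stable derivations are tested, because only these generate `CR`. Two interpretations are
-- allowed since those of a handler in two related environments differ.
EqnSound : ∀ Sg → List Eqn → ∀ D → Rel (Interp Sg ⟦ D ⟧c)
EqnSound Sg E D H H' =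
  ∀ e (d : StableEqn Sg E e) as as' → EXR E e as as' →
  ∀ fs fs' → (∀ j b b' → EZR E e j b b' → CR D (fs j b) (fs' j b')) →
  CR D (⟦ proj₁ (proj₁ d) ⟧T H as fs) (⟦ proj₂ (proj₁ d) ⟧T H' as' fs')

AlgR-reflˡ : ∀ Sg D {H H'} → AlgR Sg D H H' → AlgR Sg D H H
AlgR-reflˡ Sg D r i a a' ra κ κ' rκ =
  CR-trans D (r i a a' ra κ κ' rκ)
    (CR-sym D (r i a' a' (ArR-reflʳ Sg i ra) κ' κ' λ b b' s →
      CR-trans D (CR-sym D (rκ b b (ResR-reflˡ Sg i s))) (rκ b b' s)))

EXR-reflˡ : ∀ E e {as as'} → EXR E e as as' → EXR E e as as
EXR-reflˡ E e r = EXR-to E e (CtxR-reflˡ _ (EXR-from E e r))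

EXR-reflʳ : ∀ E e {as as'} → EXR E e as as' → EXR E e as' as'
EXR-reflʳ E e r = EXR-to E e (CtxR-reflʳ _ (EXR-from E e r))

EZR-reflˡ : ∀ E e j {b b'} → EZR E e j b b' → EZR E e j b b
EZR-reflˡ E e j r = EZR-to E e j (VR-reflˡ _ (EZR-from E e j r))

EZR-reflʳ : ∀ E e j {b b'} → EZR E e j b b' → EZR E e j b' b'
EZR-reflʳ E e j r = EZR-to E e j (VR-reflʳ _ (EZR-from E e j r))

module _ {A Sg u E D} (F F' : ⟦ comp A Sg u E ⟧c → ⟦ D ⟧c) (H H' : Interp Sg ⟦ D ⟧c)
  (hom : ∀ i a κ → F (in-op i a κ) ≡ H i a (λ b → F (κ b)))
  (hom' : ∀ i a κ → F' (in-op i a κ) ≡ H' i a (λ b → F' (κ b)))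
  (ret-rel : ∀ a a' → VR A a a' → CR D (F (in-ret a)) (F' (in-ret a')))
  (alg : AlgR Sg D H H') (snd : EqnSound Sg E D H H)
  where

  private
    -- The conclusion alone does not survive `symR`, where `F` and `F'` would change places. Here
    -- the two ends are related through `F` only, and `F` is compared with `F'` at each end
    -- separately, which is symmetric.
    Q : Rel ⟦ comp A Sg u E ⟧c
    Q t t' = CR D (F t) (F' t) × CR D (F t) (F t') × CR D (F t') (F' t')

    -- The cases of operations and equations need each continuation compared with itself; combining
    -- the induction hypotheses at `(b , b')`, `(b , b)` and `(b' , b')` supplies this.
    spread : ∀ {B : Set} {RB : Rel B} (k k' : B → ⟦ comp A Sg u E ⟧c) → (∀ {b b'} → RB b b' → RB b b) →
      (∀ {b b'} → RB b b' → RB b' b') → (∀ b b' → RB b b' → Q (k b) (k' b')) →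
      ∀ b b' → RB b b' →
      CR D (F (k b)) (F' (k b')) × CR D (F (k b)) (F' (k' b')) × CR D (F (k' b)) (F' (k' b'))
      × CR D (F (k b)) (F (k b')) × CR D (F (k' b)) (F (k' b'))
    spread k k' reflˡ reflʳ q b b' s with q b b' s | q b b (reflˡ s) | q b' b' (reflʳ s)
    ... | x , y , z | x₁ , y₁ , z₁ | x₂ , y₂ , z₂ =
      CR-trans D same x₂ , CR-trans D y z , CR-trans D same' z , same , same'
      where
      same = CR-trans D y (CR-sym D y₂)
      same' = CR-trans D (CR-sym D y₁) y

    op-rel : ∀ {i a a'} {κ κ' : ⟦ Sg ⟧res i → ⟦ comp A Sg u E ⟧c} → ArR Sg i a a' →
      (∀ b b' → ResR Sg i b b' → CR D (F (κ b)) (F' (κ' b'))) →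
      CR D (F (in-op i a κ)) (F' (in-op i a' κ'))
    op-rel {i} {a} {a'} {κ} {κ'} r k rewrite hom i a κ | hom' i a' κ' = alg i a a' r _ _ k

    op-rel-H : ∀ {i a a'} {κ : ⟦ Sg ⟧res i → ⟦ comp A Sg u E ⟧c} {κ'} → ArR Sg i a a' →
      (∀ b b' → ResR Sg i b b' → CR D (F (κ b)) (κ' b')) →
      CR D (F (in-op i a κ)) (H i a' κ')
    op-rel-H {i} {a} {a'} {κ} r k rewrite hom i a κ = AlgR-reflˡ Sg D alg i a a' r _ _ k

    go : ∀ {t t'} → CR (comp A Sg u E) t t' → Q t t'
    go (symR r) with go r
    ... | x , y , z = z , CR-sym D y , x
    go (transR r s) with go r | go s
    ... | x , y , z | x' , y' , z' = x , CR-trans D y y' , z'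
    go (retR {a} {a'} r) =
      ret-rel a a (VR-reflˡ A r) ,
      CR-trans D (ret-rel a a' r) (CR-sym D (ret-rel a' a' (VR-reflʳ A r))) ,
      ret-rel a' a' (VR-reflʳ A r)
    go (opR i {κ = κ} {κ'} r rs) =
      op-rel (ArR-reflˡ Sg i r) (λ b b' s → proj₁ (k b b' s)) ,
      CR-trans D (op-rel r (λ b b' s → proj₁ (proj₂ (k b b' s)))) (CR-sym D right) ,
      right
      where
      k = spread κ κ' (ResR-reflˡ Sg i) (ResR-reflʳ Sg i) (λ b b' s → go (rs b b' s))
      right = op-rel (ArR-reflʳ Sg i r) (λ b b' s → proj₁ (proj₂ (proj₂ (k b b' s))))
    go (eqnR e d@((d₁ , d₂) , stable₁ , stable₂) {as} {as'} {fs} {fs'} r rs) =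
      tree-interp (λ t t' → CR D (F t) (F' t')) (λ _ _ _ r _ _ → op-rel r)
        (λ j b b' s → proj₁ (k j b b' s)) d₁ d₁ self₁ ,
      -- `F` after the free interpretation agrees with interpreting by `H` with leaves `F (fs j b)`;
      -- there the equation holds by `snd`, and the same agreement for the right template leads
      -- back.
      CR-trans D
        (tree-interp (λ t y → CR D (F t) y) (λ _ _ _ r _ _ → op-rel-H r)
          (λ j b b' s → proj₁ (proj₂ (proj₂ (proj₂ (k j b b' s))))) d₁ d₁ self₁)
        (CR-trans D
          (snd e d as as' r (λ j b → F (fs j b)) (λ j b → F (fs' j b))
            (λ j b b' s → proj₁ (proj₂ (go (rs j b b' s)))))
          (CR-sym D (tree-interp (λ t y → CR D (F t) y) (λ _ _ _ r _ _ → op-rel-H r)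
            (λ j b b' s → proj₂ (proj₂ (proj₂ (proj₂ (k j b b' s))))) d₂ d₂ self₂))) ,
      tree-interp (λ t t' → CR D (F t) (F' t')) (λ _ _ _ r _ _ → op-rel r)
        (λ j b b' s → proj₁ (proj₂ (proj₂ (k j b b' s)))) d₂ d₂ self₂
      where
      k = λ j → spread (fs j) (fs' j) (EZR-reflˡ E e j) (EZR-reflʳ E e j) (λ b b' s → go (rs j b b' s))
      self₁ = stable₁ d₁ ≤-refl as as (EXR-reflˡ E e r)
      self₂ = stable₂ d₂ ≤-refl as' as' (EXR-reflʳ E e r)

  hom-cong : ∀ {t t'} → CR (comp A Sg u E) t t' → CR D (F t) (F' t')
  hom-cong r with go r
  ... | x , y , z = CR-trans D y z

lift-cong : ∀ A Sg u E D {f f' H H'} → (∀ a a' → VR A a a' → CR D (f a) (f' a')) →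
  AlgR Sg D H H' → EqnSound Sg E D H H → ∀ {t t'} → CR (comp A Sg u E) t t' →
  CR D (liftF f H t) (liftF f' H' t')
lift-cong A Sg u E D {f} {f'} {H} {H'} rf alg snd =
  hom-cong {A} {Sg} {u} {E} {D} (liftF f H) (liftF f' H') H H'
    (λ _ _ _ → refl) (λ _ _ _ → refl) rf alg snd

free-alg : ∀ {B Sg u E} → AlgR Sg (comp B Sg u E) (freeI Sg ⟦ B ⟧v) (freeI Sg ⟦ B ⟧v)
free-alg i a a' r κ κ' k = opR i r k

free-sound : ∀ {B Sg u E} → EqnSound Sg E (comp B Sg u E) (freeI Sg ⟦ B ⟧v) (freeI Sg ⟦ B ⟧v)
free-sound e d as as' r fs fs' rs = eqnR e d r rs

bind-cong : ∀ A B Sg u E {f f'} → (∀ a a' → VR A a a' → CR (comp B Sg u E) (f a) (f' a')) →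
  ∀ {t t'} → CR (comp A Sg u E) t t' →
  CR (comp B Sg u E) (liftF f (freeI Sg ⟦ B ⟧v) t) (liftF f' (freeI Sg ⟦ B ⟧v) t')
bind-cong A B Sg u E rf =
  lift-cong A Sg u E (comp B Sg u E) rf (free-alg {B} {Sg} {u} {E}) (free-sound {B} {Sg} {u} {E})

bind-ret : ∀ A Sg u E {t t'} → CR (comp A Sg u E) t t' →
  CR (comp A Sg u E) (liftF in-ret (freeI Sg ⟦ A ⟧v) t) t'
bind-ret A Sg u E =
  hom-cong {A} {Sg} {u} {E} {comp A Sg u E} (liftF in-ret (freeI Sg ⟦ A ⟧v)) (λ t → t) _ _
    (λ _ _ _ → refl) (λ _ _ _ → refl) (λ _ _ → retR)
    (free-alg {A} {Sg} {u} {E}) (free-sound {A} {Sg} {u} {E})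

bind-assoc : ∀ A B B' Sg u E {f g g'} →
  (∀ a a' → VR A a a' → CR (comp B' Sg u E) (liftF g (freeI Sg ⟦ B' ⟧v) (f a)) (g' a')) →
  ∀ {t t'} → CR (comp A Sg u E) t t' →
  CR (comp B' Sg u E) (liftF g (freeI Sg ⟦ B' ⟧v) (liftF f (freeI Sg ⟦ B ⟧v) t))
                      (liftF g' (freeI Sg ⟦ B' ⟧v) t')
bind-assoc A B B' Sg u E {f} {g} {g'} rf =
  hom-cong {A} {Sg} {u} {E} {comp B' Sg u E}
    (λ t → liftF g (freeI Sg ⟦ B' ⟧v) (liftF f (freeI Sg ⟦ B ⟧v) t)) (liftF g' (freeI Sg ⟦ B' ⟧v)) _ _
    (λ _ _ _ → refl) (λ _ _ _ → refl) rf
    (free-alg {B'} {Sg} {u} {E}) (free-sound {B'} {Sg} {u} {E})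

op-cong : ∀ A Sg u E i {a a'} {k k' : ⟦ resOf Sg i ⟧v → ⟦ comp A Sg u E ⟧c} → VR (argOf Sg i) a a' →
  (∀ b b' → VR (resOf Sg i) b b' → CR (comp A Sg u E) (k b) (k' b')) →
  CR (comp A Sg u E) (in-op i (toAr Sg i a) (λ b → k (fromRes Sg i b)))
                     (in-op i (toAr Sg i a') (λ b → k' (fromRes Sg i b)))
op-cong A Sg u E i r k = opR i (ArR-to Sg i r) (λ b b' s → k _ _ (ResR-from Sg i s))

if-cong : ∀ C {b b' t t' s s'} → b ≡ b' → CR C t t' → CR C s s' →
          CR C (if b then t else s) (if b' then t' else s')
if-cong C {true} refl r _ = r
if-cong C {false} refl _ r = r

-- Semantic typing

infix 3 _⊩v_∶_ _⊩c_∶_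

mutual
  -- Induction-recursion: the premise of `handlerS` speaks of the meaning of the clauses.
  data _⊩v_∶_ : Ctx → Val → VTy → Set where
    varS     : ∀ {Γ n A} → Γ ∋ n ∶ A → Γ ⊩v var n ∶ A
    unitS    : ∀ {Γ} → Γ ⊩v unitV ∶ unit
    trueS    : ∀ {Γ} → Γ ⊩v trueV ∶ bool
    falseS   : ∀ {Γ} → Γ ⊩v falseV ∶ bool
    funS     : ∀ {Γ A C c} → (A ∷ Γ) ⊩c c ∶ C → Γ ⊩v fun c ∶ A ⇾ C
    handlerS : ∀ {Γ A Sg u E D cr h} → (A ∷ Γ) ⊩c cr ∶ D → (cl : SClauses Γ h Sg D) →
               (∀ η η' → CtxR Γ η η' → EqnSound Sg E D (⟪ cl ⟫h η) (⟪ cl ⟫h η')) →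
               Γ ⊩v handler cr h ∶ comp A Sg u E ⇛ D

  data _⊩c_∶_ : Ctx → Comp → CTy → Set where
    ifS   : ∀ {Γ v c₁ c₂ C} → Γ ⊩v v ∶ bool → Γ ⊩c c₁ ∶ C → Γ ⊩c c₂ ∶ C → Γ ⊩c ifC v c₁ c₂ ∶ C
    appS  : ∀ {Γ v₁ v₂ A C} → Γ ⊩v v₁ ∶ A ⇾ C → Γ ⊩v v₂ ∶ A → Γ ⊩c app v₁ v₂ ∶ C
    retS  : ∀ {Γ v A Sg u E} → Γ ⊩v v ∶ A → Γ ⊩c ret v ∶ comp A Sg u E
    opS   : ∀ {Γ o v c A Sg u E} (i : OpIx Sg) → nameOf Sg i ≡ o →
            Γ ⊩v v ∶ argOf Sg i → (resOf Sg i ∷ Γ) ⊩c c ∶ comp A Sg u E →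
            Γ ⊩c opC o v c ∶ comp A Sg u E
    doS   : ∀ {Γ c₁ c₂ A B Sg u E} → Γ ⊩c c₁ ∶ comp A Sg u E → (A ∷ Γ) ⊩c c₂ ∶ comp B Sg u E →
            Γ ⊩c doC c₁ c₂ ∶ comp B Sg u E
    withS : ∀ {Γ v c C D} → Γ ⊩v v ∶ C ⇛ D → Γ ⊩c c ∶ C → Γ ⊩c withC v c ∶ D

  data SClause (Γ : Ctx) (h : Clauses) (o : OpName) (A B : VTy) (D : CTy) : Set where
    clauseS : (c : Comp) → lookupCl h o ≡ just c → ((B ⇾ D) ∷ A ∷ Γ) ⊩c c ∶ D →
              SClause Γ h o A B D

  data SClauses (Γ : Ctx) (h : Clauses) (Sg : Sig) (D : CTy) : Set where
    clausesS : ((i : OpIx Sg) → SClause Γ h (nameOf Sg i) (argOf Sg i) (resOf Sg i) D) →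
               SClauses Γ h Sg D

  ⟪_⟫v : ∀ {Γ v A} → Γ ⊩v v ∶ A → ⟦ Γ ⟧x → ⟦ A ⟧v
  ⟪ varS q ⟫v η = lookupEnv q η
  ⟪ unitS ⟫v η = tt
  ⟪ trueS ⟫v η = true
  ⟪ falseS ⟫v η = false
  ⟪ funS d ⟫v η = λ a → ⟪ d ⟫c (a , η)
  ⟪ handlerS d cl _ ⟫v η = liftF (λ a → ⟪ d ⟫c (a , η)) (⟪ cl ⟫h η)

  ⟪_⟫c : ∀ {Γ c C} → Γ ⊩c c ∶ C → ⟦ Γ ⟧x → ⟦ C ⟧c
  ⟪ ifS v d₁ d₂ ⟫c η = if ⟪ v ⟫v η then ⟪ d₁ ⟫c η else ⟪ d₂ ⟫c η
  ⟪ appS v w ⟫c η = ⟪ v ⟫v η (⟪ w ⟫v η)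
  ⟪ retS v ⟫c η = in-ret (⟪ v ⟫v η)
  ⟪ opS {Sg = Sg} i _ v d ⟫c η =
    in-op i (toAr Sg i (⟪ v ⟫v η)) (λ b → ⟪ d ⟫c (fromRes Sg i b , η))
  ⟪ doS {B = B} {Sg = Sg} d₁ d₂ ⟫c η =
    liftF (λ a → ⟪ d₂ ⟫c (a , η)) (freeI Sg ⟦ B ⟧v) (⟪ d₁ ⟫c η)
  ⟪ withS v d ⟫c η = ⟪ v ⟫v η (⟪ d ⟫c η)

  ⟪_⟫cl : ∀ {Γ h o A B D} → SClause Γ h o A B D → ⟦ Γ ⟧x → ⟦ A ⟧v → (⟦ B ⟧v → ⟦ D ⟧c) → ⟦ D ⟧c
  ⟪ clauseS _ _ d ⟫cl η a κ = ⟪ d ⟫c (κ , a , η)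

  ⟪_⟫h : ∀ {Γ h Sg D} → SClauses Γ h Sg D → ⟦ Γ ⟧x → Interp Sg ⟦ D ⟧c
  ⟪_⟫h {Sg = Sg} (clausesS cl) η i a κ = ⟪ cl i ⟫cl η (fromAr Sg i a) (λ b → κ (toRes Sg i b))

ClauseR : ∀ A B D → Rel (⟦ A ⟧v → (⟦ B ⟧v → ⟦ D ⟧c) → ⟦ D ⟧c)
ClauseR A B D g g' = ∀ a a' → VR A a a' → ∀ κ κ' → VR (B ⇾ D) κ κ' → CR D (g a κ) (g' a' κ')

clauses-alg : ∀ Sg D {g g' : (i : OpIx Sg) → ⟦ argOf Sg i ⟧v → (⟦ resOf Sg i ⟧v → ⟦ D ⟧c) → ⟦ D ⟧c} →
  (∀ i → ClauseR (argOf Sg i) (resOf Sg i) D (g i) (g' i)) →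
  AlgR Sg D (λ i a κ → g i (fromAr Sg i a) (λ b → κ (toRes Sg i b)))
            (λ i a κ → g' i (fromAr Sg i a) (λ b → κ (toRes Sg i b)))
clauses-alg Sg D r i a a' ra κ κ' rκ =
  r i _ _ (ArR-from Sg i ra) _ _ (λ b b' s → rκ _ _ (ResR-to Sg i s))

mutual
  fundV : ∀ {Γ v A} (d : Γ ⊩v v ∶ A) {η η'} → CtxR Γ η η' → VR A (⟪ d ⟫v η) (⟪ d ⟫v η')
  fundV (varS q) r = CtxR-lookup q r
  fundV unitS r = refl
  fundV trueS r = refl
  fundV falseS r = refl
  fundV (funS d) r a a' s = fundC d (s , r)
  fundV (handlerS {Γ} {A} {Sg} {u} {E} {D} d cl snd) r t t' s =
    lift-cong A Sg u E D (λ a a' s → fundC d (s , r))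
      (fundH cl r)
      (snd _ _ (CtxR-reflˡ Γ r)) s

  fundC : ∀ {Γ c C} (d : Γ ⊩c c ∶ C) {η η'} → CtxR Γ η η' → CR C (⟪ d ⟫c η) (⟪ d ⟫c η')
  fundC {C = C} (ifS v d₁ d₂) r = if-cong C (fundV v r) (fundC d₁ r) (fundC d₂ r)
  fundC (appS v w) r = fundV v r _ _ (fundV w r)
  fundC (retS v) r = retR (fundV v r)
  fundC (opS {A = A} {Sg} {u} {E} i _ v d) r = op-cong A Sg u E i (fundV v r) (λ b b' s → fundC d (s , r))
  fundC (doS {A = A} {B} {Sg} {u} {E} d₁ d₂) r = bind-cong A B Sg u E (λ a a' s → fundC d₂ (s , r)) (fundC d₁ r)
  fundC (withS v d) r = fundV v r _ _ (fundC d r)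

  fundCl : ∀ {Γ h o A B D} (cl : SClause Γ h o A B D) {η η'} → CtxR Γ η η' →
           ClauseR A B D (⟪ cl ⟫cl η) (⟪ cl ⟫cl η')
  fundCl (clauseS _ _ d) r a a' ra κ κ' rκ = fundC d (rκ , ra , r)

  fundH : ∀ {Γ h Sg D} (cl : SClauses Γ h Sg D) {η η'} → CtxR Γ η η' →
          AlgR Sg D (⟪ cl ⟫h η) (⟪ cl ⟫h η')
  fundH {Sg = Sg} {D} (clausesS cl) r = clauses-alg Sg D (λ i → fundCl (cl i) r)

-- Substitution

-- A stable derivation has a tree related to itself, so its meanings under related interpretations
-- are related, on either side of the equation.
EqnSound-resp : ∀ Sg E D {H H' K K'} → AlgR Sg D K H → AlgR Sg D K' H' →
                EqnSound Sg E D H H' → EqnSound Sg E D K K'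
EqnSound-resp Sg E D r r' snd e d@((d₁ , d₂) , stable₁ , stable₂) as as' ra fs fs' rf =
  CR-trans D
    (tree-interp (CR D) r
      (λ j b b' s → CR-trans D (rf j b b' s) (CR-sym D (rf j b' b' (EZR-reflʳ E e j s))))
      d₁ d₁ (stable₁ d₁ ≤-refl as as (EXR-reflˡ E e ra)))
    (CR-trans D (snd e d as as' ra fs fs' rf)
      (CR-sym D (tree-interp (CR D) r'
        (λ j b b' s → CR-trans D (CR-sym D (rf j b b (EZR-reflˡ E e j s))) (rf j b b' s))
        d₂ d₂ (stable₂ d₂ ≤-refl as' as' (EXR-reflʳ E e ra)))))

lookup-subH : ∀ σ h o {c} → lookupCl h o ≡ just c →
              lookupCl (subH σ h) o ≡ just (subC (extS (extS σ)) c)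
lookup-subH σ ((o' , c') ∷ h) o e with o ≡ᵇ o'
lookup-subH σ ((o' , c') ∷ h) o refl | true = refl
lookup-subH σ ((o' , c') ∷ h) o e | false = lookup-subH σ h o e

-- Substituting under a binder needs weakening, which is itself a renaming, that is, a
-- substitution of variables; the class 𝒱 allows one traversal to serve for both.
module Traversal
  (𝒱 : ∀ {Γ w A} → Γ ⊩v w ∶ A → Set)
  (𝒱-var : ∀ {Γ A} → 𝒱 (varS (here {Γ} {A})))
  (𝒱-wk : ∀ {Γ w A} B (d : Γ ⊩v w ∶ A) → 𝒱 d →
          Σ[ d' ∈ (B ∷ Γ) ⊩v renV suc w ∶ A ] 𝒱 d' ×
          (∀ b η → CtxR (B ∷ Γ) (b , η) (b , η) → VR A (⟪ d' ⟫v (b , η)) (⟪ d ⟫v η)))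
  where

  data Sub (Γ : Ctx) : Ctx → Subst → Set where
    []  : ∀ {σ} → Sub Γ [] σ
    _∷_ : ∀ {A Γ' σ} → Σ[ d ∈ Γ ⊩v σ zero ∶ A ] 𝒱 d → Sub Γ Γ' (λ n → σ (suc n)) → Sub Γ (A ∷ Γ') σ

  env : ∀ {Γ Γ' σ} → Sub Γ Γ' σ → ⟦ Γ ⟧x → ⟦ Γ' ⟧x
  env [] η = tt
  env ((d , _) ∷ s) η = ⟪ d ⟫v η , env s η

  env-resp : ∀ {Γ Γ' σ} (s : Sub Γ Γ' σ) {η η'} → CtxR Γ η η' → CtxR Γ' (env s η) (env s η')
  env-resp [] r = tt
  env-resp ((d , _) ∷ s) r = fundV d r , env-resp s r

  wk : ∀ {Γ Γ' σ} B → Sub Γ Γ' σ → Sub (B ∷ Γ) Γ' (λ n → renV suc (σ n))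
  wk B [] = []
  wk B ((d , p) ∷ s) = (proj₁ (𝒱-wk B d p) , proj₁ (proj₂ (𝒱-wk B d p))) ∷ wk B s

  wk-env : ∀ {Γ Γ' σ} B (s : Sub Γ Γ' σ) {b η} → CtxR (B ∷ Γ) (b , η) (b , η) →
           CtxR Γ' (env (wk B s) (b , η)) (env s η)
  wk-env B [] r = tt
  wk-env B ((d , p) ∷ s) r = proj₂ (proj₂ (𝒱-wk B d p)) _ _ r , wk-env B s r

  ext : ∀ {Γ Γ' σ} B → Sub Γ Γ' σ → Sub (B ∷ Γ) (B ∷ Γ') (extS σ)
  ext B s = (varS here , 𝒱-var) ∷ wk B s

  -- Equality with `env s η` would not pass under a binder, where weakened values have meanings only
  -- related to the original ones. That `η` is related to itself is what `𝒱-wk` asks for.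
  Related : ∀ {Γ Γ' σ} → Sub Γ Γ' σ → ⟦ Γ ⟧x → ⟦ Γ' ⟧x → Set
  Related {Γ} {Γ'} s η η' = CtxR Γ η η × CtxR Γ' (env s η) η'

  related-self : ∀ {Γ Γ' σ} (s : Sub Γ Γ' σ) {η} → CtxR Γ η η → Related s η (env s η)
  related-self s r = r , env-resp s r

  related-ext : ∀ {Γ Γ' σ} B (s : Sub Γ Γ' σ) {η η' b b'} → VR B b b' → Related s η η' →
                Related (ext B s) (b , η) (b' , η')
  related-ext {Γ' = Γ'} B s rb (r , rs) =
    self , rb , CtxR-trans Γ' (wk-env B s self) rs
    where self = VR-reflˡ B rb , r

  mutual
    substituteV : ∀ {Γ Γ' σ v A} (s : Sub Γ Γ' σ) (d : Γ' ⊩v v ∶ A) →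
      Σ[ d' ∈ Γ ⊩v subV σ v ∶ A ]
        (∀ {η η'} → Related s η η' → VR A (⟪ d' ⟫v η) (⟪ d ⟫v η'))
    substituteV ((d , _) ∷ s) (varS here) = d , λ r → proj₁ (proj₂ r)
    substituteV (_ ∷ s) (varS (there q)) with substituteV s (varS q)
    ... | d' , k = d' , λ r → k (proj₁ r , proj₂ (proj₂ r))
    substituteV s unitS = unitS , λ _ → refl
    substituteV s trueS = trueS , λ _ → refl
    substituteV s falseS = falseS , λ _ → refl
    substituteV s (funS {A = A} d) with substituteC (ext A s) d
    ... | d' , k = funS d' , λ r a a' ra → k (related-ext A s ra r)
    substituteV {Γ} {σ = σ} s (handlerS {A = A} {Sg} {u} {E} {D} {h = h} d cl snd)
      with substituteC (ext A s) d | substituteH s cl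
    ... | d' , k | cl' , k' =
      handlerS d' cl' snd' ,
      λ r t t' → lift-cong A Sg u E D (λ a a' ra → k (related-ext A s ra r)) (k' r)
                   (snd' _ _ (proj₁ r))
      where
      -- Soundness at `env s η` is transported along the agreement of the two clause meanings; no
      -- derivation of an equation has to be substituted into.
      snd' : ∀ η η' → CtxR Γ η η' → EqnSound Sg E D (⟪ cl' ⟫h η) (⟪ cl' ⟫h η')
      snd' η η' r = EqnSound-resp Sg E D
        (k' (related-self s (CtxR-reflˡ Γ r))) (k' (related-self s (CtxR-reflʳ Γ r)))
        (snd _ _ (env-resp s r))

    substituteC : ∀ {Γ Γ' σ c C} (s : Sub Γ Γ' σ) (d : Γ' ⊩c c ∶ C) →
      Σ[ d' ∈ Γ ⊩c subC σ c ∶ C ]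
        (∀ {η η'} → Related s η η' → CR C (⟪ d' ⟫c η) (⟪ d ⟫c η'))
    substituteC {C = C} s (ifS v d₁ d₂) with substituteV s v | substituteC s d₁ | substituteC s d₂
    ... | v' , k | d₁' , k₁ | d₂' , k₂ = ifS v' d₁' d₂' , λ r → if-cong C (k r) (k₁ r) (k₂ r)
    substituteC s (appS v w) with substituteV s v | substituteV s w
    ... | v' , k | w' , k' = appS v' w' , λ r → k r _ _ (k' r)
    substituteC s (retS v) with substituteV s v
    ... | v' , k = retS v' , λ r → retR (k r)
    substituteC s (opS {A = A} {Sg} {u} {E} i e v d)
      with substituteV s v | substituteC (ext (resOf Sg i) s) d
    ... | v' , k | d' , k' =
      opS i e v' d' , λ r → op-cong A Sg u E i (k r) (λ b b' rb → k' (related-ext _ s rb r))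
    substituteC s (doS {A = A} {B} {Sg} {u} {E} d₁ d₂)
      with substituteC s d₁ | substituteC (ext A s) d₂
    ... | d₁' , k₁ | d₂' , k₂ =
      doS d₁' d₂' , λ r → bind-cong A B Sg u E (λ a a' ra → k₂ (related-ext A s ra r)) (k₁ r)
    substituteC s (withS v d) with substituteV s v | substituteC s d
    ... | v' , k | d' , k' = withS v' d' , λ r → k r _ _ (k' r)

    substituteCl : ∀ {Γ Γ' σ h o A B D} (s : Sub Γ Γ' σ) (cl : SClause Γ' h o A B D) →
      Σ[ cl' ∈ SClause Γ (subH σ h) o A B D ]
        (∀ {η η'} → Related s η η' → ClauseR A B D (⟪ cl' ⟫cl η) (⟪ cl ⟫cl η'))
    substituteCl {σ = σ} {h} {o} {A} {B} {D} s (clauseS c e d)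
      with substituteC (ext (B ⇾ D) (ext A s)) d
    ... | d' , k =
      clauseS _ (lookup-subH σ h o e) d' ,
      λ r a a' ra κ κ' rκ → k (related-ext (B ⇾ D) (ext A s) rκ (related-ext A s ra r))

    substituteH : ∀ {Γ Γ' σ h Sg D} (s : Sub Γ Γ' σ) (cl : SClauses Γ' h Sg D) →
      Σ[ cl' ∈ SClauses Γ (subH σ h) Sg D ]
        (∀ {η η'} → Related s η η' → AlgR Sg D (⟪ cl' ⟫h η) (⟪ cl ⟫h η'))
    substituteH {Sg = Sg} {D} s (clausesS cl) =
      clausesS (λ i → proj₁ (substituteCl s (cl i))) ,
      λ r → clauses-alg Sg D (λ i → proj₂ (substituteCl s (cl i)) r)

-- Renaming and weakening

mutual
  renV≡subV : ∀ {ρ σ} → (∀ n → var (ρ n) ≡ σ n) → ∀ v → renV ρ v ≡ subV σ v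
  renV≡subV e (var n) = e n
  renV≡subV e unitV = refl
  renV≡subV e trueV = refl
  renV≡subV e falseV = refl
  renV≡subV e (fun c) = cong fun (renC≡subC (ext-var e) c)
  renV≡subV e (handler c h) = cong₂ handler (renC≡subC (ext-var e) c) (renH≡subH e h)

  renC≡subC : ∀ {ρ σ} → (∀ n → var (ρ n) ≡ σ n) → ∀ c → renC ρ c ≡ subC σ c
  renC≡subC e (ifC v c₁ c₂)
    rewrite renV≡subV e v | renC≡subC e c₁ | renC≡subC e c₂ = refl
  renC≡subC e (app v w) = cong₂ app (renV≡subV e v) (renV≡subV e w)
  renC≡subC e (ret v) = cong ret (renV≡subV e v)
  renC≡subC e (opC o v c) = cong₂ (opC o) (renV≡subV e v) (renC≡subC (ext-var e) c)
  renC≡subC e (doC c₁ c₂) = cong₂ doC (renC≡subC e c₁) (renC≡subC (ext-var e) c₂)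
  renC≡subC e (withC v c) = cong₂ withC (renV≡subV e v) (renC≡subC e c)

  renH≡subH : ∀ {ρ σ} → (∀ n → var (ρ n) ≡ σ n) → ∀ h → renH ρ h ≡ subH σ h
  renH≡subH e [] = refl
  renH≡subH e ((o , c) ∷ h) =
    cong₂ _∷_ (cong (o ,_) (renC≡subC (ext-var (ext-var e)) c)) (renH≡subH e h)

  ext-var : ∀ {ρ σ} → (∀ n → var (ρ n) ≡ σ n) → ∀ n → var (extR ρ n) ≡ extS σ n
  ext-var e zero = refl
  ext-var e (suc n) = cong (renV suc) (e n)

-- For variables, weakening is the shift of an index, so this use of the traversal presupposes no
-- weakening lemma. It yields `weaken`, on which the use for arbitrary values rests.
data IsVar : ∀ {Γ w A} → Γ ⊩v w ∶ A → Set where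
  isVar : ∀ {Γ n A} {q : Γ ∋ n ∶ A} → IsVar (varS q)

wk-var : ∀ {Γ w A} B (d : Γ ⊩v w ∶ A) → IsVar d →
  Σ[ d' ∈ (B ∷ Γ) ⊩v renV suc w ∶ A ] IsVar d' ×
  (∀ b η → CtxR (B ∷ Γ) (b , η) (b , η) → VR A (⟪ d' ⟫v (b , η)) (⟪ d ⟫v η))
wk-var B (varS q) isVar = varS (there q) , isVar , λ _ _ r → CtxR-lookup q (proj₂ r)

module Rename = Traversal IsVar isVar wk-var

Renaming : Ctx → Ctx → Ren → Set
Renaming Γ Γ' ρ = ∀ {n A} → Γ' ∋ n ∶ A → Γ ∋ ρ n ∶ A

RenamedEnv : ∀ {Γ Γ' ρ} → Renaming Γ Γ' ρ → ⟦ Γ ⟧x → ⟦ Γ' ⟧x → Set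
RenamedEnv {Γ} {Γ'} r η η' =
  ∀ {n A} (q : Γ' ∋ n ∶ A) → VR A (lookupEnv (r q) η) (lookupEnv q η')

ren-sub : ∀ {Γ} Γ' {ρ} → Renaming Γ Γ' ρ → Rename.Sub Γ Γ' (λ n → var (ρ n))
ren-sub [] r = Rename.[]
ren-sub (A ∷ Γ') r = (varS (r here) , isVar) Rename.∷ ren-sub Γ' (λ q → r (there q))

ren-sub-env : ∀ {Γ} Γ' {ρ} (r : Renaming Γ Γ' ρ) {η η'} → RenamedEnv {Γ} {Γ'} {ρ} r η η' →
              CtxR Γ' (Rename.env (ren-sub Γ' {ρ} r) η) η'
ren-sub-env [] r k = tt
ren-sub-env (A ∷ Γ') {ρ} r k =
  k here , ren-sub-env Γ' {λ n → ρ (suc n)} (λ q → r (there q)) (λ q → k (there q))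

renameV : ∀ {Γ Γ' v A} ρ (r : Renaming Γ Γ' ρ) (d : Γ' ⊩v v ∶ A) →
  Σ[ d' ∈ Γ ⊩v renV ρ v ∶ A ]
    (∀ {η η'} → CtxR Γ η η → RenamedEnv {Γ} {Γ'} {ρ} r η η' → VR A (⟪ d' ⟫v η) (⟪ d ⟫v η'))
renameV {Γ' = Γ'} {v} ρ r d rewrite renV≡subV {ρ} (λ _ → refl) v with Rename.substituteV (ren-sub Γ' {ρ} r) d
... | d' , k = d' , λ rη rη' → k (rη , ren-sub-env Γ' {ρ} r rη')

renameC : ∀ {Γ Γ' c C} ρ (r : Renaming Γ Γ' ρ) (d : Γ' ⊩c c ∶ C) →
  Σ[ d' ∈ Γ ⊩c renC ρ c ∶ C ]
    (∀ {η η'} → CtxR Γ η η → RenamedEnv {Γ} {Γ'} {ρ} r η η' → CR C (⟪ d' ⟫c η) (⟪ d ⟫c η'))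
renameC {Γ' = Γ'} {c} ρ r d rewrite renC≡subC {ρ} (λ _ → refl) c with Rename.substituteC (ren-sub Γ' {ρ} r) d
... | d' , k = d' , λ rη rη' → k (rη , ren-sub-env Γ' {ρ} r rη')

weaken : ∀ {Γ w A} B (d : Γ ⊩v w ∶ A) →
  Σ[ d' ∈ (B ∷ Γ) ⊩v renV suc w ∶ A ]
  (∀ b η → CtxR (B ∷ Γ) (b , η) (b , η) → VR A (⟪ d' ⟫v (b , η)) (⟪ d ⟫v η))
weaken {Γ} B d with renameV suc there d
... | d' , k = d' , λ b η r → k r (λ q → CtxR-lookup q (proj₂ r))

-- Substitution of arbitrary values

AnyValue : ∀ {Γ w A} → Γ ⊩v w ∶ A → Set
AnyValue _ = ⊤

wk-any : ∀ {Γ w A} B (d : Γ ⊩v w ∶ A) → AnyValue d →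
  Σ[ d' ∈ (B ∷ Γ) ⊩v renV suc w ∶ A ] AnyValue d' ×
  (∀ b η → CtxR (B ∷ Γ) (b , η) (b , η) → VR A (⟪ d' ⟫v (b , η)) (⟪ d ⟫v η))
wk-any B d _ = proj₁ (weaken B d) , tt , proj₂ (weaken B d)

open Traversal AnyValue tt wk-any

var-sub : ∀ {Γ} Γ' {ρ} → Renaming Γ Γ' ρ → Sub Γ Γ' (λ n → var (ρ n))
var-sub [] r = []
var-sub (A ∷ Γ') r = (varS (r here) , tt) ∷ var-sub Γ' (λ q → r (there q))

var-sub-env : ∀ {Γ} Γ' {ρ} (r : Renaming Γ Γ' ρ) {η η'} → RenamedEnv {Γ} {Γ'} {ρ} r η η' →
              CtxR Γ' (env (var-sub Γ' {ρ} r) η) η'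
var-sub-env [] r k = tt
var-sub-env (A ∷ Γ') {ρ} r k =
  k here , var-sub-env Γ' {λ n → ρ (suc n)} (λ q → r (there q)) (λ q → k (there q))

id-sub : ∀ Γ → Sub Γ Γ var
id-sub Γ = var-sub Γ (λ q → q)

id-sub-env : ∀ Γ {η η'} → CtxR Γ η η' → CtxR Γ (env (id-sub Γ) η) η'
id-sub-env Γ r = var-sub-env Γ (λ q → q) (λ q → CtxR-lookup q r)

instV : ∀ {Γ v w A B} (d : (A ∷ Γ) ⊩v v ∶ B) (dw : Γ ⊩v w ∶ A) →
  Σ[ d' ∈ Γ ⊩v v [ w ]V ∶ B ] (∀ {η η'} → CtxR Γ η η' → VR B (⟪ d' ⟫v η) (⟪ d ⟫v (⟪ dw ⟫v η' , η')))
instV {Γ} d dw with substituteV ((dw , tt) ∷ id-sub Γ) d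
... | d' , k = d' , λ r → k (CtxR-reflˡ Γ r , fundV dw r , id-sub-env Γ r)

instC : ∀ {Γ c w A C} (d : (A ∷ Γ) ⊩c c ∶ C) (dw : Γ ⊩v w ∶ A) →
  Σ[ d' ∈ Γ ⊩c c [ w ]C ∶ C ] (∀ {η η'} → CtxR Γ η η' → CR C (⟪ d' ⟫c η) (⟪ d ⟫c (⟪ dw ⟫v η' , η')))
instC {Γ} d dw with substituteC ((dw , tt) ∷ id-sub Γ) d
... | d' , k = d' , λ r → k (CtxR-reflˡ Γ r , fundV dw r , id-sub-env Γ r)

-- Heterogeneous relations and coherence

-- Between different types there is no symmetry or transitivity to close under; `conjH` lets the
-- homogeneous relations act on both sides instead. `opH` stores that each continuation respects its
-- own relation, which is how each side is recovered as related to itself.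
data HFRel {I I' : Set} {P R : I → Set} {P' R' : I' → Set} {X X' : Set}
           (RX : X → X' → Set) (N : I → I' → Set)
           (RP : (i : I) (i' : I') → P i → P' i' → Set)
           (RR : (i : I) (i' : I') → R i → R' i' → Set)
           (L : Rel (Free I P R X)) (L' : Rel (Free I' P' R' X'))
           (SR : (i : I) → Rel (R i)) (SR' : (i' : I') → Rel (R' i')) :
           Free I P R X → Free I' P' R' X' → Set where
  retH  : ∀ {a a'} → RX a a' → HFRel RX N RP RR L L' SR SR' (in-ret a) (in-ret a')
  opH   : ∀ {i i' a a' κ κ'} → N i i' → RP i i' a a' →
          (∀ b b' → SR i b b' → L (κ b) (κ b')) → (∀ b b' → SR' i' b b' → L' (κ' b) (κ' b')) →
          (∀ b b' → RR i i' b b' → HFRel RX N RP RR L L' SR SR' (κ b) (κ' b')) →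
          HFRel RX N RP RR L L' SR SR' (in-op i a κ) (in-op i' a' κ')
  conjH : ∀ {t t₁ t₁' t'} → L t t₁ → HFRel RX N RP RR L L' SR SR' t₁ t₁' → L' t₁' t' →
          HFRel RX N RP RR L L' SR SR' t t'

mutual
  -- The two self-relations are stored so that arguments and environments arising in a coherence
  -- proof can be handed to `fundV` and to functions that respect `VR`.
  VS : (A A' : VTy) → ⟦ A ⟧v → ⟦ A' ⟧v → Set
  VS A A' a a' = VR A a a × VR A' a' a' × VS₀ A A' a a'

  VS₀ : (A A' : VTy) → ⟦ A ⟧v → ⟦ A' ⟧v → Set
  VS₀ unit unit _ _ = ⊤
  VS₀ bool bool b b' = b ≡ b'
  VS₀ (A ⇾ C) (A' ⇾ C') f f' = ∀ a a' → VS A A' a a' → CS C C' (f a) (f' a')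
  VS₀ (C ⇛ D) (C' ⇛ D') h h' = ∀ t t' → CS C C' t t' → CS D D' (h t) (h' t')
  VS₀ _ _ _ _ = ⊥

  CS : (C C' : CTy) → ⟦ C ⟧c → ⟦ C' ⟧c → Set
  CS (comp A Sg u E) (comp A' Sg' u' E') =
    HFRel (VS A A') (λ i i' → nameOf Sg i ≡ nameOf Sg' i') (ArS Sg Sg') (ResS Sg Sg')
          (CR (comp A Sg u E)) (CR (comp A' Sg' u' E')) (ResR Sg) (ResR Sg')

  -- Operations are matched by name and may stand at different positions of the two signatures, so
  -- the indices run down independently.
  ArS : (Sg Sg' : Sig) (i : OpIx Sg) (i' : OpIx Sg') → ⟦ Sg ⟧ar i → ⟦ Sg' ⟧ar i' → Set
  ArS ((_ , A , _) ∷ Sg) ((_ , A' , _) ∷ Sg') fzero fzero = VS A A'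
  ArS (x ∷ Sg) (_ ∷ Sg') fzero (fsuc i') = ArS (x ∷ Sg) Sg' fzero i'
  ArS (_ ∷ Sg) (x ∷ Sg') (fsuc i) fzero = ArS Sg (x ∷ Sg') i fzero
  ArS (_ ∷ Sg) (_ ∷ Sg') (fsuc i) (fsuc i') = ArS Sg Sg' i i'

  ResS : (Sg Sg' : Sig) (i : OpIx Sg) (i' : OpIx Sg') → ⟦ Sg ⟧res i → ⟦ Sg' ⟧res i' → Set
  ResS ((_ , _ , B) ∷ Sg) ((_ , _ , B') ∷ Sg') fzero fzero = VS B B'
  ResS (x ∷ Sg) (_ ∷ Sg') fzero (fsuc i') = ResS (x ∷ Sg) Sg' fzero i'
  ResS (_ ∷ Sg) (x ∷ Sg') (fsuc i) fzero = ResS Sg (x ∷ Sg') i fzero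
  ResS (_ ∷ Sg) (_ ∷ Sg') (fsuc i) (fsuc i') = ResS Sg Sg' i i'

ArS-from : ∀ Sg Sg' i i' {a a'} → ArS Sg Sg' i i' a a' →
           VS (argOf Sg i) (argOf Sg' i') (fromAr Sg i a) (fromAr Sg' i' a')
ArS-from (_ ∷ Sg) (_ ∷ Sg') fzero fzero r = r
ArS-from (x ∷ Sg) (_ ∷ Sg') fzero (fsuc i') r = ArS-from (x ∷ Sg) Sg' fzero i' r
ArS-from (_ ∷ Sg) (x ∷ Sg') (fsuc i) fzero r = ArS-from Sg (x ∷ Sg') i fzero r
ArS-from (_ ∷ Sg) (_ ∷ Sg') (fsuc i) (fsuc i') r = ArS-from Sg Sg' i i' r

ArS-to : ∀ Sg Sg' i i' {a a'} → VS (argOf Sg i) (argOf Sg' i') a a' →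
         ArS Sg Sg' i i' (toAr Sg i a) (toAr Sg' i' a')
ArS-to (_ ∷ Sg) (_ ∷ Sg') fzero fzero r = r
ArS-to (x ∷ Sg) (_ ∷ Sg') fzero (fsuc i') r = ArS-to (x ∷ Sg) Sg' fzero i' r
ArS-to (_ ∷ Sg) (x ∷ Sg') (fsuc i) fzero r = ArS-to Sg (x ∷ Sg') i fzero r
ArS-to (_ ∷ Sg) (_ ∷ Sg') (fsuc i) (fsuc i') r = ArS-to Sg Sg' i i' r

ResS-from : ∀ Sg Sg' i i' {b b'} → ResS Sg Sg' i i' b b' →
            VS (resOf Sg i) (resOf Sg' i') (fromRes Sg i b) (fromRes Sg' i' b')
ResS-from (_ ∷ Sg) (_ ∷ Sg') fzero fzero r = r
ResS-from (x ∷ Sg) (_ ∷ Sg') fzero (fsuc i') r = ResS-from (x ∷ Sg) Sg' fzero i' r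
ResS-from (_ ∷ Sg) (x ∷ Sg') (fsuc i) fzero r = ResS-from Sg (x ∷ Sg') i fzero r
ResS-from (_ ∷ Sg) (_ ∷ Sg') (fsuc i) (fsuc i') r = ResS-from Sg Sg' i i' r

ResS-to : ∀ Sg Sg' i i' {b b'} → VS (resOf Sg i) (resOf Sg' i') b b' →
          ResS Sg Sg' i i' (toRes Sg i b) (toRes Sg' i' b')
ResS-to (_ ∷ Sg) (_ ∷ Sg') fzero fzero r = r
ResS-to (x ∷ Sg) (_ ∷ Sg') fzero (fsuc i') r = ResS-to (x ∷ Sg) Sg' fzero i' r
ResS-to (_ ∷ Sg) (x ∷ Sg') (fsuc i) fzero r = ResS-to Sg (x ∷ Sg') i fzero r
ResS-to (_ ∷ Sg) (_ ∷ Sg') (fsuc i) (fsuc i') r = ResS-to Sg Sg' i i' r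

CS-conj : ∀ D D' {t t₁ t₁' t'} → CR D t t₁ → CS D D' t₁ t₁' → CR D' t₁' t' → CS D D' t t'
CS-conj (comp _ _ _ _) (comp _ _ _ _) = conjH

-- The heterogeneous relation on the diagonal

nameOf-elem : ∀ Sg i → T (elem (nameOf Sg i) (map proj₁ Sg))
nameOf-elem ((o , _) ∷ Sg) fzero with o ≡ᵇ o | ≡⇒≡ᵇ o o refl
... | true | _ = tt
nameOf-elem ((o , _) ∷ Sg) (fsuc i) with nameOf Sg i ≡ᵇ o
... | true = tt
... | false = nameOf-elem Sg i

distinct-head : ∀ o Sg i → T (distinct (o ∷ map proj₁ Sg)) → nameOf Sg i ≡ o → ⊥
distinct-head o Sg i u refl with elem o (map proj₁ Sg) | nameOf-elem Sg i
distinct-head o Sg i () refl | true | _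

distinct-tail : ∀ o os → T (distinct (o ∷ os)) → T (distinct os)
distinct-tail o os u with elem o os
distinct-tail o os u | false = u

nameOf-injective : ∀ Sg → T (distinct (map proj₁ Sg)) → ∀ i i' → nameOf Sg i ≡ nameOf Sg i' → i ≡ i'
nameOf-injective (_ ∷ Sg) u fzero fzero e = refl
nameOf-injective ((o , _) ∷ Sg) u fzero (fsuc i') e = ⊥-elim (distinct-head o Sg i' u (sym e))
nameOf-injective ((o , _) ∷ Sg) u (fsuc i) fzero e = ⊥-elim (distinct-head o Sg i u e)
nameOf-injective ((o , _) ∷ Sg) u (fsuc i) (fsuc i') e =
  cong fsuc (nameOf-injective Sg (distinct-tail o (map proj₁ Sg) u) i i' e)

-- The equality of positions, obtained from distinct names, has to be eliminated before the diagonal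
-- conversions apply. These are arguments because they belong to the mutual recursion below.
match-op : ∀ A Sg u E {i i' a a' κ κ'} → i ≡ i' →
  (∀ i {a a'} → ArS Sg Sg i i a a' → ArR Sg i a a') →
  (∀ i {b b'} → ResR Sg i b b' → ResS Sg Sg i i b b') →
  ArS Sg Sg i i' a a' → (∀ b b' → ResS Sg Sg i i' b b' → CR (comp A Sg u E) (κ b) (κ' b')) →
  CR (comp A Sg u E) (in-op i a κ) (in-op i' a' κ')
match-op A Sg u E {i} refl fa fr r rs = opR i (fa i r) (λ b b' s → rs b b' (fr i s))

mutual
  VR⇒VS : ∀ A {a a'} → VR A a a' → VS A A a a'
  VR⇒VS A r = VR-reflˡ A r , VR-reflʳ A r , VR⇒VS₀ A r

  VR⇒VS₀ : ∀ A {a a'} → VR A a a' → VS₀ A A a a'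
  VR⇒VS₀ unit r = tt
  VR⇒VS₀ bool r = r
  VR⇒VS₀ (A ⇾ C) r a a' s = CR⇒CS C (r a a' (VS⇒VR A s))
  VR⇒VS₀ (C ⇛ D) r t t' s = CR⇒CS D (r t t' (CS⇒CR C s))

  VS⇒VR : ∀ A {a a'} → VS A A a a' → VR A a a'
  VS⇒VR unit r = refl
  VS⇒VR bool (_ , _ , r) = r
  VS⇒VR (A ⇾ C) (_ , _ , r) a a' s = CS⇒CR C (r a a' (VR⇒VS A s))
  VS⇒VR (C ⇛ D) (_ , _ , r) t t' s = CS⇒CR D (r t t' (CR⇒CS C s))

  CS⇒CR : ∀ C {t t'} → CS C C t t' → CR C t t'
  CS⇒CR (comp A Sg u E) (retH r) = retR (VS⇒VR A r)
  CS⇒CR (comp A Sg u E) (opH {i} {i'} e r _ _ rs) =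
    match-op A Sg u E (nameOf-injective Sg u i i' e) (λ i → ArS⇒ArR Sg i) (λ i → ResR⇒ResS Sg i)
      r (λ b b' s → CS⇒CR (comp A Sg u E) (rs b b' s))
  CS⇒CR (comp A Sg u E) (conjH l r l') = transR l (transR (CS⇒CR (comp A Sg u E) r) l')

  CR⇒CS : ∀ C {t t'} → CR C t t' → CS C C t t'
  -- Instead of reversing `CS`, the unreversed comparison is placed between two uses of the reversed
  -- `CR`.
  CR⇒CS (comp A Sg u E) (symR r) = conjH (symR r) (CR⇒CS (comp A Sg u E) r) (symR r)
  CR⇒CS (comp A Sg u E) (transR r s) =
    conjH r (CR⇒CS (comp A Sg u E) s) (transR (symR s) s)
  CR⇒CS (comp A Sg u E) (retR r) = retH (VR⇒VS A r)
  CR⇒CS (comp A Sg u E) (opR i r rs) =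
    opH refl (ArR⇒ArS Sg i r)
      (λ b b' s → transR (rs b b' s) (symR (rs b' b' (ResR-reflʳ Sg i s))))
      (λ b b' s → transR (symR (rs b b (ResR-reflˡ Sg i s))) (rs b b' s))
      (λ b b' s → CR⇒CS (comp A Sg u E) (rs b b' (ResS⇒ResR Sg i s)))
  CR⇒CS (comp A Sg u E) (eqnR e d@((_ , d₂) , _ , stable₂) {as} {as'} {fs} {fs'} r rs) =
    -- The equation is crossed once, on the left; what remains is the right template against itself,
    -- rebuilt along its tree. `CR` is carried beside `CS` because `opH` also asks the continuations
    -- to respect `CR`.
    conjH (eqnR e d r rs)
      (proj₁ (tree-interp {RZ = EZR E e}
                (λ t t' → CS (comp A Sg u E) (comp A Sg u E) t t' × CR (comp A Sg u E) t t')
                (λ i a a' ra κ κ' k →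
                  opH refl (ArR⇒ArS Sg i ra)
                    (λ b b' s → transR (proj₂ (k b b' s)) (symR (proj₂ (k b' b' (ResR-reflʳ Sg i s)))))
                    (λ b b' s → transR (symR (proj₂ (k b b (ResR-reflˡ Sg i s)))) (proj₂ (k b b' s)))
                    (λ b b' s → proj₁ (k b b' (ResS⇒ResR Sg i s))) ,
                  opR i ra (λ b b' s → proj₂ (k b b' s)))
                (λ j b b' s →
                  conjH (symR (rs j b b (EZR-reflˡ E e j s))) (CR⇒CS (comp A Sg u E) (rs j b b' s))
                    (transR (symR (rs j b b' s)) (rs j b b' s)) ,
                  transR (symR (rs j b b (EZR-reflˡ E e j s))) (rs j b b' s))
                d₂ d₂
                (stable₂ d₂ ≤-refl as' as' (EXR-reflʳ E e r))))
      (CR-reflʳ (comp A Sg u E) (eqnR e d r rs))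

  ArR⇒ArS : ∀ Sg i {a a'} → ArR Sg i a a' → ArS Sg Sg i i a a'
  ArR⇒ArS ((_ , A , _) ∷ Sg) fzero r = VR⇒VS A r
  ArR⇒ArS (_ ∷ Sg) (fsuc i) r = ArR⇒ArS Sg i r

  ArS⇒ArR : ∀ Sg i {a a'} → ArS Sg Sg i i a a' → ArR Sg i a a'
  ArS⇒ArR ((_ , A , _) ∷ Sg) fzero r = VS⇒VR A r
  ArS⇒ArR (_ ∷ Sg) (fsuc i) r = ArS⇒ArR Sg i r

  ResR⇒ResS : ∀ Sg i {b b'} → ResR Sg i b b' → ResS Sg Sg i i b b'
  ResR⇒ResS ((_ , _ , B) ∷ Sg) fzero r = VR⇒VS B r
  ResR⇒ResS (_ ∷ Sg) (fsuc i) r = ResR⇒ResS Sg i r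

  ResS⇒ResR : ∀ Sg i {b b'} → ResS Sg Sg i i b b' → ResR Sg i b b'
  ResS⇒ResR ((_ , _ , B) ∷ Sg) fzero r = VS⇒VR B r
  ResS⇒ResR (_ ∷ Sg) (fsuc i) r = ResS⇒ResR Sg i r

-- Coherence of semantic typing

CtxS : (Γ Γ' : Ctx) → ⟦ Γ ⟧x → ⟦ Γ' ⟧x → Set
CtxS [] [] η η' = ⊤
CtxS (A ∷ Γ) (A' ∷ Γ') (a , η) (a' , η') = VS A A' a a' × CtxS Γ Γ' η η'
CtxS _ _ _ _ = ⊥

CtxS-reflˡ : ∀ Γ Γ' {η η'} → CtxS Γ Γ' η η' → CtxR Γ η η
CtxS-reflˡ [] [] r = tt
CtxS-reflˡ (A ∷ Γ) (A' ∷ Γ') ((r , _) , rs) = r , CtxS-reflˡ Γ Γ' rs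

CtxS-reflʳ : ∀ Γ Γ' {η η'} → CtxS Γ Γ' η η' → CtxR Γ' η' η'
CtxS-reflʳ [] [] r = tt
CtxS-reflʳ (A ∷ Γ) (A' ∷ Γ') ((_ , r , _) , rs) = r , CtxS-reflʳ Γ Γ' rs

CtxS-lookup : ∀ {Γ Γ' n A A' η η'} (q : Γ ∋ n ∶ A) (q' : Γ' ∋ n ∶ A') → CtxS Γ Γ' η η' →
              VS A A' (lookupEnv q η) (lookupEnv q' η')
CtxS-lookup here here (r , _) = r
CtxS-lookup (there q) (there q') (_ , rs) = CtxS-lookup q q' rs

CtxR⇒CtxS : ∀ Γ {η η'} → CtxR Γ η η' → CtxS Γ Γ η η'
CtxR⇒CtxS [] r = tt
CtxR⇒CtxS (A ∷ Γ) (r , rs) = VR⇒VS A r , CtxR⇒CtxS Γ rs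

AlgS : ∀ Sg Sg' D D' → Interp Sg ⟦ D ⟧c → Interp Sg' ⟦ D' ⟧c → Set
AlgS Sg Sg' D D' H H' =
  ∀ i i' a a' → nameOf Sg i ≡ nameOf Sg' i' → ArS Sg Sg' i i' a a' → ∀ κ κ' →
  (∀ b b' → ResR Sg i b b' → CR D (κ b) (κ b')) → (∀ b b' → ResR Sg' i' b b' → CR D' (κ' b) (κ' b')) →
  (∀ b b' → ResS Sg Sg' i i' b b' → CS D D' (κ b) (κ' b')) → CS D D' (H i a κ) (H' i' a' κ')

-- The lifts must respect the homogeneous relations because `conjH` moves either side along them.
lift-het : ∀ A Sg u E A' Sg' u' E' D D' {f f' H H'} →
  (∀ {t t'} → CR (comp A Sg u E) t t' → CR D (liftF f H t) (liftF f H t')) →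
  (∀ {t t'} → CR (comp A' Sg' u' E') t t' → CR D' (liftF f' H' t) (liftF f' H' t')) →
  (∀ a a' → VS A A' a a' → CS D D' (f a) (f' a')) → AlgS Sg Sg' D D' H H' →
  ∀ {t t'} → CS (comp A Sg u E) (comp A' Sg' u' E') t t' → CS D D' (liftF f H t) (liftF f' H' t')
lift-het A Sg u E A' Sg' u' E' D D' {f} {f'} {H} {H'} resp resp' rf alg = go
  where
  go : ∀ {t t'} → CS (comp A Sg u E) (comp A' Sg' u' E') t t' → CS D D' (liftF f H t) (liftF f' H' t')
  go (retH r) = rf _ _ r
  go (opH {i} {i'} e r k k' rs) =
    alg i i' _ _ e r _ _ (λ b b' s → resp (k b b' s)) (λ b b' s → resp' (k' b b' s))
      (λ b b' s → go (rs b b' s))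
  go (conjH l r l') = CS-conj D D' (resp l) (go r) (resp' l')

mutual
  -- Two derivations of one term are followed in parallel. Even with equal types at the root they
  -- may part at a hidden type, such as the argument type of an application, so the induction needs
  -- two types and two contexts.
  cohV : ∀ {Γ Γ' v A A'} (d : Γ ⊩v v ∶ A) (d' : Γ' ⊩v v ∶ A') {η η'} → CtxS Γ Γ' η η' →
         VS A A' (⟪ d ⟫v η) (⟪ d' ⟫v η')
  cohV {Γ} {Γ'} d d' r = fundV d (CtxS-reflˡ Γ Γ' r) , fundV d' (CtxS-reflʳ Γ Γ' r) , cohV₀ d d' r

  cohV₀ : ∀ {Γ Γ' v A A'} (d : Γ ⊩v v ∶ A) (d' : Γ' ⊩v v ∶ A') {η η'} → CtxS Γ Γ' η η' →
          VS₀ A A' (⟪ d ⟫v η) (⟪ d' ⟫v η')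
  cohV₀ (varS q) (varS q') r = proj₂ (proj₂ (CtxS-lookup q q' r))
  cohV₀ unitS unitS r = tt
  cohV₀ trueS trueS r = refl
  cohV₀ falseS falseS r = refl
  cohV₀ (funS d) (funS d') r a a' s = cohC d d' (s , r)
  cohV₀ {Γ} {Γ'} w@(handlerS {A = A} {Sg} {u} {E} {D} d cl snd)
                 w'@(handlerS {A = A'} {Sg'} {u'} {E'} {D'} d' cl' snd') r t t' =
    lift-het A Sg u E A' Sg' u' E' D D'
      (fundV w (CtxS-reflˡ Γ Γ' r) _ _) (fundV w' (CtxS-reflʳ Γ Γ' r) _ _)
      (λ a a' s → cohC d d' (s , r)) (cohH cl cl' r)

  cohC : ∀ {Γ Γ' c C C'} (d : Γ ⊩c c ∶ C) (d' : Γ' ⊩c c ∶ C') {η η'} → CtxS Γ Γ' η η' →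
         CS C C' (⟪ d ⟫c η) (⟪ d' ⟫c η')
  cohC (ifS v d₁ d₂) (ifS v' d₁' d₂') {η} {η'} r
    with ⟪ v ⟫v η | ⟪ v' ⟫v η' | proj₂ (proj₂ (cohV v v' r))
  ... | true | .true | refl = cohC d₁ d₁' r
  ... | false | .false | refl = cohC d₂ d₂' r
  cohC (appS v w) (appS v' w') r = proj₂ (proj₂ (cohV v v' r)) _ _ (cohV w w' r)
  cohC (retS v) (retS v') r = retH (cohV v v' r)
  cohC {Γ} {Γ'} (opS {Sg = Sg} i refl v d) (opS {Sg = Sg'} i' e v' d') r =
    opH (sym e) (ArS-to Sg Sg' i i' (cohV v v' r))
      (λ b b' s → fundC d (ResR-from Sg i s , CtxS-reflˡ Γ Γ' r))
      (λ b b' s → fundC d' (ResR-from Sg' i' s , CtxS-reflʳ Γ Γ' r))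
      (λ b b' s → cohC d d' (ResS-from Sg Sg' i i' s , r))
  cohC {Γ} {Γ'} (doS {A = A} {B} {Sg} {u} {E} d₁ d₂) (doS {A = A'} {B'} {Sg'} {u'} {E'} d₁' d₂') r =
    lift-het A Sg u E A' Sg' u' E' (comp B Sg u E) (comp B' Sg' u' E')
      (bind-cong A B Sg u E (λ a a' s → fundC d₂ (s , CtxS-reflˡ Γ Γ' r)))
      (bind-cong A' B' Sg' u' E' (λ a a' s → fundC d₂' (s , CtxS-reflʳ Γ Γ' r)))
      (λ a a' s → cohC d₂ d₂' (s , r)) (λ i i' a a' e ra κ κ' → opH e ra) (cohC d₁ d₁' r)
  cohC (withS v d) (withS v' d') r = proj₂ (proj₂ (cohV v v' r)) _ _ (cohC d d' r)

  cohCl : ∀ {Γ Γ' h o o' A A' B B' D D'} (cl : SClause Γ h o A B D) (cl' : SClause Γ' h o' A' B' D') →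
          o ≡ o' → ∀ {η η'} → CtxS Γ Γ' η η' → ∀ {a a'} → VS A A' a a' →
          ∀ {κ κ'} → VS (B ⇾ D) (B' ⇾ D') κ κ' → CS D D' (⟪ cl ⟫cl η a κ) (⟪ cl' ⟫cl η' a' κ')
  cohCl (clauseS c e d) (clauseS c' e' d') refl r ra rκ with just-injective (trans (sym e) e')
  ... | refl = cohC d d' (rκ , ra , r)

  cohH : ∀ {Γ Γ' h Sg Sg' D D'} (cl : SClauses Γ h Sg D) (cl' : SClauses Γ' h Sg' D') →
         ∀ {η η'} → CtxS Γ Γ' η η' → AlgS Sg Sg' D D' (⟪ cl ⟫h η) (⟪ cl' ⟫h η')
  cohH {Sg = Sg} {Sg'} (clausesS cl) (clausesS cl') r i i' a a' e ra κ κ' k k' rκ =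
    cohCl (cl i) (cl' i') e r (ArS-from Sg Sg' i i' ra)
      ((λ b b' s → k _ _ (ResR-to Sg i s)) , (λ b b' s → k' _ _ (ResR-to Sg' i' s)) ,
       (λ b b' s → rκ _ _ (ResS-to Sg Sg' i i' s)))

ArS-reflˡ : ∀ Sg Sg' i i' {a a'} → ArS Sg Sg' i i' a a' → ArR Sg i a a
ArS-reflˡ (_ ∷ Sg) (_ ∷ Sg') fzero fzero (r , _) = r
ArS-reflˡ (x ∷ Sg) (_ ∷ Sg') fzero (fsuc i') r = ArS-reflˡ (x ∷ Sg) Sg' fzero i' r
ArS-reflˡ (_ ∷ Sg) (x ∷ Sg') (fsuc i) fzero r = ArS-reflˡ Sg (x ∷ Sg') i fzero r
ArS-reflˡ (_ ∷ Sg) (_ ∷ Sg') (fsuc i) (fsuc i') r = ArS-reflˡ Sg Sg' i i' r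

ArS-reflʳ : ∀ Sg Sg' i i' {a a'} → ArS Sg Sg' i i' a a' → ArR Sg' i' a' a'
ArS-reflʳ (_ ∷ Sg) (_ ∷ Sg') fzero fzero (_ , r , _) = r
ArS-reflʳ (x ∷ Sg) (_ ∷ Sg') fzero (fsuc i') r = ArS-reflʳ (x ∷ Sg) Sg' fzero i' r
ArS-reflʳ (_ ∷ Sg) (x ∷ Sg') (fsuc i) fzero r = ArS-reflʳ Sg (x ∷ Sg') i fzero r
ArS-reflʳ (_ ∷ Sg) (_ ∷ Sg') (fsuc i) (fsuc i') r = ArS-reflʳ Sg Sg' i i' r

CS-reflˡ : ∀ C C' {t t'} → CS C C' t t' → CR C t t
CS-reflˡ (comp _ _ _ _) (comp _ _ _ _) (retH (r , _)) = retR r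
CS-reflˡ (comp _ Sg _ _) (comp _ Sg' _ _) (opH {i} {i'} _ r k _ _) = opR i (ArS-reflˡ Sg Sg' i i' r) k
CS-reflˡ C@(comp _ _ _ _) (comp _ _ _ _) (conjH l _ _) = CR-reflˡ C l

CS-reflʳ : ∀ C C' {t t'} → CS C C' t t' → CR C' t' t'
CS-reflʳ (comp _ _ _ _) (comp _ _ _ _) (retH (_ , r , _)) = retR r
CS-reflʳ (comp _ Sg _ _) (comp _ Sg' _ _) (opH {i} {i'} _ r _ k _) = opR i' (ArS-reflʳ Sg Sg' i i' r) k
CS-reflʳ (comp _ _ _ _) C'@(comp _ _ _ _) (conjH _ _ l) = CR-reflʳ C' l

coherentV : ∀ {Γ v A} (d d' : Γ ⊩v v ∶ A) {η η'} → CtxR Γ η η' → VR A (⟪ d ⟫v η) (⟪ d' ⟫v η')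
coherentV {Γ} {A = A} d d' r = VS⇒VR A (cohV d d' (CtxR⇒CtxS Γ r))

coherentC : ∀ {Γ c C} (d d' : Γ ⊩c c ∶ C) {η η'} → CtxR Γ η η' → CR C (⟪ d ⟫c η) (⟪ d' ⟫c η')
coherentC {Γ} {C = C} d d' r = CS⇒CR C (cohC d d' (CtxR⇒CtxS Γ r))

-- Templates

record ConvV {Γ v A} (d : Γ ⊢v v ∶ A) : Set where
  constructor _,_
  field
    semV   : Γ ⊩v v ∶ A
    agreeV : ∀ {η η'} → CtxR Γ η η' → VR A (⟦ d ⟧V η) (⟪ semV ⟫v η')

record ConvC {Γ c C} (d : Γ ⊢c c ∶ C) : Set where
  constructor _,_
  field
    semC   : Γ ⊩c c ∶ C
    agreeC : ∀ {η η'} → CtxR Γ η η' → CR C (⟦ d ⟧C η) (⟪ semC ⟫c η')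

data ConvT {Sg zs} : ∀ {Γ T} → TmplTy Sg zs Γ T → Set where
  convZ  : ∀ {Γ n v} {j : Fin (length zs)} {e : toℕ j ≡ n} {d : Γ ⊢v v ∶ lookup zs j} →
           ConvV d → ConvT (tzT j e d)
  convIf : ∀ {Γ v T₁ T₂} {d : Γ ⊢v v ∶ bool} {t₁ : TmplTy Sg zs Γ T₁} {t₂ : TmplTy Sg zs Γ T₂} →
           ConvV d → ConvT t₁ → ConvT t₂ → ConvT (tifT d t₁ t₂)
  convOp : ∀ {Γ o v T} {i : OpIx Sg} {e : nameOf Sg i ≡ o} {d : Γ ⊢v v ∶ argOf Sg i}
           {t : TmplTy Sg zs (resOf Sg i ∷ Γ) T} → ConvV d → ConvT t → ConvT (topT i e d t)

FunsR : ∀ zs D → Rel ((j : Fin (length zs)) → ⟦ lookup zs j ⟧v → ⟦ D ⟧c)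
FunsR zs D fs fs' = ∀ j b b' → VR (lookup zs j) b b' → CR D (fs j b) (fs' j b')

FunsR-reflˡ : ∀ zs D {fs fs'} → FunsR zs D fs fs' → FunsR zs D fs fs
FunsR-reflˡ zs D r j b b' s = CR-trans D (r j b b' s) (CR-sym D (r j b' b' (VR-reflʳ _ s)))

FunsR-reflʳ : ∀ zs D {fs fs'} → FunsR zs D fs fs' → FunsR zs D fs' fs'
FunsR-reflʳ zs D r j b b' s = CR-trans D (CR-sym D (r j b b (VR-reflˡ _ s))) (r j b b' s)

convV-resp : ∀ {Γ v A} {d d' : Γ ⊢v v ∶ A} → ConvV d → ConvV d' → ∀ {η η'} → CtxR Γ η η' →
             VR A (⟦ d ⟧V η) (⟦ d' ⟧V η')
convV-resp {Γ} {A = A} (w , k) (w' , k') r =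
  VR-trans A (k (CtxR-reflˡ Γ r))
    (VR-trans A (coherentV w w' r) (VR-sym A (k' (CtxR-reflʳ Γ r))))

VS-conj : ∀ A A' {a a₁ a₁' a'} → VR A a a₁ → VS A A' a₁ a₁' → VR A' a₁' a' → VS A A' a a'
VS-conj A A' l (_ , _ , r) l' = VR-reflˡ A l , VR-reflʳ A' l' , go A A' l r l'
  where
  go : ∀ A A' {a a₁ a₁' a'} → VR A a a₁ → VS₀ A A' a₁ a₁' → VR A' a₁' a' → VS₀ A A' a a'
  go unit unit l r l' = tt
  go bool bool refl refl refl = refl
  go (A ⇾ C) (A' ⇾ C') l r l' a a' s@(ra , ra' , _) =
    CS-conj C C' (l a a ra) (r a a' s) (l' a' a' ra')
  go (C ⇛ D) (C' ⇛ D') l r l' t t' s =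
    CS-conj D D' (l t t (CS-reflˡ C C' s)) (r t t' s) (l' t' t' (CS-reflʳ C C' s))

convV-het : ∀ {Γ Γ' v A A'} {d : Γ ⊢v v ∶ A} {d' : Γ' ⊢v v ∶ A'} → ConvV d → ConvV d' →
            ∀ {η η'} → CtxS Γ Γ' η η' → VS A A' (⟦ d ⟧V η) (⟦ d' ⟧V η')
convV-het {Γ} {Γ'} {A = A} {A'} (w , k) (w' , k') r =
  VS-conj A A' (k (CtxS-reflˡ Γ Γ' r)) (cohV w w' r) (VR-sym A' (k' (CtxS-reflʳ Γ Γ' r)))

template-resp : ∀ Sg zs D {Γ T} {t : TmplTy Sg zs Γ T} → ConvT t → ∀ {H H' η η' fs fs'} →
  AlgR Sg D H H' → CtxR Γ η η' → FunsR zs D fs fs' → CR D (⟦ t ⟧T H η fs) (⟦ t ⟧T H' η' fs')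
template-resp Sg zs D (convZ v) rH r rf = rf _ _ _ (convV-resp v v r)
template-resp Sg zs D (convIf v t₁ t₂) rH r rf =
  if-cong D (convV-resp v v r) (template-resp Sg zs D t₁ rH r rf) (template-resp Sg zs D t₂ rH r rf)
template-resp Sg zs D (convOp {i = i} v t) rH r rf =
  rH i _ _ (ArR-to Sg i (convV-resp v v r)) _ _
    (λ b b' s → template-resp Sg zs D t rH (ResR-from Sg i s , r) rf)

-- Unlike tree-coherent, this does not presuppose that the names in Sg are distinct:
-- two derivations may resolve the same operation to different declarations.
template-coherent : ∀ Sg zs D {Γ Γ' T} {t : TmplTy Sg zs Γ T} {t' : TmplTy Sg zs Γ' T} →
  ConvT t → ConvT t' → ∀ {H H' η η' fs fs'} → AlgR Sg D H H → AlgR Sg D H' H' → AlgS Sg Sg D D H H' →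
  CtxS Γ Γ' η η' → FunsR zs D fs fs' → CS D D (⟦ t ⟧T H η fs) (⟦ t' ⟧T H' η' fs')
template-coherent Sg zs D (convZ {j = j} {e} v) (convZ {j = j'} {e'} v') rH rH' rS r rf
  with toℕ-injective (trans e (sym e'))
... | refl = CR⇒CS D (rf j _ _ (VS⇒VR (lookup zs j) (convV-het v v' r)))
template-coherent Sg zs D {t = tifT d _ _} {tifT d' _ _} (convIf v t₁ t₂) (convIf v' t₁' t₂')
                  {η = η} {η'} rH rH' rS r rf
  with ⟦ d ⟧V η | ⟦ d' ⟧V η' | proj₂ (proj₂ (convV-het v v' r))
... | true | .true | refl = template-coherent Sg zs D t₁ t₁' rH rH' rS r rf
... | false | .false | refl = template-coherent Sg zs D t₂ t₂' rH rH' rS r rf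
template-coherent Sg zs D {Γ} {Γ'} (convOp {i = i} {refl} v t) (convOp {i = i'} {e'} v' t') rH rH' rS r rf =
  rS i i' _ _ (sym e') (ArS-to Sg Sg i i' (convV-het v v' r)) _ _
    (λ b b' s → template-resp Sg zs D t rH (ResR-from Sg i s , CtxS-reflˡ Γ Γ' r) (FunsR-reflˡ zs D rf))
    (λ b b' s → template-resp Sg zs D t' rH' (ResR-from Sg i' s , CtxS-reflʳ Γ Γ' r) (FunsR-reflʳ zs D rf))
    (λ b b' s → template-coherent Sg zs D t t' rH rH' rS (ResS-from Sg Sg i i' s , r) rf)

-- Distinct names force both derivations to resolve an operation to the same declaration; the values
-- in them agree by conversion and coherence.
tree-coherent : ∀ Sg zs → T (distinct (map proj₁ Sg)) → ∀ {RZ} →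
  (∀ j b b' → VR (lookup zs j) b b' → RZ j b b') →
  ∀ {Γ T} {t t' : TmplTy Sg zs Γ T} → ConvT t → ConvT t' → ∀ {η η'} → CtxR Γ η η' →
  TreeRel (ArR Sg) (ResR Sg) RZ (tree t η) (tree t' η')
tree-coherent Sg zs u z (convZ {j = j} {e} v) (convZ {j = j'} {e'} v') r
  with toℕ-injective (trans e (sym e'))
... | refl = leafR (z j _ _ (convV-resp v v' r))
tree-coherent Sg zs u z {t = tifT d _ _} {tifT d' _ _} (convIf v t₁ t₂) (convIf v' t₁' t₂') {η} {η'} r
  with ⟦ d ⟧V η | ⟦ d' ⟧V η' | convV-resp v v' r
... | true | .true | refl = tree-coherent Sg zs u z t₁ t₁' r
... | false | .false | refl = tree-coherent Sg zs u z t₂ t₂' r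
tree-coherent Sg zs u z (convOp {i = i} {refl} v t) (convOp {i = i'} {e'} v' t') r
  with nameOf-injective Sg u i i' (sym e')
... | refl = nodeR (ArR-to Sg i (convV-resp v v' r))
               (λ b b' s → tree-coherent Sg zs u z t t' (ResR-from Sg i s , r))

-- Meaning of instantiated and handled templates

funAt : ∀ {Γ D} zs {φ} → Sub Γ (map (_⇾ D) zs) φ → (j : Fin (length zs)) →
        Γ ⊩v φ (toℕ j) ∶ lookup zs j ⇾ D
funAt (_ ∷ zs) ((d , _) ∷ s) fzero = d
funAt (_ ∷ zs) (_ ∷ s) (fsuc j) = funAt zs s j

funs : ∀ {Γ D} zs {φ} → Sub Γ (map (_⇾ D) zs) φ → ⟦ Γ ⟧x → (j : Fin (length zs)) → ⟦ lookup zs j ⟧v → ⟦ D ⟧c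
funs zs s η j = ⟪ funAt zs s j ⟫v η

funs-wk : ∀ {Γ D} zs {φ} B (s : Sub Γ (map (_⇾ D) zs) φ) {b η fs} → CtxR (B ∷ Γ) (b , η) (b , η) →
          FunsR zs D (funs zs s η) fs → FunsR zs D (funs zs (wk B s) (b , η)) fs
funs-wk {D = D} zs B s {b} {η} r rf j a a' ra =
  CR-trans D (at zs s j a a (VR-reflˡ _ ra)) (rf j a a' ra)
  where
  at : ∀ zs {φ} (s : Sub _ (map (_⇾ D) zs) φ) j →
       VR (lookup zs j ⇾ D) (funs zs (wk B s) (b , η) j) (funs zs s η j)
  at (_ ∷ zs) ((d , _) ∷ s) fzero = proj₂ (weaken B d) b η r
  at (_ ∷ zs) (_ ∷ s) (fsuc j) = at zs s j

applyV : ∀ {Γ Δ σ v A} (s : Sub Γ Δ σ) {d : Δ ⊢v v ∶ A} → ConvV d →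
  Σ[ d' ∈ Γ ⊩v subV σ v ∶ A ] (∀ {η as} → Related s η as → VR A (⟪ d' ⟫v η) (⟦ d ⟧V as))
applyV {Δ = Δ} {A = A} s (w , k) with substituteV s w
... | w' , k' = w' , λ r → VR-trans A (k' r) (VR-sym A (k (CtxR-reflʳ Δ (proj₂ r))))

-- This brings both sides of the inheritance rule into the form of the generator `eqnR`.
instT : ∀ A Sg u E zs {Γ Δ σ φ T} {t : TmplTy Sg zs Δ T} → ConvT t →
  (s : Sub Γ Δ σ) (f : Sub Γ (map (_⇾ comp A Sg u E) zs) φ) →
  Σ[ d ∈ Γ ⊩c inst σ φ T ∶ comp A Sg u E ]
    (∀ {η as fs} → Related s η as → FunsR zs (comp A Sg u E) (funs zs f η) fs →
     CR (comp A Sg u E) (⟪ d ⟫c η) (⟦ t ⟧T (freeI Sg ⟦ A ⟧v) as fs))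
instT A Sg u E zs (convZ {j = j} {refl} v) s f with applyV s v
... | v' , k = appS (funAt zs f j) v' , λ r rf → rf j _ _ (k r)
instT A Sg u E zs (convIf v t₁ t₂) s f
  with applyV s v | instT A Sg u E zs t₁ s f | instT A Sg u E zs t₂ s f
... | v' , k | d₁ , k₁ | d₂ , k₂ =
  ifS v' d₁ d₂ , λ r rf → if-cong (comp A Sg u E) (k r) (k₁ r rf) (k₂ r rf)
instT A Sg u E zs (convOp {i = i} {e} v t) s f
  with applyV s v | instT A Sg u E zs t (ext (resOf Sg i) s) (wk (resOf Sg i) f)
... | v' , k | d , k' =
  opS i e v' d ,
  λ r rf → op-cong A Sg u E i (k r) (λ b b' rb →
    k' (related-ext (resOf Sg i) s rb r)
       (funs-wk zs (resOf Sg i) f (VR-reflˡ _ rb , proj₁ r) rf))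

-- Leaving the lookup unevaluated in the type fits `hT` directly and the handler rule for operations
-- after one transport. The default `ret unitV` is never reached, since `e` says that the lookup
-- succeeds.
runClause : ∀ {Θ Γ h o A B D γ v w} (cl : SClause Γ h o A B D) →
  (k : Θ ⊩v w ∶ B ⇾ D) (a : Θ ⊩v v ∶ A) (g : Sub Θ Γ γ) →
  Σ[ d ∈ Θ ⊩c maybe′ (subC (w • v • γ)) (ret unitV) (lookupCl h o) ∶ D ]
    (∀ {θ η a' κ} → Related g θ η → VR A (⟪ a ⟫v θ) a' → VR (B ⇾ D) (⟪ k ⟫v θ) κ →
     CR D (⟪ d ⟫c θ) (⟪ cl ⟫cl η a' κ))
runClause {Θ} {Γ} {A = A} {B} {D} {γ} {v} {w} (clauseS c e d) k a g
  with substituteC ((k , tt) ∷ (a , tt) ∷ g) d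
... | d' , agree =
  subst (λ m → Σ[ d₁ ∈ Θ ⊩c maybe′ (subC (w • v • γ)) (ret unitV) m ∶ D ]
                 (∀ {θ η a' κ} → Related g θ η → VR A (⟪ a ⟫v θ) a' → VR (B ⇾ D) (⟪ k ⟫v θ) κ →
                  CR D (⟪ d₁ ⟫c θ) (⟪ d ⟫c (κ , a' , η))))
    (sym e) (d' , λ rg ra rκ → agree (proj₁ rg , rκ , ra , proj₂ rg))

handleT : ∀ Sg D zs {Θ Γ Δ h σ φ γ T} (cl : SClauses Γ h Sg D) {t : TmplTy Sg zs Δ T} → ConvT t →
  (s : Sub Θ Δ σ) (f : Sub Θ (map (_⇾ D) zs) φ) (g : Sub Θ Γ γ) →
  Σ[ d ∈ Θ ⊩c hT h σ φ γ T ∶ D ]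
    (∀ {θ as fs η} → Related s θ as → FunsR zs D (funs zs f θ) fs → Related g θ η →
     CR D (⟪ d ⟫c θ) (⟦ t ⟧T (⟪ cl ⟫h η) as fs))
handleT Sg D zs cl (convZ {j = j} {refl} v) s f g with applyV s v
... | v' , k = appS (funAt zs f j) v' , λ r rf rg → rf j _ _ (k r)
handleT Sg D zs cl (convIf v t₁ t₂) s f g
  with applyV s v | handleT Sg D zs cl t₁ s f g | handleT Sg D zs cl t₂ s f g
... | v' , k | d₁ , k₁ | d₂ , k₂ =
  ifS v' d₁ d₂ , λ r rf rg → if-cong D (k r) (k₁ r rf rg) (k₂ r rf rg)
handleT Sg D zs (clausesS cl) (convOp {i = i} {refl} v t) s f g
  with applyV s v
     | handleT Sg D zs (clausesS cl) t (ext (resOf Sg i) s) (wk (resOf Sg i) f) (wk (resOf Sg i) g)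
... | v' , k | d , k' with runClause (cl i) (funS d) v' g
... | d' , agree =
  d' ,
  λ {θ} r rf rg → agree rg
    -- The template encodes the argument into `⟦ Sg ⟧ar i` and the clause decodes it again.
    (subst (VR (argOf Sg i) (⟪ v' ⟫v θ)) (sym (fromAr-toAr Sg i _)) (k r))
    (λ b b' rb → let self = VR-reflˡ _ rb , proj₁ r in
      k' (related-ext (resOf Sg i) s (subst (VR (resOf Sg i) b) (sym (fromRes-toRes Sg i b')) rb) r)
         (funs-wk zs (resOf Sg i) f self rf)
         (self , CtxR-trans _ (wk-env (resOf Sg i) g self) (proj₂ rg)))

-- The context (f_j)_j, (x_i)_i, Γ of hInst

_++ᵉ_ : ∀ {xs Γ} → ⟦ xs ⟧x → ⟦ Γ ⟧x → ⟦ xs ++ Γ ⟧x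
_++ᵉ_ {[]} as η = η
_++ᵉ_ {A ∷ xs} (a , as) η = a , _++ᵉ_ {xs} as η

++ᵉ-resp : ∀ xs Γ {as as' η η'} → CtxR xs as as' → CtxR Γ η η' →
           CtxR (xs ++ Γ) (_++ᵉ_ {xs} as η) (_++ᵉ_ {xs} as' η')
++ᵉ-resp [] Γ r s = s
++ᵉ-resp (A ∷ xs) Γ (r , rs) s = r , ++ᵉ-resp xs Γ rs s

prefix : ∀ {xs Γ n A} → xs ∋ n ∶ A → (xs ++ Γ) ∋ n ∶ A
prefix here = here
prefix (there q) = there (prefix q)

prefix-resp : ∀ {xs Γ n A} {as as' : ⟦ xs ⟧x} {η : ⟦ Γ ⟧x} (q : xs ∋ n ∶ A) → CtxR xs as as' →
              VR A (lookupEnv (prefix q) (_++ᵉ_ {xs} as η)) (lookupEnv q as')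
prefix-resp here (r , _) = r
prefix-resp (there q) (_ , rs) = prefix-resp q rs

shift : ∀ xs {Γ n A} → Γ ∋ n ∶ A → (xs ++ Γ) ∋ length xs + n ∶ A
shift [] q = q
shift (_ ∷ xs) q = there (shift xs q)

shift-lookup : ∀ xs {Γ n A} {as : ⟦ xs ⟧x} {η : ⟦ Γ ⟧x} (q : Γ ∋ n ∶ A) →
               lookupEnv (shift xs q) (_++ᵉ_ {xs} as η) ≡ lookupEnv q η
shift-lookup [] q = refl
shift-lookup (_ ∷ xs) q = shift-lookup xs q

module _ (D : CTy) where

  Funs : List VTy → Ctx
  Funs zs = map (_⇾ D) zs

  funEnv : ∀ zs → ((j : Fin (length zs)) → ⟦ lookup zs j ⟧v → ⟦ D ⟧c) → ⟦ Funs zs ⟧x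
  funEnv [] fs = tt
  funEnv (_ ∷ zs) fs = fs fzero , funEnv zs (λ j → fs (fsuc j))

  funEnv-resp : ∀ zs {fs fs'} → FunsR zs D fs fs' → CtxR (Funs zs) (funEnv zs fs) (funEnv zs fs')
  funEnv-resp [] r = tt
  funEnv-resp (_ ∷ zs) r = r fzero , funEnv-resp zs (λ j → r (fsuc j))

  funs-var : ∀ zs {Θ ρ θ fs} (r : Renaming Θ (Funs zs) ρ) → RenamedEnv {Θ} {Funs zs} {ρ} r θ (funEnv zs fs) →
             FunsR zs D (funs zs (var-sub (Funs zs) {ρ} r) θ) fs
  funs-var (_ ∷ zs) r k fzero = k here
  funs-var (_ ∷ zs) {ρ = ρ} r k (fsuc j) =
    funs-var zs {ρ = λ n → ρ (suc n)} (λ q → r (there q)) (λ q → k (there q)) j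

  -- Not an instance of shift: length (map f zs) and length zs differ definitionally,
  -- and hInst associates the sum of the two lengths to the left.
  shift-funs : ∀ zs {Γ n A} → Γ ∋ n ∶ A → (Funs zs ++ Γ) ∋ length zs + n ∶ A
  shift-funs [] q = q
  shift-funs (_ ∷ zs) q = there (shift-funs zs q)

  shift-funs-lookup : ∀ zs {Γ n A} {fs : ⟦ Funs zs ⟧x} {η : ⟦ Γ ⟧x} (q : Γ ∋ n ∶ A) →
    lookupEnv (shift-funs zs q) (_++ᵉ_ {Funs zs} fs η) ≡ lookupEnv q η
  shift-funs-lookup [] q = refl
  shift-funs-lookup (_ ∷ zs) q = shift-funs-lookup zs q

  shift-both : ∀ zs xs {Γ n A} → Γ ∋ n ∶ A → (Funs zs ++ xs ++ Γ) ∋ length zs + length xs + n ∶ A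
  shift-both [] xs q = shift xs q
  shift-both (_ ∷ zs) xs q = there (shift-both zs xs q)

  shift-both-lookup : ∀ zs xs {Γ n A} {fs : ⟦ Funs zs ⟧x} {as : ⟦ xs ⟧x} {η : ⟦ Γ ⟧x} (q : Γ ∋ n ∶ A) →
    lookupEnv (shift-both zs xs q) (_++ᵉ_ {Funs zs} fs (_++ᵉ_ {xs} as η)) ≡ lookupEnv q η
  shift-both-lookup [] xs q = shift-lookup xs q
  shift-both-lookup (_ ∷ zs) xs q = shift-both-lookup zs xs q

  module _ (zs xs : List VTy) {Γ : Ctx} where

    hInst-env : ((j : Fin (length zs)) → ⟦ lookup zs j ⟧v → ⟦ D ⟧c) → ⟦ xs ⟧x → ⟦ Γ ⟧x →
                ⟦ Funs zs ++ xs ++ Γ ⟧x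
    hInst-env fs as η = _++ᵉ_ {Funs zs} (funEnv zs fs) (_++ᵉ_ {xs} as η)

    hInst-env-resp : ∀ {fs fs' as as' η η'} → FunsR zs D fs fs' → CtxR xs as as' → CtxR Γ η η' →
      CtxR (Funs zs ++ xs ++ Γ) (hInst-env fs as η) (hInst-env fs' as' η')
    hInst-env-resp rf ra r =
      ++ᵉ-resp (Funs zs) (xs ++ Γ) (funEnv-resp zs rf) (++ᵉ-resp xs Γ ra r)

    handleInst : ∀ {Sg h T} (cl : SClauses Γ h Sg D) {t : TmplTy Sg zs xs T} → ConvT t →
      Σ[ d ∈ (Funs zs ++ xs ++ Γ) ⊩c hInst h xs zs T ∶ D ]
        (∀ {fs as η} → FunsR zs D fs fs → CtxR xs as as → CtxR Γ η η →
         CR D (⟪ d ⟫c (hInst-env fs as η)) (⟦ t ⟧T (⟪ cl ⟫h η) as fs))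
    handleInst {Sg} cl t
      with handleT Sg D zs cl t
             (var-sub xs {length zs +_} (λ q → shift-funs zs (prefix q)))
             (var-sub (Funs zs) {λ n → n} prefix)
             (var-sub Γ {λ n → length zs + length xs + n} (shift-both zs xs))
    ... | d , k =
      d , λ {fs} {as} {η} rf ra r → let self = hInst-env-resp rf ra r in
        k (self , var-sub-env xs {length zs +_} (λ q → shift-funs zs (prefix q)) (λ {_} {A} q →
             subst (λ x → VR A x (lookupEnv q as)) (sym (shift-funs-lookup zs (prefix q)))
               (prefix-resp q ra)))
          (funs-var zs {ρ = λ n → n} prefix (λ q → prefix-resp q (funEnv-resp zs rf)))
          (self , var-sub-env Γ {λ n → length zs + length xs + n} (shift-both zs xs) (λ {_} {A} q →
             subst (λ x → VR A x (lookupEnv q η)) (sym (shift-both-lookup zs xs q)) (CtxR-lookup q r)))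

-- Semantic equations

-- A derived equation does not determine typings of its sides, and the premises of transitivity may
-- type the middle term differently. Some pair of semantic typings suffices, because coherence
-- exchanges it for any other.
EquivV : Ctx → Val → Val → VTy → Set
EquivV Γ v v' A = Σ[ d ∈ Γ ⊩v v ∶ A ] Σ[ d' ∈ Γ ⊩v v' ∶ A ]
  (∀ {η η'} → CtxR Γ η η' → VR A (⟪ d ⟫v η) (⟪ d' ⟫v η'))

EquivC : Ctx → Comp → Comp → CTy → Set
EquivC Γ c c' C = Σ[ d ∈ Γ ⊩c c ∶ C ] Σ[ d' ∈ Γ ⊩c c' ∶ C ]
  (∀ {η η'} → CtxR Γ η η' → CR C (⟪ d ⟫c η) (⟪ d' ⟫c η'))

equivV-refl : ∀ {Γ v A} → Γ ⊩v v ∶ A → EquivV Γ v v A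
equivV-refl d = d , d , fundV d

equivC-refl : ∀ {Γ c C} → Γ ⊩c c ∶ C → EquivC Γ c c C
equivC-refl d = d , d , fundC d

equivV-sym : ∀ {Γ v v' A} → EquivV Γ v v' A → EquivV Γ v' v A
equivV-sym {Γ} {A = A} (d , d' , k) = d' , d , λ r → VR-sym A (k (CtxR-sym Γ r))

equivC-sym : ∀ {Γ c c' C} → EquivC Γ c c' C → EquivC Γ c' c C
equivC-sym {Γ} {C = C} (d , d' , k) = d' , d , λ r → CR-sym C (k (CtxR-sym Γ r))

equivV-trans : ∀ {Γ v v' v'' A} → EquivV Γ v v' A → EquivV Γ v' v'' A → EquivV Γ v v'' A
equivV-trans {Γ} {A = A} (d , d₁ , k) (d₂ , d' , k') = d , d' , λ r →
  VR-trans A (k (CtxR-reflˡ Γ r)) (VR-trans A (coherentV d₁ d₂ r) (k' (CtxR-reflʳ Γ r)))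

equivC-trans : ∀ {Γ c c' c'' C} → EquivC Γ c c' C → EquivC Γ c' c'' C → EquivC Γ c c'' C
equivC-trans {Γ} {C = C} (d , d₁ , k) (d₂ , d' , k') = d , d' , λ r →
  CR-trans C (k (CtxR-reflˡ Γ r)) (CR-trans C (coherentC d₁ d₂ r) (k' (CtxR-reflʳ Γ r)))

equivV-subst : ∀ {Γ w A v v' B} → Γ ⊩v w ∶ A → EquivV (A ∷ Γ) v v' B → EquivV Γ (v [ w ]V) (v' [ w ]V) B
equivV-subst {Γ} {B = B} w (d , d' , k) with instV d w | instV d' w
... | e , l | e' , l' = e , e' , λ r →
  VR-trans B (l (CtxR-reflˡ Γ r))
    (VR-trans B (k (fundV w r , r)) (VR-sym B (l' (CtxR-reflʳ Γ r))))

equivC-subst : ∀ {Γ w A c c' C} → Γ ⊩v w ∶ A → EquivC (A ∷ Γ) c c' C → EquivC Γ (c [ w ]C) (c' [ w ]C) C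
equivC-subst {Γ} {C = C} w (d , d' , k) with instC d w | instC d' w
... | e , l | e' , l' = e , e' , λ r →
  CR-trans C (l (CtxR-reflˡ Γ r))
    (CR-trans C (k (fundV w r , r)) (CR-sym C (l' (CtxR-reflʳ Γ r))))

equiv-funη : ∀ {Γ v A C} → Γ ⊩v v ∶ A ⇾ C → EquivV Γ (fun (app (renV suc v) (var zero))) v (A ⇾ C)
equiv-funη {Γ} {A = A} {C} d with weaken A d
... | d' , k = funS (appS d' (varS here)) , d , λ {η} r a a' s →
  CR-trans C (k a η (VR-reflˡ A s , CtxR-reflˡ Γ r) a a (VR-reflˡ A s)) (fundV d r a a' s)

equiv-funβ : ∀ {Γ c v A C} → (A ∷ Γ) ⊩c c ∶ C → Γ ⊩v v ∶ A → EquivC Γ (app (fun c) v) (c [ v ]C) C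
equiv-funβ {Γ} {C = C} d v with instC d v
... | d' , k = appS (funS d) v , d' , λ r → CR-sym C (k (CtxR-sym Γ r))

equiv-doRet : ∀ {Γ v c A B Sg u E} → Γ ⊩v v ∶ A → (A ∷ Γ) ⊩c c ∶ comp B Sg u E →
              EquivC Γ (doC (ret v) c) (c [ v ]C) (comp B Sg u E)
equiv-doRet {Γ} v d with instC d v
... | d' , k = doS (retS v) d , d' , λ r → symR (k (CtxR-sym Γ r))

weaken-body : ∀ {Γ c A C} B (d : (A ∷ Γ) ⊩c c ∶ C) →
  Σ[ d' ∈ (A ∷ B ∷ Γ) ⊩c renC (extR suc) c ∶ C ]
    (∀ {a a' b η η'} → VR A a a' → VR B b b → CtxR Γ η η' → CR C (⟪ d ⟫c (a , η)) (⟪ d' ⟫c (a' , b , η')))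
weaken-body {Γ} {A = A} {C} B d with renameC (extR suc) under d
  where
  under : Renaming (A ∷ B ∷ Γ) (A ∷ Γ) (extR suc)
  under here = here
  under (there q) = there (there q)
... | d' , k = d' , λ ra rb r →
  CR-sym C (k (VR-reflʳ A ra , rb , CtxR-reflʳ Γ r)
    (λ { here → VR-sym A ra ; (there q) → VR-sym _ (CtxR-lookup q r) }))

equiv-doOp : ∀ {Γ v c₁ c₂ A B Sg u E} (i : OpIx Sg) → Γ ⊩v v ∶ argOf Sg i →
  (resOf Sg i ∷ Γ) ⊩c c₁ ∶ comp A Sg u E → (A ∷ Γ) ⊩c c₂ ∶ comp B Sg u E →
  EquivC Γ (doC (opC (nameOf Sg i) v c₁) c₂) (opC (nameOf Sg i) v (doC c₁ (renC (extR suc) c₂)))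
         (comp B Sg u E)
equiv-doOp {A = A} {B} {Sg} {u} {E} i v d₁ d₂ with weaken-body (resOf Sg i) d₂
... | d₂' , k = doS (opS i refl v d₁) d₂ , opS i refl v (doS d₁ d₂') , λ r →
  op-cong B Sg u E i (fundV v r) (λ b b' s →
    bind-cong A B Sg u E (λ a a' ra → k ra (VR-reflʳ _ s) r) (fundC d₁ (s , r)))

equiv-doAssoc : ∀ {Γ c₁ c₂ c₃ A B B' Sg u E} → Γ ⊩c c₁ ∶ comp A Sg u E →
  (A ∷ Γ) ⊩c c₂ ∶ comp B Sg u E → (B ∷ Γ) ⊩c c₃ ∶ comp B' Sg u E →
  EquivC Γ (doC (doC c₁ c₂) c₃) (doC c₁ (doC c₂ (renC (extR suc) c₃))) (comp B' Sg u E)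
equiv-doAssoc {A = A} {B} {B'} {Sg} {u} {E} d₁ d₂ d₃ with weaken-body A d₃
... | d₃' , k = doS (doS d₁ d₂) d₃ , doS d₁ (doS d₂ d₃') , λ r →
  bind-assoc A B B' Sg u E (λ a a' ra →
      bind-cong B B' Sg u E (λ b b' rb → k rb (VR-reflʳ A ra) r) (fundC d₂ (ra , r)))
    (fundC d₁ r)

equiv-withRet : ∀ {Γ cr h v A Sg u E D} → Γ ⊩v handler cr h ∶ comp A Sg u E ⇛ D → Γ ⊩v v ∶ A →
                EquivC Γ (withC (handler cr h) (ret v)) (cr [ v ]C) D
equiv-withRet {Γ} {D = D} w@(handlerS d _ _) v with instC d v
... | d' , k = withS w (retS v) , d' , λ r → CR-sym D (k (CtxR-sym Γ r))

equiv-withOp : ∀ {Γ cr h o v c cop C D} → Γ ⊩v handler cr h ∶ C ⇛ D → Γ ⊩c opC o v c ∶ C →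
  lookupCl h o ≡ just cop →
  EquivC Γ (withC (handler cr h) (opC o v c))
           (subC (fun (withC (renV suc (handler cr h)) c) • v • var) cop) D
equiv-withOp {Γ} {cr} {h} {o} {v} {c} {D = D} w@(handlerS {Sg = Sg} d (clausesS cl) snd) (opS i refl v' c') e
  with weaken (resOf Sg i) w
... | w' , k with runClause (cl i) (funS (withS w' c')) v' (id-sub Γ)
... | d' , agree =
  subst (λ m → EquivC Γ (withC (handler cr h) (opC o v c))
                 (maybe′ (subC (fun (withC (renV suc (handler cr h)) c) • v • var)) (ret unitV) m) D) e
    (withS w (opS i refl v' c') , d' , λ {η} {η'} r → CR-sym D (agree
      (CtxR-reflʳ Γ r , id-sub-env Γ (CtxR-sym Γ r))
      (subst (VR (argOf Sg i) (⟪ v' ⟫v η')) (sym (fromAr-toAr Sg i _)) (VR-sym _ (fundV v' r)))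
      (λ b b' rb → let rb' = subst (VR (resOf Sg i) b) (sym (fromRes-toRes Sg i b')) rb in
        CR-trans D
          (k b η' (VR-reflˡ _ rb , CtxR-reflʳ Γ r) _ _ (fundC c' (VR-reflˡ _ rb , CtxR-reflʳ Γ r)))
          (fundV w (CtxR-sym Γ r) _ _ (fundC c' (rb' , CtxR-sym Γ r))))))

equiv-boolη : ∀ {Γ c v C} → (bool ∷ Γ) ⊩c c ∶ C → Γ ⊩v v ∶ bool →
              EquivC Γ (c [ v ]C) (ifC v (c [ trueV ]C) (c [ falseV ]C)) C
equiv-boolη {Γ} {C = C} d v with instC d v | instC d trueS | instC d falseS
... | d' , k | d₁ , k₁ | d₂ , k₂ = d' , ifS v d₁ d₂ , λ {η} {η'} r →
  CR-trans C (k r) (by-cases (⟪ v ⟫v η') (k₁ (CtxR-reflʳ Γ r)) (k₂ (CtxR-reflʳ Γ r)))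
  where
  by-cases : ∀ b {η t s} → CR C t (⟪ d ⟫c (true , η)) → CR C s (⟪ d ⟫c (false , η)) →
             CR C (⟪ d ⟫c (b , η)) (if b then t else s)
  by-cases true r _ = CR-sym C r
  by-cases false _ r = CR-sym C r

clause-equiv : ∀ {Γ h h' o A B D c c'} (cl : SClause Γ h o A B D) (cl' : SClause Γ h' o A B D) →
  lookupCl h o ≡ just c → lookupCl h' o ≡ just c' → EquivC ((B ⇾ D) ∷ A ∷ Γ) c c' D →
  ∀ {η η'} → CtxR Γ η η' → ClauseR A B D (⟪ cl ⟫cl η) (⟪ cl' ⟫cl η')
clause-equiv {Γ} {A = A} {B} {D} (clauseS _ e₁ d₁) (clauseS _ e₂ d₂) e e' (d , d' , k) r a a' ra κ κ' rκ
  with just-injective (trans (sym e₁) e) | just-injective (trans (sym e₂) e')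
... | refl | refl with CtxR-reflˡ ((B ⇾ D) ∷ A ∷ Γ) (rκ , ra , r) | CtxR-reflʳ ((B ⇾ D) ∷ A ∷ Γ) (rκ , ra , r)
... | rˡ | rʳ = CR-trans D (coherentC d₁ d rˡ) (CR-trans D (k (rκ , ra , r)) (coherentC d' d₂ rʳ))

-- Conversion of derivations

clauses-equiv : ∀ {Γ h h' Sg D} (cl : SClauses Γ h Sg D) (cl' : SClauses Γ h' Sg D) →
  (∀ i → Σ[ c ∈ Comp ] Σ[ c' ∈ Comp ] lookupCl h (nameOf Sg i) ≡ just c × lookupCl h' (nameOf Sg i) ≡ just c' ×
         EquivC ((resOf Sg i ⇾ D) ∷ argOf Sg i ∷ Γ) c c' D) →
  ∀ {η η'} → CtxR Γ η η' → AlgR Sg D (⟪ cl ⟫h η) (⟪ cl' ⟫h η')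
clauses-equiv {Sg = Sg} {D} (clausesS cl) (clausesS cl') es r = clauses-alg Sg D (λ i →
  let _ , _ , e , e' , k = es i in clause-equiv (cl i) (cl' i) e e' k r)

-- `lhs` and `rhs` come from the handler's own proof of the equation; their sizes are what
-- `stable-compare` weighs against an arbitrary stable derivation.
record ConvEqn (n : ℕ) {Γ h} Sg D (cl : SClauses Γ h Sg D) (q : Eqn) : Set where
  field
    lhs   : TmplTy Sg (eqZs q) (eqXs q) (eqL q)
    rhs   : TmplTy Sg (eqZs q) (eqXs q) (eqR q)
    sizeˡ : sizeT lhs ≤ n
    sizeʳ : sizeT rhs ≤ n
    convˡ : ConvT lhs
    convʳ : ConvT rhs
    holds : ∀ {η η' as as' fs fs'} → CtxR Γ η η' → CtxR (eqXs q) as as' → FunsR (eqZs q) D fs fs' →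
            CR D (⟦ lhs ⟧T (⟪ cl ⟫h η) as fs) (⟦ rhs ⟧T (⟪ cl ⟫h η') as' fs')

record Conv⊨ (n : ℕ) {Γ h E Sg D} (p : Γ ⊢ h ⊨ E ∶ Sg ⇉ D) : Set where
  constructor conv⊨
  field
    clauses : SClauses Γ h Sg D
    agree   : ∀ {η η'} → CtxR Γ η η' → AlgR Sg D (⟦ p ⟧⊨ η) (⟪ clauses ⟫h η')
    eqns    : ∀ {q} → q ∈ E → ConvEqn n Sg D clauses q

ConvBelow : ℕ → Set
ConvBelow n = ∀ {Sg zs Γ T} (t : TmplTy Sg zs Γ T) → sizeT t ≤ n → ConvT t

-- Whatever `Stable` compares with `t` is no larger than `t`, hence converts as well.
stable : ∀ {n Sg E e T₀} → ConvBelow n → T (distinct (map proj₁ Sg)) →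
  (t : TmplTy Sg (eqZs (lookup E e)) (eqXs (lookup E e)) T₀) → sizeT t ≤ n →
  Stable (ArR Sg) (ResR Sg) (EXR E e) (EZR E e) t
stable {Sg = Sg} {E} {e} conv u t le t' le' as as' r =
  tree-coherent Sg _ u (λ j b b' → EZR-to E e j) (conv t le) (conv t' (≤-trans le' le)) (EXR-from E e r)

-- If `t` is the smaller one, stability of `t'` applies; otherwise `t'` is below the bound too and
-- both convert. A `t'` beyond the bound always falls into the first case.
stable-compare : ∀ {n Sg E e T₀} → ConvBelow n → T (distinct (map proj₁ Sg)) →
  (t : TmplTy Sg (eqZs (lookup E e)) (eqXs (lookup E e)) T₀) → sizeT t ≤ n →
  (t' : TmplTy Sg (eqZs (lookup E e)) (eqXs (lookup E e)) T₀) →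
  Stable (ArR Sg) (ResR Sg) (EXR E e) (EZR E e) t' → ∀ as as' → EXR E e as as' →
  TreeRel (ArR Sg) (ResR Sg) (EZR E e) (tree t' as) (tree t as')
stable-compare {Sg = Sg} {E} {e} conv u t le t' st as as' r with ≤-total (sizeT t) (sizeT t')
... | inj₁ le' = st t le' as as' r
... | inj₂ le' =
  tree-coherent Sg _ u (λ j b b' → EZR-to E e j) (conv t' (≤-trans le' le)) (conv t le) (EXR-from E e r)

conv-sound : ∀ {n Γ h E Sg D} {p : Γ ⊢ h ⊨ E ∶ Sg ⇉ D} → T (distinct (map proj₁ Sg)) → ConvBelow n →
  (c : Conv⊨ n p) → ∀ η η' → CtxR Γ η η' →
  EqnSound Sg E D (⟪ Conv⊨.clauses c ⟫h η) (⟪ Conv⊨.clauses c ⟫h η')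
conv-sound {Γ = Γ} {E = E} {Sg} {D} u conv (conv⊨ cl _ eqns) η η' r
           e ((m₁ , m₂) , st₁ , st₂) as as' ra fs fs' rf =
  CR-trans D
    (tree-interp (CR D) (fundH cl (CtxR-reflˡ Γ r)) (λ j b b' s → FunsR-reflˡ (eqZs (lookup E e)) D rf' j b b' (EZR-from E e j s))
      m₁ lhs (stable-compare {E = E} {e} conv u lhs sizeˡ m₁ st₁ as as (EXR-reflˡ E e ra)))
    (CR-trans D (holds r (EXR-from E e ra) rf')
      (CR-sym D
        (tree-interp (CR D) (fundH cl (CtxR-reflʳ Γ r)) (λ j b b' s → FunsR-reflʳ (eqZs (lookup E e)) D rf' j b b' (EZR-from E e j s))
          m₂ rhs (stable-compare {E = E} {e} conv u rhs sizeʳ m₂ st₂ as' as' (EXR-reflʳ E e ra)))))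
  where
  open ConvEqn (eqns (∈-lookup {xs = E} e))
  rf' : FunsR (eqZs (lookup E e)) D fs fs'
  rf' j b b' s = rf j b b' (EZR-to E e j s)

eqn-holds : ∀ A Sg u E {n q} → ConvBelow n → q ∈ E →
  (t₁ : TmplTy Sg (eqZs q) (eqXs q) (eqL q)) (t₂ : TmplTy Sg (eqZs q) (eqXs q) (eqR q)) →
  sizeT t₁ ≤ n → sizeT t₂ ≤ n → ∀ {as as' fs fs'} → CtxR (eqXs q) as as' →
  FunsR (eqZs q) (comp A Sg u E) fs fs' →
  CR (comp A Sg u E) (⟦ t₁ ⟧T (freeI Sg ⟦ A ⟧v) as fs) (⟦ t₂ ⟧T (freeI Sg ⟦ A ⟧v) as' fs')
eqn-holds A Sg u E conv mem t₁ t₂ le₁ le₂ ra rf with index mem | lookup-index mem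
... | e | refl =
  eqnR e ((t₁ , t₂) , stable {E = E} {e} conv u t₁ le₁ , stable {E = E} {e} conv u t₂ le₂)
    (EXR-to E e ra) (λ j b b' s → rf j b b' (EZR-from E e j s))

≤ˡ : ∀ n {m o} → m ⊔ n ≤ o → m ≤ o
≤ˡ n {m} = ≤-trans (m≤m⊔n m n)

≤ʳ : ∀ m {n o} → m ⊔ n ≤ o → n ≤ o
≤ʳ m {n} = ≤-trans (m≤n⊔m m n)

weaken-eqn : ∀ {n Γ h Sg D} {cl : SClauses Γ h Sg D} {q} → ConvEqn n Sg D cl q → ConvEqn (suc n) Sg D cl q
weaken-eqn {n} c = record
  { lhs = lhs ; rhs = rhs ; sizeˡ = ≤-trans sizeˡ (n≤1+n n) ; sizeʳ = ≤-trans sizeʳ (n≤1+n n)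
  ; convˡ = convˡ ; convʳ = convʳ ; holds = holds }
  where open ConvEqn c

-- `handleInst` identifies each handled template with the template interpreted by the clauses;
-- coherence joins its typings to those that come with the equation.
eqn-from-equiv : ∀ {n Γ h Sg D xs zs T₁ T₂} (cl : SClauses Γ h Sg D) →
  (t₁ : TmplTy Sg zs xs T₁) (t₂ : TmplTy Sg zs xs T₂) → sizeT t₁ ≤ n → sizeT t₂ ≤ n → ConvT t₁ → ConvT t₂ →
  EquivC (map (_⇾ D) zs ++ xs ++ Γ) (hInst h xs zs T₁) (hInst h xs zs T₂) D →
  ConvEqn n Sg D cl (eqn xs zs T₁ T₂)
eqn-from-equiv {Γ = Γ} {D = D} {xs} {zs} cl t₁ t₂ le₁ le₂ c₁ c₂ (d , d' , k)
  with handleInst D zs xs cl c₁ | handleInst D zs xs cl c₂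
... | d₁ , k₁ | d₂ , k₂ = record
  { lhs = t₁ ; rhs = t₂ ; sizeˡ = le₁ ; sizeʳ = le₂ ; convˡ = c₁ ; convʳ = c₂
  ; holds = λ r ra rf →
      let Θ = map (_⇾ D) zs ++ xs ++ Γ
          rθ = hInst-env-resp D zs xs rf ra r
      in CR-trans D (CR-sym D (k₁ (FunsR-reflˡ zs D rf) (CtxR-reflˡ xs ra) (CtxR-reflˡ Γ r)))
        (CR-trans D (coherentC d₁ d (CtxR-reflˡ Θ rθ))
        (CR-trans D (k rθ)
        (CR-trans D (coherentC d' d₂ (CtxR-reflʳ Θ rθ))
          (k₂ (FunsR-reflʳ zs D rf) (CtxR-reflʳ xs ra) (CtxR-reflʳ Γ r))))) }

equiv-inherit : ∀ {n Γ A Sg u E xs zs T₁ T₂ σ φ} → ConvBelow n → eqn xs zs T₁ T₂ ∈ E →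
  (t₁ : TmplTy Sg zs xs T₁) (t₂ : TmplTy Sg zs xs T₂) → sizeT t₁ ≤ n → sizeT t₂ ≤ n →
  Sub Γ xs σ → Sub Γ (map (_⇾ comp A Sg u E) zs) φ →
  EquivC Γ (inst σ φ T₁) (inst σ φ T₂) (comp A Sg u E)
equiv-inherit {Γ = Γ} {A} {Sg} {u} {E} {zs = zs} conv mem t₁ t₂ le₁ le₂ s f
  with instT A Sg u E zs (conv t₁ le₁) s f | instT A Sg u E zs (conv t₂ le₂) s f
... | d₁ , k₁ | d₂ , k₂ = d₁ , d₂ , λ r →
  transR (k₁ (related-self s (CtxR-reflˡ Γ r)) (λ j b b' → fundV (funAt zs f j) (CtxR-reflˡ Γ r) b b'))
    (transR (eqn-holds A Sg u E conv mem t₁ t₂ le₁ le₂ (env-resp s r)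
              (λ j b b' → fundV (funAt zs f j) r b b'))
      (symR (k₂ (related-self s (CtxR-reflʳ Γ r)) (λ j b b' → fundV (funAt zs f j) (CtxR-reflʳ Γ r) b b'))))

equiv-handler : ∀ {n Γ A Sg u E D cr cr' h h'} {p : Γ ⊢ h ⊨ E ∶ Sg ⇉ D} {p' : Γ ⊢ h' ⊨ E ∶ Sg ⇉ D} →
  ConvBelow n → Conv⊨ n p → Conv⊨ n p' → EquivC (A ∷ Γ) cr cr' D →
  (∀ i → Σ[ c ∈ Comp ] Σ[ c' ∈ Comp ] lookupCl h (nameOf Sg i) ≡ just c × lookupCl h' (nameOf Sg i) ≡ just c' ×
         EquivC ((resOf Sg i ⇾ D) ∷ argOf Sg i ∷ Γ) c c' D) →
  EquivV Γ (handler cr h) (handler cr' h') (comp A Sg u E ⇛ D)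
equiv-handler {Γ = Γ} {A} {Sg} {u} {E} {D} conv c@(conv⊨ cl _ _) c'@(conv⊨ cl' _ _) (d , d' , k) es =
  handlerS d cl (conv-sound u conv c) , handlerS d' cl' (conv-sound u conv c') , λ r t t' →
  lift-cong A Sg u E D (λ a a' ra → k (ra , r)) (clauses-equiv cl cl' es r)
    (conv-sound u conv c _ _ (CtxR-reflˡ Γ r))

-- Simultaneous induction on the size of derivations

mutual
  -- The handler case consults `convT n` about all templates of size at most `n`, not only those
  -- inside `d`; recursion on the bound makes this legitimate.
  convV : ∀ n {Γ v A} (d : Γ ⊢v v ∶ A) → sizeV d ≤ n → ConvV d
  convV (suc n) (varT q) le = varS q , CtxR-lookup q
  convV (suc n) unitT le = unitS , λ _ → refl
  convV (suc n) trueT le = trueS , λ _ → refl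
  convV (suc n) falseT le = falseS , λ _ → refl
  convV (suc n) (funT d) (s≤s le) with convC n d le
  ... | d' , k = funS d' , λ r a a' ra → k (ra , r)
  convV (suc n) (handlerT {Γ} {A} {Sg} {u} {E} {D} d p) (s≤s le)
    with convC n d (≤ˡ (size⊨ p) le) | conv⊨-below n p (≤ʳ (sizeC d) le)
  ... | d' , k | c@(conv⊨ cl agree _) =
    handlerS d' cl (conv-sound u (convT n) c) , λ r t t' →
    lift-cong A Sg u E D (λ a a' ra → k (ra , r)) (agree r)
      (EqnSound-resp Sg E D (agree r) (agree r) (conv-sound u (convT n) c _ _ (CtxR-reflʳ Γ r)))

  convC : ∀ n {Γ c C} (d : Γ ⊢c c ∶ C) → sizeC d ≤ n → ConvC d
  convC (suc n) {C = C} (ifT v d₁ d₂) (s≤s le)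
    with convV n v (≤ˡ (sizeC d₁ ⊔ sizeC d₂) le)
       | convC n d₁ (≤ˡ (sizeC d₂) (≤ʳ (sizeV v) le)) | convC n d₂ (≤ʳ (sizeC d₁) (≤ʳ (sizeV v) le))
  ... | v' , k | d₁' , k₁ | d₂' , k₂ = ifS v' d₁' d₂' , λ r → if-cong C (k r) (k₁ r) (k₂ r)
  convC (suc n) (appT v w) (s≤s le) with convV n v (≤ˡ (sizeV w) le) | convV n w (≤ʳ (sizeV v) le)
  ... | v' , k | w' , k' = appS v' w' , λ r → k r _ _ (k' r)
  convC (suc n) (retT v) (s≤s le) with convV n v le
  ... | v' , k = retS v' , λ r → retR (k r)
  convC (suc n) (opT {A = A} {Sg} {u} {E} i e v d) (s≤s le)
    with convV n v (≤ˡ (sizeC d) le) | convC n d (≤ʳ (sizeV v) le)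
  ... | v' , k | d' , k' = opS i e v' d' , λ r → op-cong A Sg u E i (k r) (λ b b' rb → k' (rb , r))
  convC (suc n) (doT {A = A} {B} {Sg} {u} {E} d₁ d₂) (s≤s le)
    with convC n d₁ (≤ˡ (sizeC d₂) le) | convC n d₂ (≤ʳ (sizeC d₁) le)
  ... | d₁' , k₁ | d₂' , k₂ =
    doS d₁' d₂' , λ r → bind-cong A B Sg u E (λ a a' ra → k₂ (ra , r)) (k₁ r)
  convC (suc n) (withT v d) (s≤s le) with convV n v (≤ˡ (sizeC d) le) | convC n d (≤ʳ (sizeV v) le)
  ... | v' , k | d' , k' = withS v' d' , λ r → k r _ _ (k' r)

  convCl : ∀ n {Γ h o A B D} (cl : ClauseFor Γ h o A B D) → sizeCl cl ≤ n →
    Σ[ cl' ∈ SClause Γ h o A B D ] (∀ {η η'} → CtxR Γ η η' → ClauseR A B D (⟦ cl ⟧CL η) (⟪ cl' ⟫cl η'))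
  convCl (suc n) (clause c e d) (s≤s le) with convC n d le
  ... | d' , k = clauseS c e d' , λ r a a' ra κ κ' rκ → k (rκ , ra , r)

  convH : ∀ n {Γ h Sg D} (d : Γ ⊢h h ∶ Sg ⇉ D) → sizeH d ≤ n →
    Σ[ cl ∈ SClauses Γ h Sg D ] (∀ {η η'} → CtxR Γ η η' → AlgR Sg D (⟦ d ⟧H η) (⟪ cl ⟫h η'))
  convH (suc n) {Sg = Sg} {D} (clausesT _ cls _) (s≤s le) =
    clausesS (λ i → proj₁ (cl i)) , λ r → clauses-alg Sg D (λ i → proj₂ (cl i) r)
    where
    cl = λ i → convCl n (cls i) (≤-trans (sup-upper (length Sg) (λ i → sizeCl (cls i)) i) le)

  convT : ∀ n → ConvBelow n
  convT (suc n) (tzT j e v) (s≤s le) = convZ (convV n v le)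
  convT (suc n) (tifT v t₁ t₂) (s≤s le) =
    convIf (convV n v (≤ˡ (sizeT t₁ ⊔ sizeT t₂) le))
      (convT n t₁ (≤ˡ (sizeT t₂) (≤ʳ (sizeV v) le))) (convT n t₂ (≤ʳ (sizeT t₁) (≤ʳ (sizeV v) le)))
  convT (suc n) (topT i e v t) (s≤s le) =
    convOp (convV n v (≤ˡ (sizeT t) le)) (convT n t (≤ʳ (sizeV v) le))

  conv⊨-below : ∀ n {Γ h E Sg D} (p : Γ ⊢ h ⊨ E ∶ Sg ⇉ D) → size⊨ p ≤ n → Conv⊨ n p
  conv⊨-below (suc n) (⊨[] d) (s≤s le) with convH n d le
  ... | cl , k = conv⊨ cl k λ ()
  conv⊨-below (suc n) (⊨∷ p t₁ t₂ e) (s≤s le)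
    with conv⊨-below n p (≤ˡ (size≈C e) (≤ˡ (sizeT t₁ ⊔ sizeT t₂) le))
  ... | conv⊨ cl k eqns = conv⊨ cl k λ
    { (here refl) → weaken-eqn (eqn-from-equiv cl t₁ t₂ le₁ le₂ (convT n t₁ le₁) (convT n t₂ le₂)
                      (soundC n e (≤ʳ (size⊨ p) (≤ˡ (sizeT t₁ ⊔ sizeT t₂) le))))
    ; (there mem) → weaken-eqn (eqns mem) }
    where
    le₁ = ≤ˡ (sizeT t₂) (≤ʳ (size⊨ p ⊔ size≈C e) le)
    le₂ = ≤ʳ (sizeT t₁) (≤ʳ (size⊨ p ⊔ size≈C e) le)

  soundV : ∀ n {Γ v v' A} (e : Γ ⊢v v ≈ v' ∶ A) → size≈V e ≤ n → EquivV Γ v v' A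
  soundV (suc n) (reflV d) (s≤s le) = equivV-refl (ConvV.semV (convV n d le))
  soundV (suc n) (symV e) (s≤s le) = equivV-sym (soundV n e le)
  soundV (suc n) (transV e e') (s≤s le) =
    equivV-trans (soundV n e (≤ˡ (size≈V e') le)) (soundV n e' (≤ʳ (size≈V e) le))
  soundV (suc n) (substV d e) (s≤s le) =
    equivV-subst (ConvV.semV (convV n d (≤ˡ (size≈V e) le))) (soundV n e (≤ʳ (sizeV d) le))
  soundV (suc n) (funV≡ e) (s≤s le) with soundC n e le
  ... | d , d' , k = funS d , funS d' , λ r a a' ra → k (ra , r)
  soundV (suc n) (handlerV≡ {Sg = Sg} p p' e es) (s≤s le) =
    equiv-handler (convT n)
      (conv⊨-below n p (≤ˡ (size⊨ p') (≤ˡ rest le))) (conv⊨-below n p' (≤ʳ (size⊨ p) (≤ˡ rest le)))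
      (soundC n e (≤ˡ (sup (length Sg) (λ i → size≈Cl (es i))) (≤ʳ (size⊨ p ⊔ size⊨ p') le)))
      (λ i → soundCl n (es i) (≤-trans (sup-upper (length Sg) (λ i → size≈Cl (es i)) i)
                                 (≤ʳ (size≈C e) (≤ʳ (size⊨ p ⊔ size⊨ p') le))))
    where rest = size≈C e ⊔ sup (length Sg) (λ i → size≈Cl (es i))
  soundV (suc n) (funη d) (s≤s le) = equiv-funη (ConvV.semV (convV n d le))
  soundV (suc n) (unitη d) (s≤s le) = ConvV.semV (convV n d le) , unitS , λ _ → refl

  soundCl : ∀ n {Γ h h' o A B D} (e : ClauseEqFor Γ h h' o A B D) → size≈Cl e ≤ n →
    Σ[ c ∈ Comp ] Σ[ c' ∈ Comp ] lookupCl h o ≡ just c × lookupCl h' o ≡ just c' ×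
    EquivC ((B ⇾ D) ∷ A ∷ Γ) c c' D
  soundCl (suc n) (clauseEq {c} {c'} e₁ e₂ e) (s≤s le) = c , c' , e₁ , e₂ , soundC n e le

  soundC : ∀ n {Γ c c' C} (e : Γ ⊢c c ≈ c' ∶ C) → size≈C e ≤ n → EquivC Γ c c' C
  soundC (suc n) (reflC d) (s≤s le) = equivC-refl (ConvC.semC (convC n d le))
  soundC (suc n) (symC e) (s≤s le) = equivC-sym (soundC n e le)
  soundC (suc n) (transC e e') (s≤s le) =
    equivC-trans (soundC n e (≤ˡ (size≈C e') le)) (soundC n e' (≤ʳ (size≈C e) le))
  soundC (suc n) (substC d e) (s≤s le) =
    equivC-subst (ConvV.semV (convV n d (≤ˡ (size≈C e) le))) (soundC n e (≤ʳ (sizeV d) le))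
  soundC (suc n) {C = C} (ifC≡ e e₁ e₂) (s≤s le)
    with soundV n e (≤ˡ (size≈C e₁ ⊔ size≈C e₂) le)
       | soundC n e₁ (≤ˡ (size≈C e₂) (≤ʳ (size≈V e) le)) | soundC n e₂ (≤ʳ (size≈C e₁) (≤ʳ (size≈V e) le))
  ... | v , v' , k | d₁ , d₁' , k₁ | d₂ , d₂' , k₂ =
    ifS v d₁ d₂ , ifS v' d₁' d₂' , λ r → if-cong C (k r) (k₁ r) (k₂ r)
  soundC (suc n) (app≡ e e') (s≤s le) with soundV n e (≤ˡ (size≈V e') le) | soundV n e' (≤ʳ (size≈V e) le)
  ... | v , v' , k | w , w' , l = appS v w , appS v' w' , λ r → k r _ _ (l r)
  soundC (suc n) (ret≡ e) (s≤s le) with soundV n e le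
  ... | v , v' , k = retS v , retS v' , λ r → retR (k r)
  soundC (suc n) (opC≡ {A = A} {Sg} {u} {E} i o e e') (s≤s le)
    with soundV n e (≤ˡ (size≈C e') le) | soundC n e' (≤ʳ (size≈V e) le)
  ... | v , v' , k | d , d' , l =
    opS i o v d , opS i o v' d' , λ r → op-cong A Sg u E i (k r) (λ b b' rb → l (rb , r))
  soundC (suc n) (doC≡ {A = A} {B} {Sg} {u} {E} e e') (s≤s le)
    with soundC n e (≤ˡ (size≈C e') le) | soundC n e' (≤ʳ (size≈C e) le)
  ... | d₁ , d₁' , k₁ | d₂ , d₂' , k₂ =
    doS d₁ d₂ , doS d₁' d₂' , λ r → bind-cong A B Sg u E (λ a a' ra → k₂ (ra , r)) (k₁ r)
  soundC (suc n) (withC≡ e e') (s≤s le) with soundV n e (≤ˡ (size≈C e') le) | soundC n e' (≤ʳ (size≈V e) le)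
  ... | v , v' , k | d , d' , l = withS v d , withS v' d' , λ r → k r _ _ (l r)
  soundC (suc n) (ifTrue d₁ d₂) (s≤s le) with convC n d₁ (≤ˡ (sizeC d₂) le) | convC n d₂ (≤ʳ (sizeC d₁) le)
  ... | d₁' , _ | d₂' , _ = ifS trueS d₁' d₂' , d₁' , fundC d₁'
  soundC (suc n) (ifFalse d₁ d₂) (s≤s le) with convC n d₁ (≤ˡ (sizeC d₂) le) | convC n d₂ (≤ʳ (sizeC d₁) le)
  ... | d₁' , _ | d₂' , _ = ifS falseS d₁' d₂' , d₂' , fundC d₂'
  soundC (suc n) (funβ d v) (s≤s le) =
    equiv-funβ (ConvC.semC (convC n d (≤ˡ (sizeV v) le))) (ConvV.semV (convV n v (≤ʳ (sizeC d) le)))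
  soundC (suc n) (doRet v d) (s≤s le) =
    equiv-doRet (ConvV.semV (convV n v (≤ˡ (sizeC d) le))) (ConvC.semC (convC n d (≤ʳ (sizeV v) le)))
  soundC (suc n) (doOp i refl v d₁ d₂) (s≤s le) =
    equiv-doOp i (ConvV.semV (convV n v (≤ˡ (sizeC d₁ ⊔ sizeC d₂) le)))
      (ConvC.semC (convC n d₁ (≤ˡ (sizeC d₂) (≤ʳ (sizeV v) le))))
      (ConvC.semC (convC n d₂ (≤ʳ (sizeC d₁) (≤ʳ (sizeV v) le))))
  soundC (suc n) (withRet d v) (s≤s le) =
    equiv-withRet (ConvV.semV (convV n d (≤ˡ (sizeV v) le))) (ConvV.semV (convV n v (≤ʳ (sizeV d) le)))
  soundC (suc n) (withOp d c e) (s≤s le) =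
    equiv-withOp (ConvV.semV (convV n d (≤ˡ (sizeC c) le))) (ConvC.semC (convC n c (≤ʳ (sizeV d) le))) e
  soundC (suc n) (boolη d v) (s≤s le) =
    equiv-boolη (ConvC.semC (convC n d (≤ˡ (sizeV v) le))) (ConvV.semV (convV n v (≤ʳ (sizeC d) le)))
  soundC (suc n) (doη {A = A} {Sg} {u} {E} d) (s≤s le) with convC n d le
  ... | d' , _ = doS d' (retS (varS here)) , d' , λ r → bind-ret A Sg u E (fundC d' r)
  soundC (suc n) (doAssoc d₁ d₂ d₃) (s≤s le) =
    equiv-doAssoc (ConvC.semC (convC n d₁ (≤ˡ (sizeC d₂ ⊔ sizeC d₃) le)))
      (ConvC.semC (convC n d₂ (≤ˡ (sizeC d₃) (≤ʳ (sizeC d₁) le))))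
      (ConvC.semC (convC n d₃ (≤ʳ (sizeC d₂) (≤ʳ (sizeC d₁) le))))
  soundC (suc n) (inherit mem t₁ t₂ vs fs) (s≤s le) =
    equiv-inherit (convT n) mem t₁ t₂ (≤ˡ (sizeT t₂) (≤ˡ args le)) (≤ʳ (sizeT t₁) (≤ˡ args le))
      (convArgs n vs (≤ˡ (sizeFuns fs) (≤ʳ (sizeT t₁ ⊔ sizeT t₂) le)))
      (convFuns n fs (≤ʳ (sizeArgs vs) (≤ʳ (sizeT t₁ ⊔ sizeT t₂) le)))
    where args = sizeArgs vs ⊔ sizeFuns fs

  convArgs : ∀ n {Γ vs xs} (ds : Pointwise (λ v B → Γ ⊢v v ∶ B) vs xs) → sizeArgs ds ≤ n →
             Sub Γ xs (listS vs)
  convArgs n [] le = []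
  convArgs n (d ∷ ds) le =
    (ConvV.semV (convV n d (≤ˡ (sizeArgs ds) le)) , tt) ∷ convArgs n ds (≤ʳ (sizeV d) le)

  convFuns : ∀ n {Γ C fs zs} (ds : Pointwise (λ f B → Γ ⊢v f ∶ B ⇾ C) fs zs) → sizeFuns ds ≤ n →
             Sub Γ (map (_⇾ C) zs) (listS fs)
  convFuns n [] le = []
  convFuns n (d ∷ ds) le =
    (ConvV.semV (convV n d (≤ˡ (sizeFuns ds) le)) , tt) ∷ convFuns n ds (≤ʳ (sizeV d) le)

-- Comparison with VRel and CRel

mutual
  VRel⇒VR : ∀ A {a a'} → VRel A a a' → VR A a a'
  VRel⇒VR unit r = r
  VRel⇒VR bool r = r
  VRel⇒VR (A ⇾ C) r a a' s = CRel⇒CR C (r a a' (VR⇒VRel A s))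
  VRel⇒VR (C ⇛ D) r t t' s = CRel⇒CR D (r t t' (CR⇒CRel C s))

  VR⇒VRel : ∀ A {a a'} → VR A a a' → VRel A a a'
  VR⇒VRel unit r = r
  VR⇒VRel bool r = r
  VR⇒VRel (A ⇾ C) r a a' s = CR⇒CRel C (r a a' (VRel⇒VR A s))
  VR⇒VRel (C ⇛ D) r t t' s = CR⇒CRel D (r t t' (CRel⇒CR C s))

  CRel⇒CR : ∀ C {t t'} → CRel C t t' → CR C t t'
  CRel⇒CR C@(comp A Sg u E) (symR r) = symR (CRel⇒CR C r)
  CRel⇒CR C@(comp A Sg u E) (transR r s) = transR (CRel⇒CR C r) (CRel⇒CR C s)
  CRel⇒CR C@(comp A Sg u E) (retR r) = retR (VRel⇒VR A r)
  CRel⇒CR C@(comp A Sg u E) (opR i r rs) =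
    opR i (ArRel⇒ArR Sg i r) (λ b b' s → CRel⇒CR C (rs b b' (ResR⇒ResRel Sg i s)))
  CRel⇒CR C@(comp A Sg u E) (eqnR e (t₁ , t₂) r rs) =
    -- Conversion at its own size makes every template derivation stable; in the other direction
    -- stability is simply forgotten.
    eqnR e ((t₁ , t₂) , stable {E = E} {e} (convT (sizeT t₁)) u t₁ ≤-refl
                      , stable {E = E} {e} (convT (sizeT t₂)) u t₂ ≤-refl)
      (EXRel⇒EXR E e r) (λ j b b' s → CRel⇒CR C (rs j b b' (EZR⇒EZRel E e j s)))

  CR⇒CRel : ∀ C {t t'} → CR C t t' → CRel C t t'
  CR⇒CRel C@(comp A Sg u E) (symR r) = symR (CR⇒CRel C r)
  CR⇒CRel C@(comp A Sg u E) (transR r s) = transR (CR⇒CRel C r) (CR⇒CRel C s)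
  CR⇒CRel C@(comp A Sg u E) (retR r) = retR (VR⇒VRel A r)
  CR⇒CRel C@(comp A Sg u E) (opR i r rs) =
    opR i (ArR⇒ArRel Sg i r) (λ b b' s → CR⇒CRel C (rs b b' (ResRel⇒ResR Sg i s)))
  CR⇒CRel C@(comp A Sg u E) (eqnR e (d , _) r rs) =
    eqnR e d (EXR⇒EXRel E e r) (λ j b b' s → CR⇒CRel C (rs j b b' (EZRel⇒EZR E e j s)))

  ArRel⇒ArR : ∀ Sg i {a a'} → ArRel Sg i a a' → ArR Sg i a a'
  ArRel⇒ArR ((_ , A , _) ∷ Sg) fzero r = VRel⇒VR A r
  ArRel⇒ArR (_ ∷ Sg) (fsuc i) r = ArRel⇒ArR Sg i r

  ArR⇒ArRel : ∀ Sg i {a a'} → ArR Sg i a a' → ArRel Sg i a a'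
  ArR⇒ArRel ((_ , A , _) ∷ Sg) fzero r = VR⇒VRel A r
  ArR⇒ArRel (_ ∷ Sg) (fsuc i) r = ArR⇒ArRel Sg i r

  ResRel⇒ResR : ∀ Sg i {b b'} → ResRel Sg i b b' → ResR Sg i b b'
  ResRel⇒ResR ((_ , _ , B) ∷ Sg) fzero r = VRel⇒VR B r
  ResRel⇒ResR (_ ∷ Sg) (fsuc i) r = ResRel⇒ResR Sg i r

  ResR⇒ResRel : ∀ Sg i {b b'} → ResR Sg i b b' → ResRel Sg i b b'
  ResR⇒ResRel ((_ , _ , B) ∷ Sg) fzero r = VR⇒VRel B r
  ResR⇒ResRel (_ ∷ Sg) (fsuc i) r = ResR⇒ResRel Sg i r

  CtxRel⇒CtxR : ∀ Γ {η η'} → CtxRel Γ η η' → CtxR Γ η η'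
  CtxRel⇒CtxR [] r = tt
  CtxRel⇒CtxR (A ∷ Γ) (r , rs) = VRel⇒VR A r , CtxRel⇒CtxR Γ rs

  CtxR⇒CtxRel : ∀ Γ {η η'} → CtxR Γ η η' → CtxRel Γ η η'
  CtxR⇒CtxRel [] r = tt
  CtxR⇒CtxRel (A ∷ Γ) (r , rs) = VR⇒VRel A r , CtxR⇒CtxRel Γ rs

  ZjRel⇒ZjR : ∀ zs j {b b'} → ZjRel zs j b b' → ZjR zs j b b'
  ZjRel⇒ZjR (B ∷ zs) fzero r = VRel⇒VR B r
  ZjRel⇒ZjR (B ∷ zs) (fsuc j) r = ZjRel⇒ZjR zs j r

  ZjR⇒ZjRel : ∀ zs j {b b'} → ZjR zs j b b' → ZjRel zs j b b'
  ZjR⇒ZjRel (B ∷ zs) fzero r = VR⇒VRel B r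
  ZjR⇒ZjRel (B ∷ zs) (fsuc j) r = ZjR⇒ZjRel zs j r

  EXRel⇒EXR : ∀ E e {as as'} → EXRel E e as as' → EXR E e as as'
  EXRel⇒EXR (eqn xs _ _ _ ∷ E) fzero r = CtxRel⇒CtxR xs r
  EXRel⇒EXR (eqn _ _ _ _ ∷ E) (fsuc e) r = EXRel⇒EXR E e r

  EXR⇒EXRel : ∀ E e {as as'} → EXR E e as as' → EXRel E e as as'
  EXR⇒EXRel (eqn xs _ _ _ ∷ E) fzero r = CtxR⇒CtxRel xs r
  EXR⇒EXRel (eqn _ _ _ _ ∷ E) (fsuc e) r = EXR⇒EXRel E e r

  EZRel⇒EZR : ∀ E e j {b b'} → EZRel E e j b b' → EZR E e j b b'
  EZRel⇒EZR (eqn _ zs _ _ ∷ E) fzero j r = ZjRel⇒ZjR zs j r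
  EZRel⇒EZR (eqn _ _ _ _ ∷ E) (fsuc e) j r = EZRel⇒EZR E e j r

  EZR⇒EZRel : ∀ E e j {b b'} → EZR E e j b b' → EZRel E e j b b'
  EZR⇒EZRel (eqn _ zs _ _ ∷ E) fzero j r = ZjR⇒ZjRel zs j r
  EZR⇒EZRel (eqn _ _ _ _ ∷ E) (fsuc e) j r = EZR⇒EZRel E e j r

-- Soundness of handlers and of derived equations

theorem3 : (∀ {Γ h E Sg D} (p : Γ ⊢ h ⊨ E ∶ Sg ⇉ D) {xs zs T₁ T₂} → eqn xs zs T₁ T₂ ∈ E →
    (d₁ : TmplTy Sg zs xs T₁) (d₂ : TmplTy Sg zs xs T₂) →
    ∀ η η' → CtxRel Γ η η' →
    ∀ as as' → CtxRel xs as as' →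
    ∀ (fs fs' : (j : Fin (length zs)) → ⟦ lookup zs j ⟧v → ⟦ D ⟧c) →
    (∀ j → VRel (lookup zs j ⇾ D) (fs j) (fs' j)) →
    CRel D (⟦ d₁ ⟧T (⟦ p ⟧⊨ η) as fs) (⟦ d₂ ⟧T (⟦ p ⟧⊨ η') as' fs'))
    ×
    (∀ {Γ} (η η' : ⟦ Γ ⟧x) → CtxRel Γ η η' →
    (∀ {v v' A} → Γ ⊢v v ≈ v' ∶ A → (d : Γ ⊢v v ∶ A) (d' : Γ ⊢v v' ∶ A) →
    VRel A (⟦ d ⟧V η) (⟦ d' ⟧V η'))
    ×
    (∀ {c c' C} → Γ ⊢c c ≈ c' ∶ C → (d : Γ ⊢c c ∶ C) (d' : Γ ⊢c c' ∶ C) →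
    CRel C (⟦ d ⟧C η) (⟦ d' ⟧C η')))
theorem3 = sound , λ {Γ} η η' r →
  (λ {_} {_} {A} e d d' → VR⇒VRel A (values e d d' (CtxRel⇒CtxR Γ r))) ,
  (λ {_} {_} {C} e d d' → CR⇒CRel C (computations e d d' (CtxRel⇒CtxR Γ r)))
  where
  -- The typings `d` and `d'` are unrelated to the derivation of the equation: each is converted,
  -- and coherence passes to the semantic typings that `soundV` produces.
  values : ∀ {Γ v v' A} → Γ ⊢v v ≈ v' ∶ A → (d : Γ ⊢v v ∶ A) (d' : Γ ⊢v v' ∶ A) →
           ∀ {η η'} → CtxR Γ η η' → VR A (⟦ d ⟧V η) (⟦ d' ⟧V η')
  values {Γ} {A = A} e d d' r
    with soundV _ e ≤-refl | convV _ d ≤-refl | convV _ d' ≤-refl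
  ... | x , x' , k | w , l | w' , l' =
    VR-trans A (l (CtxR-reflˡ Γ r)) (VR-trans A (coherentV w x (CtxR-reflˡ Γ r))
      (VR-trans A (k r) (VR-trans A (coherentV x' w' (CtxR-reflʳ Γ r)) (VR-sym A (l' (CtxR-reflʳ Γ r))))))

  computations : ∀ {Γ c c' C} → Γ ⊢c c ≈ c' ∶ C → (d : Γ ⊢c c ∶ C) (d' : Γ ⊢c c' ∶ C) →
                 ∀ {η η'} → CtxR Γ η η' → CR C (⟦ d ⟧C η) (⟦ d' ⟧C η')
  computations {Γ} {C = C} e d d' r
    with soundC _ e ≤-refl | convC _ d ≤-refl | convC _ d' ≤-refl
  ... | x , x' , k | w , l | w' , l' =
    CR-trans C (l (CtxR-reflˡ Γ r)) (CR-trans C (coherentC w x (CtxR-reflˡ Γ r))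
      (CR-trans C (k r) (CR-trans C (coherentC x' w' (CtxR-reflʳ Γ r)) (CR-sym C (l' (CtxR-reflʳ Γ r))))))

  -- A handler judgment does not make the names in `Sg` distinct, so the trees of `t` and `t'` may
  -- differ. Under the clauses they still agree: clauses are found by name, so equally named
  -- declarations share a body.
  templates : ∀ {Γ h Sg zs xs D T} (cl : SClauses Γ h Sg D) {t t' : TmplTy Sg zs xs T} →
    ConvT t → ConvT t' → ∀ {H η as fs} → AlgR Sg D H (⟪ cl ⟫h η) → CtxR Γ η η → CtxR xs as as →
    FunsR zs D fs fs → CR D (⟦ t ⟧T H as fs) (⟦ t' ⟧T (⟪ cl ⟫h η) as fs)
  templates {Γ} {Sg = Sg} {zs} {xs} {D} cl c c' rH r ra rf =
    CR-trans D (template-resp Sg zs D c rH ra rf)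
      (CS⇒CR D (template-coherent Sg zs D c c' (fundH cl r) (fundH cl r) (cohH cl cl (CtxR⇒CtxS Γ r))
        (CtxR⇒CtxS xs ra) rf))

  sound : ∀ {Γ h E Sg D} (p : Γ ⊢ h ⊨ E ∶ Sg ⇉ D) {xs zs T₁ T₂} → eqn xs zs T₁ T₂ ∈ E →
    (d₁ : TmplTy Sg zs xs T₁) (d₂ : TmplTy Sg zs xs T₂) →
    ∀ η η' → CtxRel Γ η η' → ∀ as as' → CtxRel xs as as' →
    ∀ (fs fs' : (j : Fin (length zs)) → ⟦ lookup zs j ⟧v → ⟦ D ⟧c) →
    (∀ j → VRel (lookup zs j ⇾ D) (fs j) (fs' j)) →
    CRel D (⟦ d₁ ⟧T (⟦ p ⟧⊨ η) as fs) (⟦ d₂ ⟧T (⟦ p ⟧⊨ η') as' fs')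
  sound {Γ} {D = D} p {xs} {zs} mem d₁ d₂ η η' r as as' ra fs fs' rf
    with conv⊨-below _ p ≤-refl
  ... | conv⊨ cl agree eqns = CR⇒CRel D
    (CR-trans D
      (templates cl (convT _ d₁ ≤-refl) convˡ (agree rˡ) rˡ (CtxR-reflˡ xs ra') (FunsR-reflˡ zs D rf'))
      (CR-trans D (holds r' ra' rf')
        (CR-sym D (templates cl (convT _ d₂ ≤-refl) convʳ (agree rʳ) rʳ (CtxR-reflʳ xs ra')
          (FunsR-reflʳ zs D rf')))))
    where
    open ConvEqn (eqns mem)
    r' = CtxRel⇒CtxR Γ r
    rˡ = CtxR-reflˡ Γ r'
    rʳ = CtxR-reflʳ Γ r'
    ra' = CtxRel⇒CtxR xs ra
    rf' : FunsR zs D fs fs'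
    rf' j = VRel⇒VR (lookup zs j ⇾ D) (rf j)
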